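{- Let $q$ be an odd prime power. Every non-classical orthogonal Buekenhout-Metz unital $\mathcal U_{a,b}$ in $\mathrm{PG}(2,q^2)$ contains a BM-special Triple O'Nan configuration, with the exception of the conic unitals for $q=3$ and $q=5$ (which contain no BM-special Triple O'Nan configuration).
   Context: Points of $\mathrm{PG}(2,q^2)$ are written in homogeneous coordinates $(x,y,z)$. For $q$ odd and $a,b\in\mathbb F_{q^2}$ such that $d=(b-b^q)^2+4a^{q+1}$ is a non-square in $\mathbb F_q$, the orthogonal Buekenhout-Metz (BM) unital is $$\mathcal U_{a,b}=\{(x,ax^2+bx^{q+1}+r,1)\mid r\in\mathbb F_q,\ x\in\mathbb F_{q^2}\}\cup\{T_\infty=(0,1,0)\}.$$ It is classical if and only if $a=0$. The point $T_\infty$ is called the special point. A conic unital is a non-classical BM unital of the form $\mathcal U_{a,0}$ (in which case $a$ is necessarily a non-square in $\mathbb F_{q^2}$), or one equivalent to such a unital under the automorphism group of the plane $\mathrm{PG}(2,q^2)$. A Triple O'Nan configuration of $\mathcal U$ is a set of six lines arising as follows: there is a quadrangle of four points of $\mathcal U$ (no three collinear) such that, for each of the three partitions of the four points into two pairs, the two lines joining the pairs meet in a point of $\mathcal U$; the six lines joining pairs of the four points form the Triple O'Nan. It is called BM-special if one of its six lines (as a line of $\mathrm{PG}(2,q^2)$) contains $T_\infty$. -}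

module Defs where

open import Algebra.Apartness.Bundles using (HeytingField; HeytingCommutativeRing)
open import Algebra.Bundles using (CommutativeRing)
import Algebra.Apartness.Properties.HeytingCommutativeRing as HeytingProperties
import Algebra.Properties.Monoid.Mult as Mult
import Algebra.Properties.Monoid.Sum as Sum
import Algebra.Properties.Semiring.Exp as Exp
open import Data.Fin.Base using (Fin)
open import Data.Fin.Patterns using (0F; 1F; 2F; 3F)
open import Data.Nat.Base using (ℕ; _≤_)
import Data.Nat.Base as ℕ
open import Data.Nat.Divisibility using (_∤_)
open import Data.Nat.Primality using (Prime)
open import Data.Product using (Σ-syntax; ∃-syntax; _×_; _,_; proj₁; proj₂)
open import Data.Sum.Base using (_⊎_)
open import Data.Vec.Functional using (Vector; []; _∷_)
open import Function.Bundles using (Inverse; _⇔_)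
open import Level using (_⊔_) renaming (suc to lsuc)
open import Relation.Binary.Bundles using (Setoid)
open import Relation.Binary.PropositionalEquality as ≡ using (_≡_; _≢_)
open import Relation.Nullary.Negation using (¬_)
open import Relation.Unary using (Pred; _∈_)

OddPrimePower : ℕ → Set
OddPrimePower q = ∃[ p ] ∃[ n ] Prime p × 1 ≤ n × q ≡ p ℕ.^ n × 2 ∤ q

-- A Heyting field of finite size is discrete: x # y is then equivalent
-- to ¬ x ≈ y, and every element other than 0# is invertible.
HasSize : ∀ {c ℓ₁ ℓ₂} → HeytingField c ℓ₁ ℓ₂ → ℕ → Set (c ⊔ ℓ₁)
HasSize F n = Inverse setoid (≡.setoid (Fin n))
  where
  open HeytingField F using (heytingCommutativeRing)
  open HeytingCommutativeRing heytingCommutativeRing using (commutativeRing)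
  open CommutativeRing commutativeRing using (setoid)

-- The plane PG(2,q²) over F, for F a field of size q².  The size is not
-- needed to state the definitions, so it is not a parameter here.
module Plane {c ℓ₁ ℓ₂} (F : HeytingField c ℓ₁ ℓ₂) (q : ℕ) where

  open HeytingField F
    using ( Carrier; _≈_; _#_; _+_; _*_; _-_; 0#; 1#; heytingCommutativeRing
          ; #⇒invertible; invertible⇒#; sym; trans; *-cong; *-congˡ; *-congʳ
          ; *-assoc; *-identityˡ )
  open HeytingCommutativeRing heytingCommutativeRing using (commutativeRing)
  open CommutativeRing commutativeRing using (+-monoid; semiring)
  open Sum +-monoid using (sum)
  open Mult +-monoid using () renaming (_×_ to _·_)
  open Exp semiring using (_^_)
  open HeytingProperties heytingCommutativeRing using (1#0; x#0y#0→xy#0; x-0≈x)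

  -- The subfield of order q is the fixed field of x ↦ x ^ q.
  𝔽q : Pred Carrier ℓ₁
  𝔽q x = x ^ q ≈ x

  NonSquareIn𝔽q : Pred Carrier (c ⊔ ℓ₁)
  NonSquareIn𝔽q d = ¬ (∃[ s ] s ∈ 𝔽q × s * s ≈ d)

  Coords : Set c
  Coords = Vector Carrier 3

  Homogeneous : Set (c ⊔ ℓ₂)
  Homogeneous = Σ[ v ∈ Coords ] ∃[ i ] v i # 0#

  coords : Homogeneous → Coords
  coords = proj₁

  infix 4 _∼_
  _∼_ : Homogeneous → Homogeneous → Set (c ⊔ ℓ₁ ⊔ ℓ₂)
  v ∼ w = ∃[ k ] k # 0# × (∀ i → coords v i ≈ k * coords w i)

  private
    inverse : ∀ {k} → k # 0# → ∃[ k⁻¹ ] k⁻¹ # 0# × k⁻¹ * k ≈ 1#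
    inverse {k} k#0 with #⇒invertible k#0
    ... | j , jk , kj = j , invertible⇒# (k , left , right) , jk′
      where
      jk′ : j * k ≈ 1#
      jk′ = trans (*-congˡ (sym (x-0≈x k))) jk
      right : (j - 0#) * k ≈ 1#
      right = trans (*-congʳ (x-0≈x j)) jk′
      left : k * (j - 0#) ≈ 1#
      left = trans (*-cong (sym (x-0≈x k)) (x-0≈x j)) kj

    ∼-refl : ∀ {v} → v ∼ v
    ∼-refl = 1# , 1#0 , λ _ → sym (*-identityˡ _)

    ∼-sym : ∀ {v w} → v ∼ w → w ∼ v
    ∼-sym (k , k#0 , v≈kw) with inverse k#0
    ... | j , j#0 , jk = j , j#0 , λ i →
      trans (sym (*-identityˡ _)) (trans (*-congʳ (sym jk))
        (trans (*-assoc _ _ _) (*-congˡ (sym (v≈kw i)))))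

    ∼-trans : ∀ {u v w} → u ∼ v → v ∼ w → u ∼ w
    ∼-trans (k , k#0 , u≈kv) (l , l#0 , v≈lw) =
      k * l , x#0y#0→xy#0 k#0 l#0 , λ i →
      trans (u≈kv i) (trans (*-congˡ (v≈lw i)) (sym (*-assoc _ _ _)))

  homogeneousSetoid : Setoid (c ⊔ ℓ₂) (c ⊔ ℓ₁ ⊔ ℓ₂)
  homogeneousSetoid = record
    { Carrier = Homogeneous
    ; _≈_ = _∼_
    ; isEquivalence = record
      { refl  = λ {v} → ∼-refl {v}
      ; sym   = λ {v w} → ∼-sym {v} {w}
      ; trans = λ {u v w} → ∼-trans {u} {v} {w}
      }
    }

  -- The line (l , m , n) consists of the points (x , y , z)
  -- with l x + m y + n z = 0.
  Point Line : Set (c ⊔ ℓ₂)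
  Point = Homogeneous
  Line  = Homogeneous

  infix 4 _on_
  _on_ : Point → Line → Set ℓ₁
  P on l = sum (λ i → coords l i * coords P i) ≈ 0#

  record Automorphism : Set (c ⊔ ℓ₁ ⊔ ℓ₂) where
    field
      onPoints  : Inverse homogeneousSetoid homogeneousSetoid
      onLines   : Inverse homogeneousSetoid homogeneousSetoid
      incidence : ∀ P l → P on l ⇔ Inverse.to onPoints P on Inverse.to onLines l

  PointSet : Set (lsuc (c ⊔ ℓ₁ ⊔ ℓ₂))
  PointSet = Pred Point (c ⊔ ℓ₁ ⊔ ℓ₂)

  Equivalent : PointSet → PointSet → Set (c ⊔ ℓ₁ ⊔ ℓ₂)
  Equivalent S T = Σ[ φ ∈ Automorphism ]
    (∀ P → P ∈ S ⇔ Inverse.to (Automorphism.onPoints φ) P ∈ T)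

  record NondegenerateHermitian (h : Fin 3 → Fin 3 → Carrier) : Set (c ⊔ ℓ₁) where
    field
      hermitian     : ∀ i j → h j i ≈ h i j ^ q
      nondegenerate : ∀ (v : Coords) → (∀ i → sum (λ j → h i j * v j) ≈ 0#) → ∀ i → v i ≈ 0#

  -- A classical unital is a nondegenerate Hermitian curve, i.e. the set of
  -- absolute points of a unitary polarity.
  Classical : PointSet → Set (c ⊔ ℓ₁ ⊔ ℓ₂)
  Classical S = ∃[ h ] NondegenerateHermitian h × (∀ P → P ∈ S ⇔
    sum (λ i → sum (λ j → coords P i * h i j * coords P j ^ q)) ≈ 0#)

  affine : Carrier → Carrier → Point
  affine x y = (x ∷ y ∷ 1# ∷ []) , 2F , 1#0

  T∞ : Point
  T∞ = (0# ∷ 1# ∷ 0# ∷ []) , 1F , 1#0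

  -- The element d = (b - b ^ q)² + 4 a ^ (q + 1) always lies in 𝔽q.
  Admissible : Carrier → Carrier → Set (c ⊔ ℓ₁)
  Admissible a b = NonSquareIn𝔽q ((b - b ^ q) ^ 2 + 4 · (a ^ (q ℕ.+ 1)))

  𝓤 : Carrier → Carrier → PointSet
  𝓤 a b P =
    (∃[ x ] ∃[ r ] r ∈ 𝔽q × P ∼ affine x (a * x ^ 2 + b * x ^ (q ℕ.+ 1) + r))
    ⊎ P ∼ T∞

  ConicUnital : PointSet → Set (c ⊔ ℓ₁ ⊔ ℓ₂)
  ConicUnital S = ∃[ a ]
    Admissible a 0# × ¬ Classical (𝓤 a 0#) × Equivalent S (𝓤 a 0#)

  -- The two pairs making up each of the three partitions of four points.
  pair : Fin 3 → Fin 2 → Fin 4 × Fin 4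
  pair 0F 0F = 0F , 1F
  pair 0F 1F = 2F , 3F
  pair 1F 0F = 0F , 2F
  pair 1F 1F = 1F , 3F
  pair 2F 0F = 0F , 3F
  pair 2F 1F = 1F , 2F

  record TripleO'Nan (S : PointSet) : Set (c ⊔ ℓ₁ ⊔ ℓ₂) where
    field
      vertex     : Fin 4 → Point
      vertex∈    : ∀ i → vertex i ∈ S
      quadrangle : ∀ i j k → i ≢ j → j ≢ k → i ≢ k →
                   ¬ (∃[ l ] vertex i on l × vertex j on l × vertex k on l)
      side       : Fin 3 → Fin 2 → Line
      joins      : ∀ π s → vertex (proj₁ (pair π s)) on side π s
                         × vertex (proj₂ (pair π s)) on side π s
      meet       : ∀ π → ∃[ M ] M ∈ S × M on side π 0F × M on side π 1F

  BMSpecial : ∀ {S} → TripleO'Nan S → Set ℓ₁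
  BMSpecial t = ∃[ π ] ∃[ s ] T∞ on TripleO'Nan.side t π s

  ContainsBMSpecialTripleO'Nan : PointSet → Set (c ⊔ ℓ₁ ⊔ ℓ₂)
  ContainsBMSpecialTripleO'Nan S = Σ[ t ∈ TripleO'Nan S ] BMSpecial t

{-# OPTIONS --safe #-}
module Submission where

open import Defs
open import Algebra.Apartness.Bundles using (HeytingField; HeytingCommutativeRing)
import Algebra.Apartness.Properties.HeytingCommutativeRing as HeytingProperties
open import Algebra.Bundles using (CommutativeRing)
import Algebra.Properties.AbelianGroup as AbelianGroupProperties
import Algebra.Properties.CommutativeMonoid.Sum as CommutativeSum
import Algebra.Properties.CommutativeSemiring.Binomial as Binomial
import Algebra.Properties.CommutativeSemiring.Exp as CommutativeExp
import Algebra.Properties.Ring as RingProperties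
import Algebra.Properties.Semiring.Exp as Exp
import Algebra.Properties.Semiring.Mult as SemiringMult
import Algebra.Properties.Semiring.Mult.TCOptimised as Mult′
import Algebra.Solver.Ring as Solver
open import Algebra.Solver.Ring.AlmostCommutativeRing
  using (_-Raw-AlmostCommutative⟶_; fromCommutativeRing)
open import Data.Bool.Base using (T)
open import Data.Empty using (⊥)
open import Data.Fin.Base using (Fin; zero; suc; toℕ; inject≤; inject₁; fromℕ)
open import Data.Fin.Patterns using (0F; 1F; 2F; 3F)
open import Data.Fin.Permutation using (permutation)
import Data.Fin.Properties as Fin
open import Data.Integer.Base as ℤ using (ℤ; +_; -[1+_]; _⊖_; _◃_)
import Data.Integer.Properties as ℤ
open import Data.Maybe.Base using (Maybe; just; nothing; is-just; map)
open import Data.Nat.Base as ℕ using (ℕ; zero; suc; _≤_; _<_; z≤n; s≤s; _!; _∸_)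
open import Data.Nat.Combinatorics using (k![n∸k]!∣n!; nCn≡1; nCk≡n!/k![n-k]!)
  renaming (_C_ to _choose_)
open import Data.Nat.Divisibility using (_∣_; _∤_; divides; m∣m*n; ∣⇒≤; ∣1⇒≡1; m%n≡0⇒n∣m)
open import Data.Nat.DivMod using (_%_; _/_; m≡m%n+[m/n]*n; m%n<n; m/n*n≡m)
open import Data.Nat.Primality using (Prime; euclidsLemma; prime⇒nonTrivial)
import Data.Nat.Properties as ℕ
open import Data.Product.Base using (∃; ∃-syntax; _×_; _,_; proj₁; proj₂)
import Data.Sign.Base as Sign
open import Data.Sum.Base using (_⊎_; inj₁; inj₂; [_,_]′)
open import Data.Vec.Base as Vec using (Vec; []; _∷_)
open import Data.Vec.N-ary using (N-ary; _$ⁿ_)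
open import Data.Vec.Functional using (Vector; replicate; removeAt; init)
import Data.Vec.Functional as Functional
open import Function.Base using (_∘_)
open import Function.Bundles using (Inverse; Equivalence; _⇔_; mk⇔)
import Function.Construct.Identity as Identity
import Level
import Relation.Binary.Reasoning.Setoid as SetoidReasoning
open import Relation.Binary.Definitions using (Decidable)
open import Relation.Binary.Bundles using (Setoid)
open import Relation.Binary.PropositionalEquality as ≡ using (_≡_; _≢_)
open import Relation.Nullary.Decidable
  using (Dec; yes; no; dec⇒maybe; map′; toWitness; ¬?; _→-dec_; _⊎-dec_; _×-dec_)
open import Relation.Nullary.Negation using (¬_; contradiction)

-- Put the special side on x = 0, with the diagonal point on it at the origin.
-- In the dual coordinate w = 1/x the other four points of the configuration
-- are p (1 ± n) and p (1 ± κ n) with κ ∈ 𝔽q ∖ {0, ±1} and n ∉ 𝔽q, and they lie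
-- on the unital exactly when a p̄ / p is an 𝔽q-multiple of
-- n̄ (n - n̄) (1 - n²) (1 - κ² n²); the parameter b drops out.  If the norm of a
-- is a square in 𝔽q, this is solved by n with n̄ = -n.  Otherwise -N(a) = ι² in
-- the plane's field, and n = ν / s, κ = s² with ν of norm ±1 is a solution as
-- soon as s ∈ 𝔽q has s⁵ ≠ s, which is possible for q ≥ 7.  For q = 3 there is no
-- κ, and for q = 5 one has κ² = -1 and n⁵ = n̄, which turns the condition into
-- "N(a) is a square"; this fails for conic unitals and holds when b ∉ 𝔽q.
-- Finally T∞ lies on no O'Nan configuration while the affine points of a conic
-- unital do, so an equivalence with a conic unital fixes T∞.

-- By Hilbert 90, `p̄ / p` can be any element of norm 1, so the condition on `a` only concerns
-- norms: `N(a)` and the norm of `n̄ (n - n̄) (1 - n²) (1 - κ² n²)` must agree up to a nonzero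
-- square of 𝔽q. For `n̄ = - n` the product itself lies in 𝔽q. For `n = ν / s`, `κ = s²` and `ν` of
-- norm `ε = ±1`, the factor `1 - κ² n² = 1 - s² ν²` is `- ν²` times the conjugate of `s² - ν²`. The
-- two factors pair to a norm, and an 𝔽q-multiple of `ν (ν - ν̄)` remains. Its norm is a square
-- times `- ε (ν - ν̄)²`, a nonsquare if `ε = -1` or if -1 is a square of 𝔽q. The condition `s⁵ ≠ s`
-- says that `s²` is none of 0, 1, -1. These values of κ are degenerate: ±1 moves a vertex of the
-- special side onto its diagonal point, and 0 makes the other two diagonal points collinear with
-- T∞, which forces three points of the unital on one line to have abscissae collinear over 𝔽q. For
-- q = 5 the product is `(n - n̄)² n̄ / n`, whose norm is a square.

-- Ring identities with integer coefficients

module IntegerSolver {c ℓ} (R : CommutativeRing c ℓ) where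
  open CommutativeRing R
  open RingProperties ring
    using (-‿distribˡ-*; -‿distribʳ-*; -‿involutive; -0#≈0#)
  open AbelianGroupProperties +-abelianGroup using (⁻¹-∙-comm)
  open Mult′ semiring using (×1-homo-*; ×-homo-+; 1+×) renaming (_×_ to _·_)
  open SetoidReasoning setoid

  ⟦_⟧ᶻ : ℤ → Carrier
  ⟦ + n      ⟧ᶻ = n · 1#
  ⟦ -[1+ n ] ⟧ᶻ = - (suc n · 1#)

  ⊖-homo : ∀ m n → ⟦ m ⊖ n ⟧ᶻ ≈ m · 1# - n · 1#
  ⊖-homo m zero = sym (trans (+-congˡ -0#≈0#) (+-identityʳ _))
  ⊖-homo zero (suc n) = sym (+-identityˡ _)
  ⊖-homo (suc m) (suc n) = begin
    ⟦ suc m ⊖ suc n ⟧ᶻ              ≡⟨ ≡.cong ⟦_⟧ᶻ (ℤ.[1+m]⊖[1+n]≡m⊖n m n) ⟩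
    ⟦ m ⊖ n ⟧ᶻ                      ≈⟨ ⊖-homo m n ⟩
    m · 1# - n · 1#                 ≈⟨ +-congʳ (+-identityʳ _) ⟨
    m · 1# + 0# - n · 1#            ≈⟨ +-congʳ (+-congˡ (-‿inverseʳ 1#)) ⟨
    m · 1# + (1# - 1#) - n · 1#     ≈⟨ +-congʳ (+-assoc _ _ _) ⟨
    m · 1# + 1# - 1# - n · 1#       ≈⟨ +-assoc _ _ _ ⟩
    m · 1# + 1# + (- 1# - n · 1#)   ≈⟨ +-cong (+-comm _ _) (⁻¹-∙-comm _ _) ⟩
    1# + m · 1# - (1# + n · 1#)     ≈⟨ +-cong (1+× m 1#) (-‿cong (1+× n 1#)) ⟨
    suc m · 1# - suc n · 1#         ∎

  +-homo : ∀ i j → ⟦ i ℤ.+ j ⟧ᶻ ≈ ⟦ i ⟧ᶻ + ⟦ j ⟧ᶻ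
  +-homo (+ m)    (+ n)    = ×-homo-+ 1# m n
  +-homo (+ m)    -[1+ n ] = ⊖-homo m (suc n)
  +-homo -[1+ m ] (+ n)    = trans (⊖-homo n (suc m)) (+-comm _ _)
  +-homo -[1+ m ] -[1+ n ] = begin
    - (suc (suc (m ℕ.+ n)) · 1#)         ≡⟨ ≡.cong (λ k → - (k · 1#)) (≡.cong suc (ℕ.+-suc m n)) ⟨
    - ((suc m ℕ.+ suc n) · 1#)           ≈⟨ -‿cong (×-homo-+ 1# (suc m) (suc n)) ⟩
    - (suc m · 1# + suc n · 1#)          ≈⟨ ⁻¹-∙-comm _ _ ⟨
    - (suc m · 1#) + - (suc n · 1#)      ∎

  -‿homo : ∀ i → ⟦ ℤ.- i ⟧ᶻ ≈ - ⟦ i ⟧ᶻ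
  -‿homo (+ zero)  = sym -0#≈0#
  -‿homo (+ suc n) = refl
  -‿homo -[1+ n ]  = sym (-‿involutive _)

  *-homo : ∀ i j → ⟦ i ℤ.* j ⟧ᶻ ≈ ⟦ i ⟧ᶻ * ⟦ j ⟧ᶻ
  *-homo (+ m)    (+ n)    = trans (reflexive (≡.cong ⟦_⟧ᶻ (ℤ.+◃n≡+n (m ℕ.* n)))) (×1-homo-* m n)
  *-homo (+ m)    -[1+ n ] = begin
    ⟦ Sign.- ◃ m ℕ.* suc n ⟧ᶻ   ≡⟨ ≡.cong ⟦_⟧ᶻ (ℤ.-◃n≡-n (m ℕ.* suc n)) ⟩
    ⟦ ℤ.- (+ (m ℕ.* suc n)) ⟧ᶻ  ≈⟨ -‿homo (+ (m ℕ.* suc n)) ⟩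
    - ((m ℕ.* suc n) · 1#)      ≈⟨ -‿cong (×1-homo-* m (suc n)) ⟩
    - (m · 1# * suc n · 1#)     ≈⟨ -‿distribʳ-* _ _ ⟩
    m · 1# * - (suc n · 1#)     ∎
  *-homo -[1+ m ] (+ n)    = begin
    ⟦ Sign.- ◃ suc m ℕ.* n ⟧ᶻ   ≡⟨ ≡.cong ⟦_⟧ᶻ (ℤ.-◃n≡-n (suc m ℕ.* n)) ⟩
    ⟦ ℤ.- (+ (suc m ℕ.* n)) ⟧ᶻ  ≈⟨ -‿homo (+ (suc m ℕ.* n)) ⟩
    - ((suc m ℕ.* n) · 1#)      ≈⟨ -‿cong (×1-homo-* (suc m) n) ⟩
    - (suc m · 1# * n · 1#)     ≈⟨ -‿distribˡ-* _ _ ⟩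
    - (suc m · 1#) * n · 1#     ∎
  *-homo -[1+ m ] -[1+ n ] = begin
    (suc m ℕ.* suc n) · 1#              ≈⟨ ×1-homo-* (suc m) (suc n) ⟩
    suc m · 1# * suc n · 1#             ≈⟨ -‿involutive _ ⟨
    - - (suc m · 1# * suc n · 1#)       ≈⟨ -‿cong (-‿distribʳ-* _ _) ⟩
    - (suc m · 1# * - (suc n · 1#))     ≈⟨ -‿distribˡ-* _ _ ⟩
    - (suc m · 1#) * - (suc n · 1#)     ∎

  morphism : ℤ.+-*-rawRing -Raw-AlmostCommutative⟶ fromCommutativeRing R
  morphism = record
    { ⟦_⟧ = ⟦_⟧ᶻ ; +-homo = +-homo ; *-homo = *-homo ; -‿homo = -‿homo
    ; 0-homo = refl ; 1-homo = refl }

  open Solver ℤ.+-*-rawRing (fromCommutativeRing R) morphism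
    (λ i j → map (λ i≡j → reflexive (≡.cong ⟦_⟧ᶻ i≡j)) (dec⇒maybe (i ℤ.≟ j))) public
    using (Polynomial; con; var; _:+_; _:*_; _:-_; :-_; ⟦_⟧; ⟦_⟧N-cong; _≟N_; prove; normalise)

  :0 :1 : ∀ {n} → Polynomial n
  :0 = con (+ 0)
  :1 = con (+ 1)

  infix 4 _:=_
  _:=_ : ∀ {n} → Polynomial n → Polynomial n → Polynomial n × Polynomial n
  _:=_ = _,_

  private
    witness : ∀ {a} {A : Set a} (x : Maybe A) → T (is-just x) → A
    witness (just x) _ = x

  -- The solver's own solve compares normal forms after evaluating them in R;
  -- comparing them as closed terms is much faster.
  ringIdentity : ∀ n (equation : N-ary n (Polynomial n) (Polynomial n × Polynomial n)) →
    let l , r = equation $ⁿ Vec.map var (Vec.allFin n) in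
    {T (is-just (normalise l ≟N normalise r))} → ∀ ρ → ⟦ l ⟧ ρ ≈ ⟦ r ⟧ ρ
  ringIdentity n equation {eq} ρ = let l , r = equation $ⁿ Vec.map var (Vec.allFin n) in
    prove ρ l r (⟦ witness (normalise l ≟N normalise r) eq ⟧N-cong ρ)

-- Equations certified by linear combinations

module FieldTools {c ℓ₁ ℓ₂} (F : HeytingField c ℓ₁ ℓ₂) where
  open HeytingField F public using (_#_; heytingCommutativeRing; tight; #-irrefl; #-cotrans; #⇒invertible)
  open HeytingCommutativeRing heytingCommutativeRing public using (commutativeRing)
  open CommutativeRing commutativeRing public hiding (ring; zero)
  open IntegerSolver commutativeRing public using (ringIdentity; _:=_; _:+_; _:*_; _:-_; :-_; :0; :1)
  open HeytingProperties heytingCommutativeRing public using (1#0; x#0y#0→xy#0; invertibleˡ⇒#)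
  open Exp semiring public using (_^_; ^-congˡ; ^-congʳ; ^-homo-*; ^-assocʳ)

  -- The multiplier `k` is a certificate that `x - y` lies in the ideal of the known equation. Only
  -- a polynomial identity remains, which the ring solver checks; the variants with two and three
  -- equations serve in the same way.
  combine₁ : ∀ {x y l r} k → l ≈ r → x - y ≈ k * (l - r) → x ≈ y
  combine₁ {x} {y} {l} {r} k l≈r eq = begin
    x                 ≈⟨ (ringIdentity 2 (λ a b → a := a :- b :+ b) (_ ∷ _ ∷ [])) ⟩
    (x - y) + y       ≈⟨ +-congʳ eq ⟩
    k * (l - r) + y   ≈⟨ +-congʳ (*-congˡ (+-congʳ l≈r)) ⟩
    k * (r - r) + y   ≈⟨ (ringIdentity 3 (λ a b c → a :* (b :- b) :+ c := c) (_ ∷ _ ∷ _ ∷ [])) ⟩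
    y                 ∎
    where open SetoidReasoning setoid

  combine₂ : ∀ {x y l r l′ r′} k k′ → l ≈ r → l′ ≈ r′ →
    x - y ≈ k * (l - r) + k′ * (l′ - r′) → x ≈ y
  combine₂ {l = l} {r} {l′} {r′} k k′ l≈r l′≈r′ eq =
    combine₁ k l≈r (trans eq (combine₁ {y = k * (l - r)} k′ l′≈r′ (ringIdentity 6 (λ a b c d e f → a :* (b :- c) :+ d :* (e :- f) :- a :* (b :- c) := d :* (e :- f)) (_ ∷ _ ∷ _ ∷ _ ∷ _ ∷ _ ∷ []))))

  combine₃ : ∀ {x y l r l′ r′ l″ r″} k k′ k″ → l ≈ r → l′ ≈ r′ → l″ ≈ r″ →
    x - y ≈ k * (l - r) + k′ * (l′ - r′) + k″ * (l″ - r″) → x ≈ y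
  combine₃ {l = l} {r} {l′} {r′} {l″} {r″} k k′ k″ l≈r l′≈r′ l″≈r″ eq =
    combine₂ k k′ l≈r l′≈r′ (trans eq (combine₁ {y = k * (l - r) + k′ * (l′ - r′)} k″ l″≈r″ (ringIdentity 9 (λ a b c d e f g h i → a :* (b :- c) :+ d :* (e :- f) :+ g :* (h :- i) :- (a :* (b
          :- c) :+ d :* (e :- f)) := g :* (h :- i)) (_ ∷ _ ∷ _ ∷ _ ∷ _ ∷ _ ∷ _ ∷ _ ∷ _ ∷ []))))

-- Decidable equality and inverses in a finite field

module FiniteField {c ℓ₁ ℓ₂} (F : HeytingField c ℓ₁ ℓ₂) {order : ℕ} (size : HasSize F order) where
  open FieldTools F
  open SetoidReasoning setoid
  open Inverse size using (to; from; to-cong; strictlyInverseˡ; strictlyInverseʳ)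

  to-injective : ∀ {x y} → to x ≡ to y → x ≈ y
  to-injective {x} {y} eq = begin
    x           ≈⟨ strictlyInverseʳ x ⟨
    from (to x) ≡⟨ ≡.cong from eq ⟩
    from (to y) ≈⟨ strictlyInverseʳ y ⟩
    y           ∎

  infix 4 _≟_
  abstract
    _≟_ : Decidable _≈_
    x ≟ y = map′ to-injective to-cong (to x Fin.≟ to y)

  search : ∀ {ℓ} {P : Carrier → Set ℓ} → (∀ {x y} → x ≈ y → P x → P y) →
    (∀ x → Dec (P x)) → Dec (∃ P)
  search resp P? = map′ (λ (i , Pi) → from i , Pi)
    (λ (x , Px) → to x , resp (sym (strictlyInverseʳ x)) Px) (Fin.any? (P? ∘ from))

  1≉0 : 1# ≉ 0#
  1≉0 1≈0 = #-irrefl 1≈0 1#0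

  ^#0 : ∀ n {x} → x # 0# → x ^ n # 0#
  ^#0 zero    x#0 = 1#0
  ^#0 (suc n) x#0 = x#0y#0→xy#0 x#0 (^#0 n x#0)

  ^≈0⇒≈0 : ∀ n {x} → x ^ n ≈ 0# → x ≈ 0#
  ^≈0⇒≈0 n x^n≈0 = proj₁ (tight _ _) λ x#0 → #-irrefl x^n≈0 (^#0 n x#0)

  -- Two powers of x agree, say x ^ i (1 - x ^ (1 + d)) ≈ 0, and one of
  -- 1 - x ^ (1 + d) and x ^ (1 + d) is invertible.
  ≉0⇒#0 : ∀ {x} → x ≉ 0# → x # 0#
  ≉0⇒#0 {x} x≉0
    with i , j , i<j , eq ← Fin.pigeonhole (ℕ.n<1+n order) (λ i → to (x ^ toℕ i))
    with d , ≡j ← ℕ.m≤n⇒∃[o]m+o≡n i<j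
    with #-cotrans 1#0 (x * x ^ d)
  ... | inj₁ 1#z with w , w[1-z]≈1 , _ ← #⇒invertible 1#z =
    contradiction (^≈0⇒≈0 (toℕ i) (unit-cancel w[1-z]≈1
      (trans (to-injective eq) (trans (^-congʳ x (≡.sym ≡j)) (*-congˡ (^-homo-* x (toℕ i) d)))))) x≉0
    where
    unit-cancel : ∀ {w x u v} → w * (1# - x * v) ≈ 1# → u ≈ x * (u * v) → u ≈ 0#
    unit-cancel {w} {x} {u} {v} wz≈1 eq = combine₂ (- u) w wz≈1 eq (ringIdentity 4 (λ a b c d → a :- :0 := (:- a) :* (b :* (:1 :- c :* d) :- :1) :+ b :* (a :- c :* (a
          :* d))) (_ ∷ _ ∷ _ ∷ _ ∷ []))
  ... | inj₂ z#0 with w , wz≈1 , _ ← #⇒invertible z#0 =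
    invertibleˡ⇒# (w * x ^ d , left-inverse wz≈1)
    where
    left-inverse : ∀ {w x v} → w * (x * v - 0#) ≈ 1# → (w * v) * (x - 0#) ≈ 1#
    left-inverse {w} {x} {v} eq = combine₁ 1# eq (ringIdentity 3 (λ a b c → a :* b :* (c :- :0) :- :1 := :1 :* (a :* (c :* b :- :0) :- :1)) (_ ∷ _ ∷ _ ∷ []))

  infix 8 _⁻¹
  abstract
    _⁻¹ : Carrier → Carrier
    x ⁻¹ with x ≟ 0#
    ... | yes _  = 0#
    ... | no x≉0 = proj₁ (#⇒invertible (≉0⇒#0 x≉0))

    ⁻¹-inverse : ∀ {x} → x ≉ 0# → x ⁻¹ * x ≈ 1#
    ⁻¹-inverse {x} x≉0 with x ≟ 0#
    ... | yes x≈0 = contradiction x≈0 x≉0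
    ... | no x≉0′ with y , y[x-0]≈1 , _ ← #⇒invertible (≉0⇒#0 x≉0′) = combine₁ 1# y[x-0]≈1 (ringIdentity 2 (λ a b → a :* b :- :1 := :1 :* (a :* (b :- :0) :- :1)) (_ ∷ _ ∷ []))

  ⁻¹-cancelˡ : ∀ {x} → x ≉ 0# → ∀ y → x ⁻¹ * (x * y) ≈ y
  ⁻¹-cancelˡ x≉0 y = combine₁ y (⁻¹-inverse x≉0) (ringIdentity 3 (λ a b c → a :* (b :* c) :- c := c :* (a :* b :- :1)) (_ ∷ _ ∷ _ ∷ []))

  ⁻¹-cancelʳ : ∀ {x} → x ≉ 0# → ∀ y → x * (x ⁻¹ * y) ≈ y
  ⁻¹-cancelʳ x≉0 y = combine₁ y (⁻¹-inverse x≉0) (ringIdentity 3 (λ a b c → a :* (b :* c) :- c := c :* (b :* a :- :1)) (_ ∷ _ ∷ _ ∷ []))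

  *-cancel-0 : ∀ {x y} → x ≉ 0# → x * y ≈ 0# → y ≈ 0#
  *-cancel-0 {x} {y} x≉0 xy≈0 = combine₂ (- y) (x ⁻¹) (⁻¹-inverse x≉0) xy≈0 (ringIdentity 3 (λ a b c → a :- :0 := (:- a) :* (b :* c :- :1) :+ b :* (c :* a :- :0)) (_ ∷ _ ∷ _ ∷ []))

  *-cancel-1 : ∀ {x y} → x ≉ 0# → y * x ≈ x → y ≈ 1#
  *-cancel-1 {x} {y} x≉0 yx≈x =
    combine₁ 1# (*-cancel-0 x≉0 (combine₁ {x = x * (y - 1#)} 1# yx≈x (ringIdentity 2 (λ a b → a :* (b :- :1) :- :0 := :1 :* (b :* a :- a)) (_ ∷ _ ∷ [])))) (ringIdentity 1 (λ a → a :- :1 := :1 :* (a :- :1 :- :0)) (_ ∷ []))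

  *-≉0 : ∀ {x y} → x ≉ 0# → y ≉ 0# → x * y ≉ 0#
  *-≉0 x≉0 y≉0 xy≈0 = y≉0 (*-cancel-0 x≉0 xy≈0)

  *≈0⇒ : ∀ {x y} → x * y ≈ 0# → x ≈ 0# ⊎ y ≈ 0#
  *≈0⇒ {x} xy≈0 with x ≟ 0#
  ... | yes x≈0 = inj₁ x≈0
  ... | no x≉0  = inj₂ (*-cancel-0 x≉0 xy≈0)

  *≉0ˡ : ∀ {x y} → x * y ≉ 0# → x ≉ 0#
  *≉0ˡ {x} {y} xy≉0 x≈0 = xy≉0 (combine₁ y x≈0 (ringIdentity 2 (λ a b → a :* b :- :0 := b :* (a :- :0)) (_ ∷ _ ∷ [])))

  *≉0ʳ : ∀ {x y} → x * y ≉ 0# → y ≉ 0#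
  *≉0ʳ {x} {y} xy≉0 y≈0 = xy≉0 (combine₁ x y≈0 (ringIdentity 2 (λ a b → a :* b :- :0 := a :* (b :- :0)) (_ ∷ _ ∷ [])))

  -‿≉0 : ∀ {x} → x ≉ 0# → - x ≉ 0#
  -‿≉0 {x} x≉0 -x≈0 = x≉0 (combine₁ (- 1#) -x≈0 (ringIdentity 1 (λ a → a :- :0 := (:- :1) :* (:- a :- :0)) (_ ∷ [])))

  ⁻¹≉0 : ∀ {x} → x ≉ 0# → x ⁻¹ ≉ 0#
  ⁻¹≉0 {x} x≉0 x⁻¹≈0 = 1≉0 (combine₂ (- 1#) x (⁻¹-inverse x≉0) x⁻¹≈0 (ringIdentity 2 (λ a b → :1 :- :0 := (:- :1) :* (a :* b :- :1) :+ b :* (a :- :0)) (_ ∷ _ ∷ [])))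

  -≉0 : ∀ {x y} → x ≉ y → x - y ≉ 0#
  -≉0 x≉y eq = x≉y (combine₁ 1# eq (ringIdentity 2 (λ a b → a :- b := :1 :* (a :- b :- :0)) (_ ∷ _ ∷ [])))

  -- The order of the field as multiple of 1 and as exponent

  open import Algebra.Properties.Group +-group using () renaming (∙-cancelˡ to +-cancelˡ; x≈y⇒x∙y⁻¹≈ε to x≈y⇒x-y≈0)
  open SemiringMult semiring using (×1-homo-*; ×-assoc-*; ×-assocˡ; ×-congʳ) renaming (_×_ to _·_)

  -- Translation by 1 permutes the field, so it does not change the sum
  -- of all elements.
  order·1≈0 : order · 1# ≈ 0#
  order·1≈0 = +-cancelˡ (sum from) _ _ total
    where
    open CommutativeSum +-commutativeMonoid
    shift = permutation (λ i → to (from i + 1#)) (λ i → to (from i - 1#))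
      (λ i → ≡.trans (to-cong (trans (+-congʳ (strictlyInverseʳ _)) (ringIdentity 1 (λ a → a :- :1 :+ :1 := a) (_ ∷ [])))) (strictlyInverseˡ i))
      (λ i → ≡.trans (to-cong (trans (+-congʳ (strictlyInverseʳ _)) (ringIdentity 1 (λ a → a :+ :1 :- :1 := a) (_ ∷ [])))) (strictlyInverseˡ i))
    total : sum from + order · 1# ≈ sum from + 0#
    total = begin
      sum from + order · 1#             ≈⟨ +-congˡ (sum-replicate order) ⟨
      sum from + sum (replicate order 1#) ≈⟨ ∑-distrib-+ {order} from (λ _ → 1#) ⟨
      sum (λ i → from i + 1#)           ≈⟨ sum-cong-≋ (λ i → strictlyInverseʳ (from i + 1#)) ⟨
      sum (λ i → from (to (from i + 1#))) ≈⟨ sum-permute from shift ⟨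
      sum from                          ≈⟨ +-identityʳ _ ⟨
      sum from + 0#                     ∎

  module _ where
    open CommutativeSum *-commutativeMonoid renaming (sum to product)

    product≉0 : ∀ {n} (t : Vector Carrier n) → (∀ i → t i ≉ 0#) → product t ≉ 0#
    product≉0 {zero}  t t≉0 = 1≉0
    product≉0 {suc n} t t≉0 = *-≉0 (t≉0 zero) (product≉0 (t ∘ suc) (t≉0 ∘ suc))

    -- The entry 1 at `i` leaves `n - 1` factors `x`, and the additional `x` in front restores the
    -- exponent `n`. This is why the outcome is `x ^ order ≈ x` without a predecessor of `order`.
    product-constant : ∀ {n x} (i : Fin n) (t : Vector Carrier n) →
      t i ≈ 1# → (∀ j → j ≢ i → t j ≈ x) → x * product t ≈ x ^ n
    product-constant {suc n} {x} i t ti≈1 t≈x = *-congˡ (begin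
      product t                       ≈⟨ sum-remove {i = i} t ⟩
      t i * product (removeAt t i)    ≈⟨ *-cong ti≈1 (sum-cong-≋ (λ j → t≈x _ (Fin.punchInᵢ≢i i j))) ⟩
      1# * product (replicate n x)    ≈⟨ *-identityˡ _ ⟩
      product (replicate n x)         ≈⟨ sum-replicate n ⟩
      x ^ n                           ∎)

    -- The inhabitant of `Fin n` excludes `n = 0`, where the power would be 1.
    0^n≈0 : ∀ {n} → Fin n → ∀ {x} → x ≈ 0# → x ^ n ≈ x
    0^n≈0 {suc n} _ {x} x≈0 = trans (trans (*-congʳ x≈0) (zeroˡ _)) (sym x≈0)

    module _ {x : Carrier} (x≉0 : x ≉ 0#) where
      -- Giving zero the value 1 lets products run over the whole field and still be invertible.
      unlessZero : Carrier → Carrier → Carrier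
      unlessZero z y with z ≟ 0#
      ... | yes _ = 1#
      ... | no _  = y

      unlessZero-≈0 : ∀ {z y} → z ≈ 0# → unlessZero z y ≈ 1#
      unlessZero-≈0 {z} z≈0 with z ≟ 0#
      ... | yes _  = refl
      ... | no z≉0 = contradiction z≈0 z≉0

      unlessZero-≉0 : ∀ {z y} → z ≉ 0# → unlessZero z y ≈ y
      unlessZero-≉0 {z} z≉0 with z ≟ 0#
      ... | yes z≈0 = contradiction z≈0 z≉0
      ... | no _    = refl

      nonzero : Carrier → Carrier
      nonzero z = unlessZero z z

      nonzero≉0 : ∀ z → nonzero z ≉ 0#
      nonzero≉0 z with z ≟ 0#
      ... | yes _  = 1≉0
      ... | no z≉0 = z≉0

      nonzero-* : ∀ {w} z → w ≈ x * z → nonzero w ≈ unlessZero z x * nonzero z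
      nonzero-* {w} z w≈xz with z ≟ 0#
      ... | yes z≈0 = trans (unlessZero-≈0 (combine₂ 1# x w≈xz z≈0 (ringIdentity 3 (λ a b c → a :- :0 := :1 :* (a :- b :* c) :+ b :* (c :- :0)) (_ ∷ _ ∷ _ ∷ [])))) (sym (*-identityˡ 1#))
      ... | no z≉0  = trans (unlessZero-≉0 λ w≈0 → *-≉0 x≉0 z≉0 (trans (sym w≈xz) w≈0)) w≈xz

      -- Multiplication by x permutes the nonzero elements, so it does
      -- not change their product.
      ^order-≉0 : x ^ order ≈ x
      ^order-≉0 = begin
        x ^ order      ≈⟨ product-constant (to 0#) factors
                            (unlessZero-≈0 (strictlyInverseʳ 0#))
                            (λ j j≢0 → unlessZero-≉0 λ eq → j≢0
                              (≡.trans (≡.sym (strictlyInverseˡ j)) (to-cong eq))) ⟨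
        x * product factors ≈⟨ *-congˡ cancelled ⟩
        x * 1#         ≈⟨ *-identityʳ x ⟩
        x              ∎
        where
        factors elements : Vector Carrier order
        factors i  = unlessZero (from i) x
        elements i = nonzero (from i)
        scale = permutation (λ i → to (x * from i)) (λ i → to (x ⁻¹ * from i))
          (λ i → ≡.trans (to-cong (trans (*-congˡ (strictlyInverseʳ _))
            (⁻¹-cancelʳ x≉0 (from i)))) (strictlyInverseˡ i))
          (λ i → ≡.trans (to-cong (trans (*-congˡ (strictlyInverseʳ _))
            (⁻¹-cancelˡ x≉0 (from i)))) (strictlyInverseˡ i))
        total : product factors * product elements ≈ product elements
        total = begin
          product factors * product elements    ≈⟨ ∑-distrib-+ factors elements ⟨
          product (λ i → factors i * elements i) ≈⟨ sum-cong-≋ (λ i → nonzero-* (from i) (strictlyInverseʳ _)) ⟨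
          product (λ i → elements (to (x * from i))) ≈⟨ sum-permute elements scale ⟨
          product elements                      ∎
        cancelled : product factors ≈ 1#
        cancelled = *-cancel-1 (product≉0 elements (nonzero≉0 ∘ from)) total

    ^order : ∀ x → x ^ order ≈ x
    ^order x with x ≟ 0#
    ... | yes x≈0 = 0^n≈0 (to 0#) x≈0
    ... | no x≉0  = ^order-≉0 x≉0

  -- Roots of monic polynomials

  -- A polynomial is given by its function together with a Horner scheme for it; the leading
  -- coefficient 1 is the innermost value.
  data Monic : ℕ → (Carrier → Carrier) → Set (c Level.⊔ ℓ₁) where
    constant : ∀ {f} → (∀ x → f x ≈ 1#) → Monic 0 f
    horner   : ∀ {d f} g k → Monic d g → (∀ x → f x ≈ x * g x + k) → Monic (suc d) f

  abstract
    -- Synthetic division: the values at `r` of the successive Horner stages are the coefficients of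
    -- the quotient, so `g r` becomes its constant term.
    factor : ∀ {d f} → Monic (suc d) f → ∀ r →
      ∃[ h ] Monic d h × (∀ x → f x - f r ≈ (x - r) * h x)
    factor (horner {f = f} g k (constant g≈1) f≈) r = (λ _ → 1#) , constant (λ _ → refl) , λ x →
      trans (+-cong (trans (f≈ x) (+-congʳ (*-congˡ (g≈1 x)))) (-‿cong (trans (f≈ r) (+-congʳ (*-congˡ (g≈1 r)))))) (ringIdentity 3 (λ a b c → a :* :1 :+ b :- (c :* :1 :+ b) := (a :- c) :* :1) (_ ∷ _ ∷ _ ∷ []))
    factor (horner {f = f} g k G@(horner _ _ _ _) f≈) r with h , H , g- ← factor G r =
      (λ x → x * h x + g r) , horner h (g r) H (λ _ → refl) , λ x →
      combine₃ 1# (- 1#) x (f≈ x) (f≈ r) (g- x) (ringIdentity 8 (λ a b c d e f g h → a :- b :- (c :- d) :* (c :* e :+ f) := :1 :* (a :- (c :* g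
            :+ h)) :+ (:- :1) :* (b :- (d :* f :+ h)) :+ c :* (g :- f :- (c :- d) :* e)) (_ ∷ _ ∷ _ ∷ _ ∷ _ ∷ _ ∷ _ ∷ _ ∷ []))

  -- After division by the linear factor of the first root, the other `d` roots are roots of the
  -- quotient, since they differ from the first.
  root-bound : ∀ {d f} → Monic d f → (a : Fin (suc d) → Carrier) →
    (∀ i j → a i ≈ a j → i ≡ j) → ¬ (∀ i → f (a i) ≈ 0#)
  root-bound (constant f≈1) a a-inj roots = 1≉0 (trans (sym (f≈1 _)) (roots zero))
  root-bound M@(horner _ _ _ _) a a-inj roots with h , H , f- ← factor M (a zero) =
    root-bound H (a ∘ suc) (λ i j eq → Fin.suc-injective (a-inj _ _ eq)) λ i →
      *-cancel-0 {a (suc i) - a zero} (-≉0 λ eq → Fin.0≢1+n (≡.sym (a-inj _ _ eq)))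
        (combine₃ (- 1#) 1# (- 1#) (f- (a (suc i))) (roots (suc i)) (roots zero) (ringIdentity 5 (λ a b c d e → (a :- b) :* c :- :0 := (:- :1) :* (d :- e :- (a :- b) :* c) :+ :1
              :* (d :- :0) :+ (:- :1) :* (e :- :0)) (_ ∷ _ ∷ _ ∷ _ ∷ _ ∷ [])))

  monic-^ : ∀ n → Monic n (_^ n)
  monic-^ zero    = constant λ _ → refl
  monic-^ (suc n) = horner (_^ n) 0# (monic-^ n) λ x → sym (+-identityʳ _)

  monic-^-^ : ∀ k e → Monic (k ℕ.+ suc e) (λ x → x ^ (k ℕ.+ suc e) - x ^ k)
  monic-^-^ zero e = horner (_^ e) (- 1#) (monic-^ e) λ _ → refl
  monic-^-^ (suc k) e = horner (λ x → x ^ (k ℕ.+ suc e) - x ^ k) 0# (monic-^-^ k e) λ x → factor-out x _ _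
    where
    factor-out : ∀ x u v → x * u - x * v ≈ x * (u - v) + 0#
    factor-out x u v = (ringIdentity 3 (λ a b c → a :* b :- a :* c := a :* (b :- c) :+ :0) (_ ∷ _ ∷ _ ∷ []))

  abstract
    -- The difference of the powers is monic of degree less than the number of elements, so it
    -- cannot vanish everywhere. Both a nonfixed element and elements of 𝔽q outside a few values are
    -- obtained from this.
    powers-differ : ∀ k e → k ℕ.+ suc e < order → ∃[ x ] x ^ (k ℕ.+ suc e) ≉ x ^ k
    powers-differ k e d<order with Fin.¬∀⟶∃¬ _ _ (λ i → from i ^ (k ℕ.+ suc e) ≟ from i ^ k) agree
      where
      agree : ¬ (∀ i → from i ^ (k ℕ.+ suc e) ≈ from i ^ k)
      agree eq = root-bound (monic-^-^ k e) (λ i → from (inject≤ i d<order))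
        (λ i j x≈y → Fin.inject≤-injective d<order d<order i j
          (≡.trans (≡.sym (strictlyInverseˡ _)) (≡.trans (to-cong x≈y) (strictlyInverseˡ _))))
        (λ i → x≈y⇒x-y≈0 (eq (inject≤ i d<order)))
    ... | i , differ = from i , differ

-- Binomial coefficients, odd prime powers and bounds on exponents

prime∣!⇒≤ : ∀ {p} → Prime p → ∀ k → p ∣ k ! → p ≤ k
prime∣!⇒≤ pp zero p∣1 = contradiction (∣1⇒≡1 p∣1) (ℕ.nonTrivial⇒≢1 {{prime⇒nonTrivial pp}})
prime∣!⇒≤ pp (suc k) p∣ with euclidsLemma (suc k) (k !) pp p∣
... | inj₁ p∣1+k = ∣⇒≤ p∣1+k
... | inj₂ p∣k!  = ℕ.m≤n⇒m≤1+n (prime∣!⇒≤ pp k p∣k!)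

-- The prime divides `p !`, the product of the binomial coefficient with `k !` and `(p ∸ k) !`, but
-- neither of these two factorials, as both arguments are smaller than `p`.
prime∣C : ∀ {p k} → Prime p → 0 < k → k < p → p ∣ p choose k
prime∣C {p@(suc p-1)} {k} pp 0<k k<p with euclidsLemma (p choose k) (k ! ℕ.* (p ∸ k) !) pp p∣
  where
  instance _ = ℕ._!*_!≢0 k (p ∸ k)
  p∣ : p ∣ (p choose k) ℕ.* (k ! ℕ.* (p ∸ k) !)
  p∣ = ≡.subst (p ∣_) (≡.sym (≡.trans (≡.cong (λ z → z ℕ.* (k ! ℕ.* (p ∸ k) !)) (nCk≡n!/k![n-k]! (ℕ.<⇒≤ k<p)))
    (m/n*n≡m (k![n∸k]!∣n! (ℕ.<⇒≤ k<p))))) (m∣m*n (p-1 !))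
... | inj₁ p∣C = p∣C
... | inj₂ p∣! with euclidsLemma (k !) ((p ∸ k) !) pp p∣!
...   | inj₁ p∣k!     = contradiction k<p (ℕ.≤⇒≯ (prime∣!⇒≤ pp k p∣k!))
...   | inj₂ p∣[p-k]! = contradiction (ℕ.∸-monoʳ-< 0<k (ℕ.<⇒≤ k<p)) (ℕ.≤⇒≯ (prime∣!⇒≤ pp (p ∸ k) p∣[p-k]!))

odd⇒1+2* : ∀ {q} → 2 ∤ q → ∃[ j ] q ≡ 1 ℕ.+ j ℕ.* 2
odd⇒1+2* {q} 2∤q with q % 2 in eq | m%n<n q 2
... | 0           | _ = contradiction (m%n≡0⇒n∣m q 2 eq) 2∤q
... | 1           | _ = q / 2 , ≡.trans (m≡m%n+[m/n]*n q 2) (≡.cong (ℕ._+ q / 2 ℕ.* 2) eq)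
... | suc (suc _) | s≤s (s≤s ())

oddPrimePower≥3 : ∀ {q} → OddPrimePower q → 3 ≤ q
oddPrimePower≥3 {0} (_ , _ , _ , _ , _ , 2∤q) = contradiction (divides 0 ≡.refl) 2∤q
oddPrimePower≥3 {1} (p , suc n , pp , _ , 1≡p^n , _) =
  contradiction (ℕ.m*n≡1⇒m≡1 p _ (≡.sym 1≡p^n)) (ℕ.nonTrivial⇒≢1 {{prime⇒nonTrivial pp}})
oddPrimePower≥3 {2} (_ , _ , _ , _ , _ , 2∤q) = contradiction (divides 1 ≡.refl) 2∤q
oddPrimePower≥3 {suc (suc (suc q))} _ = s≤s (s≤s (s≤s z≤n))

oddPrimePower-cases : ∀ {q} → OddPrimePower q → q ≡ 3 ⊎ q ≡ 5 ⊎ 7 ≤ q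
oddPrimePower-cases opp@(_ , _ , _ , _ , _ , 2∤q) = cases (oddPrimePower≥3 opp) 2∤q
  where
  cases : ∀ {q} → 3 ≤ q → 2 ∤ q → q ≡ 3 ⊎ q ≡ 5 ⊎ 7 ≤ q
  cases {1} (s≤s ()) _
  cases {2} (s≤s (s≤s ())) _
  cases {3} _ _ = inj₁ ≡.refl
  cases {4} _ 2∤4 = contradiction (divides 2 ≡.refl) 2∤4
  cases {5} _ _ = inj₂ (inj₁ ≡.refl)
  cases {6} _ 2∤6 = contradiction (divides 3 ≡.refl) 2∤6
  cases {suc (suc (suc (suc (suc (suc (suc _))))))} _ _ = inj₂ (inj₂ (ℕ.m≤m+n 7 _))

-- With `s` replaced by the norm `x ^ (1 + q)`, the polynomial `s ^ (2 + m) - s` gets the degree on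
-- the left; it has to stay below q², the number of elements.
exponent-bound : ∀ {q} m → 4 ℕ.+ m ≤ q → (2 ℕ.+ m) ℕ.* suc q < q ℕ.* (q ℕ.* 1)
exponent-bound {q} m 4+m≤q = let open ℕ.≤-Reasoning in begin-strict
  (2 ℕ.+ m) ℕ.* suc q               ≡⟨ ℕ.*-suc (2 ℕ.+ m) q ⟩
  (2 ℕ.+ m) ℕ.+ (2 ℕ.+ m) ℕ.* q     <⟨ ℕ.+-monoˡ-< _ (ℕ.<-≤-trans (ℕ.m<n+m (2 ℕ.+ m) {2} (s≤s z≤n)) (ℕ.≤-trans 4+m≤q (ℕ.m≤m+n q (1 ℕ.* q)))) ⟩
  2 ℕ.* q ℕ.+ (2 ℕ.+ m) ℕ.* q       ≡⟨ ℕ.*-distribʳ-+ q 2 (2 ℕ.+ m) ⟨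
  (4 ℕ.+ m) ℕ.* q                   ≤⟨ ℕ.*-monoˡ-≤ q 4+m≤q ⟩
  q ℕ.* q                           ≡⟨ ≡.cong (q ℕ.*_) (ℕ.*-identityʳ q) ⟨
  q ℕ.* (q ℕ.* 1)                   ∎

2+≡ : ∀ {q} → 3 ≤ q → ∃[ e ] 2 ℕ.+ e ≡ q
2+≡ 3≤q = ℕ.m≤n⇒∃[o]m+o≡n (ℕ.≤-trans (ℕ.n≤1+n 2) 3≤q)

q<q^2 : ∀ {q} → 3 ≤ q → q < q ℕ.^ 2
q<q^2 {suc q} (s≤s 2≤q) = ≡.subst (suc q <_) (≡.cong (suc q ℕ.*_) (≡.sym (ℕ.*-identityʳ (suc q))))
  (ℕ.m<m*n (suc q) (suc q) (s≤s (ℕ.≤-trans (s≤s z≤n) 2≤q)))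

-- A finite check over all triples, made by evaluating the decision procedure; `t` is the index left
-- over by three distinct ones.
remaining-vertex : ∀ (i j k : Fin 4) → i ≢ j → j ≢ k → i ≢ k →
  ∃[ t ] ∀ s → s ≢ t → s ≡ i ⊎ s ≡ j ⊎ s ≡ k
remaining-vertex = toWitness {a? = Fin.all? λ (i : Fin 4) → Fin.all? λ (j : Fin 4) → Fin.all? λ (k : Fin 4) →
  ¬? (i Fin.≟ j) →-dec ¬? (j Fin.≟ k) →-dec ¬? (i Fin.≟ k) →-dec
  Fin.any? λ (t : Fin 4) → Fin.all? λ (s : Fin 4) → ¬? (s Fin.≟ t) →-dec (s Fin.≟ i ⊎-dec s Fin.≟ j ⊎-dec s Fin.≟ k)} _

-- Conjugation, norm and square roots over 𝔽q

module Unitals {c ℓ₁ ℓ₂} (F : HeytingField c ℓ₁ ℓ₂) (q : ℕ)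
  (opp : OddPrimePower q) (size : HasSize F (q ℕ.^ 2)) where
  open FieldTools F
  open FiniteField F size
  open Plane F q
  open SemiringMult semiring using (×1-homo-*; ×-assoc-*; ×-congʳ; ×-cong) renaming (_×_ to _·_)
  open CommutativeSum +-commutativeMonoid using (sum; sum-init-last; sum-cong-≋; sum-replicate-zero)
  open SetoidReasoning setoid

  p n : ℕ
  p = proj₁ opp
  n = proj₁ (proj₂ opp)

  p-prime : Prime p
  p-prime = proj₁ (proj₂ (proj₂ opp))

  q≡p^n : q ≡ p ℕ.^ n
  q≡p^n = proj₁ (proj₂ (proj₂ (proj₂ (proj₂ opp))))

  ^·1 : ∀ m k → (m ℕ.^ k) · 1# ≈ (m · 1#) ^ k
  ^·1 m zero    = +-identityʳ 1#
  ^·1 m (suc k) = trans (×1-homo-* m (m ℕ.^ k)) (*-congˡ (^·1 m k))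

  -- The order of the field is q², so what vanishes at once is the square of `q · 1#`, and a field
  -- has no nonzero nilpotents. The exponent `n` leads from `q` to `p` in the same way.
  q·1≈0 : q · 1# ≈ 0#
  q·1≈0 = ^≈0⇒≈0 2 (trans (sym (^·1 q 2)) order·1≈0)

  p·1≈0 : p · 1# ≈ 0#
  p·1≈0 = ^≈0⇒≈0 n (trans (sym (trans (×-cong q≡p^n refl) (^·1 p n))) q·1≈0)

  ∣⇒·≈0 : ∀ {m} → p ∣ m → ∀ x → m · x ≈ 0#
  ∣⇒·≈0 (divides k ≡.refl) x = begin
    (k ℕ.* p) · x         ≈⟨ ×-congʳ (k ℕ.* p) (*-identityˡ x) ⟨
    (k ℕ.* p) · (1# * x)  ≈⟨ ×-assoc-* (k ℕ.* p) 1# x ⟨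
    (k ℕ.* p) · 1# * x    ≈⟨ *-congʳ (×1-homo-* k p) ⟩
    k · 1# * p · 1# * x   ≈⟨ *-congʳ (*-congˡ p·1≈0) ⟩
    k · 1# * 0# * x       ≈⟨ trans (*-congʳ (zeroʳ _)) (zeroˡ _) ⟩
    0#                    ∎

  sum-ends : ∀ {m} (t : Vector Carrier (suc (suc m))) →
    (∀ i → t (suc (inject₁ i)) ≈ 0#) → sum t ≈ t zero + t (fromℕ (suc m))
  sum-ends {m} t inner≈0 = +-congˡ (begin
    sum (t ∘ suc)                                    ≈⟨ sum-init-last (t ∘ suc) ⟩
    sum (init (t ∘ suc)) + t (fromℕ (suc m))         ≈⟨ +-congʳ (sum-cong-≋ inner≈0) ⟩
    sum (replicate m 0#) + t (fromℕ (suc m))         ≈⟨ +-congʳ (sum-replicate-zero m) ⟩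
    0# + t (fromℕ (suc m))                           ≈⟨ +-identityˡ _ ⟩
    t (fromℕ (suc m))                                ∎)

  -- All inner terms of the binomial sum have coefficients divisible by `p`. The copy `p′` of `p` is
  -- there because it can be matched as a successor.
  frobenius : ∀ {p′} → p′ ≡ p → ∀ x y → (x + y) ^ p′ ≈ x ^ p′ + y ^ p′
  frobenius {zero} p≡ x y = contradiction (≡.subst Prime (≡.sym p≡) p-prime) λ ()
  frobenius {p′@(suc m)} p≡ x y = begin
    (x + y) ^ p′                 ≈⟨ Binomial.theorem commutativeSemiring p′ x y ⟩
    sum term                     ≈⟨ sum-ends term (λ i → ∣⇒·≈0 (≡.subst (_∣ (p′ choose toℕ (suc (inject₁ i)))) p≡
                                      (prime∣C (≡.subst Prime (≡.sym p≡) p-prime) (s≤s z≤n)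
                                      (s≤s (≡.subst (_< m) (≡.sym (Fin.toℕ-inject₁ i)) (Fin.toℕ<n i))))) _) ⟩
    term zero + term (fromℕ p′)  ≈⟨ +-cong (trans (+-identityʳ _) (*-identityˡ _)) top ⟩
    y ^ p′ + x ^ p′              ≈⟨ +-comm _ _ ⟩
    x ^ p′ + y ^ p′              ∎
    where
    term : Vector Carrier (suc p′)
    term k = (p′ choose toℕ k) · (x ^ toℕ k * y ^ (p′ ∸ toℕ k))
    top : term (fromℕ p′) ≈ x ^ p′
    top = begin
      term (fromℕ p′)                         ≡⟨ ≡.cong (λ k → (p′ choose k) · (x ^ k * y ^ (p′ ∸ k))) (Fin.toℕ-fromℕ p′) ⟩
      (p′ choose p′) · (x ^ p′ * y ^ (p′ ∸ p′))    ≈⟨ ×-cong (nCn≡1 p′) (*-congˡ (^-congʳ y (ℕ.n∸n≡0 p′))) ⟩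
      1 · (x ^ p′ * 1#)                       ≈⟨ trans (+-identityʳ _) (*-identityʳ _) ⟩
      x ^ p′                                  ∎

  frobenius-^ : ∀ k x y → (x + y) ^ (p ℕ.^ k) ≈ x ^ (p ℕ.^ k) + y ^ (p ℕ.^ k)
  frobenius-^ zero x y = trans (*-identityʳ _) (sym (+-cong (*-identityʳ x) (*-identityʳ y)))
  frobenius-^ (suc k) x y = begin
    (x + y) ^ (p ℕ.* p ℕ.^ k)                     ≈⟨ ^-assocʳ (x + y) p (p ℕ.^ k) ⟨
    ((x + y) ^ p) ^ (p ℕ.^ k)                     ≈⟨ ^-congˡ (p ℕ.^ k) (frobenius ≡.refl x y) ⟩
    (x ^ p + y ^ p) ^ (p ℕ.^ k)                   ≈⟨ frobenius-^ k (x ^ p) (y ^ p) ⟩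
    (x ^ p) ^ (p ℕ.^ k) + (y ^ p) ^ (p ℕ.^ k)     ≈⟨ +-cong (^-assocʳ x p (p ℕ.^ k)) (^-assocʳ y p (p ℕ.^ k)) ⟩
    x ^ (p ℕ.* p ℕ.^ k) + y ^ (p ℕ.* p ℕ.^ k)     ∎

  abstract
    -- The conjugation over 𝔽q, with 𝔽q as its fixed field. It is abstract, so that terms containing
    -- it do not unfold to powers.
    bar : Carrier → Carrier
    bar x = x ^ q

    bar-def : ∀ x → x ^ q ≈ bar x
    bar-def x = refl

    bar-cong : ∀ {x y} → x ≈ y → bar x ≈ bar y
    bar-cong = ^-congˡ q

    bar-+ : ∀ x y → bar (x + y) ≈ bar x + bar y
    bar-+ x y = ≡.subst (λ q → (x + y) ^ q ≈ x ^ q + y ^ q) (≡.sym q≡p^n) (frobenius-^ n x y)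

    bar-* : ∀ x y → bar (x * y) ≈ bar x * bar y
    bar-* x y = CommutativeExp.^-distrib-* commutativeSemiring x y q

    bar-involutive : ∀ x → bar (bar x) ≈ x
    bar-involutive x = begin
      (x ^ q) ^ q   ≈⟨ ^-assocʳ x q q ⟩
      x ^ (q ℕ.* q) ≈⟨ ^-congʳ x (≡.cong (q ℕ.*_) (ℕ.*-identityʳ q)) ⟨
      x ^ (q ℕ.^ 2) ≈⟨ ^order x ⟩
      x             ∎

  bar-0 : bar 0# ≈ 0#
  bar-0 = combine₁ (- 1#) (trans (bar-cong (sym (+-identityˡ 0#))) (bar-+ 0# 0#)) (ringIdentity 1 (λ a → a :- :0 := (:- :1) :* (a :- (a :+ a))) (_ ∷ []))

  bar-1 : bar 1# ≈ 1#
  bar-1 = *-cancel-1 bar1≉0 (trans (sym (bar-* 1# 1#)) (bar-cong (*-identityˡ 1#)))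
    where
    bar1≉0 : bar 1# ≉ 0#
    bar1≉0 eq = 1≉0 (trans (sym (bar-involutive 1#)) (trans (bar-cong eq) bar-0))

  bar-neg : ∀ x → bar (- x) ≈ - bar x
  bar-neg x = combine₂ (- 1#) 1# (bar-+ x (- x)) (trans (bar-cong (-‿inverseʳ x)) bar-0) (ringIdentity 3 (λ a b c → a :- (:- b) := (:- :1) :* (c :- (b :+ a)) :+ :1 :* (c :- :0)) (_ ∷ _ ∷ _ ∷ []))

  bar-sub : ∀ x y → bar (x - y) ≈ bar x - bar y
  bar-sub x y = trans (bar-+ x (- y)) (+-congˡ (bar-neg y))

  bar≉0 : ∀ {x} → x ≉ 0# → bar x ≉ 0#
  bar≉0 x≉0 eq = x≉0 (trans (sym (bar-involutive _)) (trans (bar-cong eq) bar-0))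

  Fixed : Carrier → Set ℓ₁
  Fixed x = bar x ≈ x

  fixed⇒𝔽q : ∀ {x} → Fixed x → 𝔽q x
  fixed⇒𝔽q = trans (bar-def _)

  𝔽q⇒fixed : ∀ {x} → 𝔽q x → Fixed x
  𝔽q⇒fixed = trans (sym (bar-def _))

  fixed-cong : ∀ {x y} → x ≈ y → Fixed x → Fixed y
  fixed-cong x≈y fx = trans (bar-cong (sym x≈y)) (trans fx x≈y)

  fixed-+ : ∀ {x y} → Fixed x → Fixed y → Fixed (x + y)
  fixed-+ fx fy = trans (bar-+ _ _) (+-cong fx fy)

  fixed-* : ∀ {x y} → Fixed x → Fixed y → Fixed (x * y)
  fixed-* fx fy = trans (bar-* _ _) (*-cong fx fy)

  fixed-neg : ∀ {x} → Fixed x → Fixed (- x)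
  fixed-neg fx = trans (bar-neg _) (-‿cong fx)

  fixed-- : ∀ {x y} → Fixed x → Fixed y → Fixed (x - y)
  fixed-- fx fy = fixed-+ fx (fixed-neg fy)

  fixed-⁻¹ : ∀ {x} → x ≉ 0# → Fixed x → Fixed (x ⁻¹)
  fixed-⁻¹ {x} x≉0 fx = combine₃ (bar (x ⁻¹)) (x ⁻¹) (x ⁻¹ * bar (x ⁻¹))
    (sym (⁻¹-inverse x≉0)) (trans (sym (bar-* (x ⁻¹) x)) (trans (bar-cong (⁻¹-inverse x≉0)) bar-1)) (sym fx) (ringIdentity 4 (λ a b c d → a :- b := a :* (:1 :- b :* c) :+ b :* (a :* d :- :1) :+ b :* a :* (c
          :- d)) (_ ∷ _ ∷ _ ∷ _ ∷ []))

  fixed? : ∀ x → Dec (Fixed x)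
  fixed? x = bar x ≟ x

  norm : Carrier → Carrier
  norm x = x * bar x

  fixed-norm : ∀ x → Fixed (norm x)
  fixed-norm x = trans (bar-* x (bar x)) (trans (*-congˡ (bar-involutive x)) (*-comm _ _))

  norm≉0 : ∀ {x} → x ≉ 0# → norm x ≉ 0#
  norm≉0 x≉0 = *-≉0 x≉0 (bar≉0 x≉0)

  ^1+q : ∀ x → x ^ (q ℕ.+ 1) ≈ norm x
  ^1+q x = trans (^-congʳ x (ℕ.+-comm q 1)) (*-congˡ (bar-def x))

  abstract
    half : ℕ
    half = proj₁ (odd⇒1+2* (proj₂ (proj₂ (proj₂ (proj₂ (proj₂ opp))))))

    q≡1+2half : q ≡ 1 ℕ.+ half ℕ.* 2
    q≡1+2half = proj₂ (odd⇒1+2* (proj₂ (proj₂ (proj₂ (proj₂ (proj₂ opp))))))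

  -- As q is odd and vanishes in the field, 2 = 0 would leave 1 = 0.
  2≉0 : 1# + 1# ≉ 0#
  2≉0 2≈0 = 1≉0 (begin
    1#                                  ≈⟨ trans (+-congˡ (zeroʳ _)) (+-identityʳ 1#) ⟨
    1# + half · 1# * 0#                 ≈⟨ +-congˡ (*-congˡ (trans (sym 2≈0) (+-congˡ (sym (+-identityʳ 1#))))) ⟩
    1# + half · 1# * 2 · 1#             ≈⟨ +-congˡ (×1-homo-* half 2) ⟨
    1# + (half ℕ.* 2) · 1#              ≈⟨ ×-cong q≡1+2half refl ⟨
    q · 1#                              ≈⟨ q·1≈0 ⟩
    0#                                  ∎)

  -- Since `q - 1` is even, conjugation multiplies `x` by a square. The square roots of norms and of
  -- -1 are read off from this.
  bar-half : ∀ x → bar x ≈ x * (x ^ half * x ^ half)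
  bar-half x = begin
    bar x                       ≈⟨ bar-def x ⟨
    x ^ q                       ≈⟨ ^-congʳ x q≡1+2half ⟩
    x * x ^ (half ℕ.* 2)        ≈⟨ *-congˡ (^-assocʳ x half 2) ⟨
    x * (x ^ half) ^ 2          ≈⟨ *-congˡ (*-congˡ (*-identityʳ _)) ⟩
    x * (x ^ half * x ^ half)   ∎

  abstract
    √norm : ∀ x → ∃[ g ] g * g ≈ norm x
    √norm x = x * x ^ half , rearrange x (x ^ half) (bar-half x)
      where
      rearrange : ∀ x h {x̄} → x̄ ≈ x * (h * h) → (x * h) * (x * h) ≈ x * x̄
      rearrange x h eq = combine₁ (- x) eq (ringIdentity 3 (λ a b c → a :* b :* (a :* b) :- a :* c := (:- a) :* (c :- a :* (b :* b))) (_ ∷ _ ∷ _ ∷ []))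

    nonfixed : ∃[ x ] ¬ Fixed x
    nonfixed with e , ≡q ← 2+≡ (oddPrimePower≥3 opp)
      with x , differ ← powers-differ 1 e (≡.subst (_< q ℕ.^ 2) (≡.sym ≡q) (q<q^2 (oddPrimePower≥3 opp))) =
      x , λ fx → differ (trans (^-congʳ x ≡q) (trans (bar-def x) (trans fx (sym (*-identityʳ x)))))

    bar[x-bar] : ∀ x → bar (x - bar x) ≈ - (x - bar x)
    bar[x-bar] x = combine₂ 1# (- 1#) (bar-sub x (bar x)) (bar-involutive x) (ringIdentity 4 (λ a b c d → a :- (:- (b :- c)) := :1 :* (a :- (c :- d)) :+ (:- :1) :* (d :- b)) (_ ∷ _ ∷ _ ∷ _ ∷ []))

    imaginary : ∃[ δ ] bar δ ≈ - δ × δ ≉ 0#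
    imaginary = let x , ¬fx = nonfixed in x - bar x , bar[x-bar] x , -≉0 {x} {bar x} (λ eq → ¬fx (sym eq))

    √-1 : ∃[ i ] i * i ≈ - 1#
    √-1 = let δ , δ̄≈-δ , δ≉0 = imaginary in
      δ ^ half , rearrange δ (δ ^ half) δ≉0 (trans (sym (bar-half δ)) δ̄≈-δ)
      where
      rearrange : ∀ δ h → δ ≉ 0# → δ * (h * h) ≈ - δ → h * h ≈ - 1#
      rearrange δ h δ≉0 eq = combine₁ 1# (*-cancel-0 {δ} {h * h + 1#} δ≉0 (combine₁ 1# eq (ringIdentity 2 (λ a b → a :* (b :* b :+ :1) :- :0 := :1 :* (a :* (b :* b) :- (:- a))) (_ ∷ _ ∷ [])))) (ringIdentity 1 (λ a → a :* a :- (:- :1) := :1 :* (a :* a :+ :1 :- :0)) (_ ∷ []))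

    -- The conjugate of `g` has the same square as `g`, so it is `g` or `- g`.
    √fixed : ∀ {g} → Fixed (g * g) → Fixed g ⊎ bar g ≈ - g
    √fixed {g} fg² = [ (λ eq → inj₁ (combine₁ {bar g} {g} 1# eq (ringIdentity 2 (λ a b → a :- b := :1 :* (a :- b :- :0)) (_ ∷ _ ∷ [])))) , (λ eq → inj₂ (combine₁ {bar g} { - g} 1# eq (ringIdentity 2 (λ a b → a :- (:- b) := :1 :* (a :+ b :- :0)) (_ ∷ _ ∷ [])))) ]′
      (*≈0⇒ {bar g - g} {bar g + g} (combine₁ {(bar g - g) * (bar g + g)} {0#} 1# (trans (sym (bar-* g g)) fg²) (ringIdentity 2 (λ a b → (a :- b) :* (a :+ b) :- :0 := :1 :* (a :* a :- b :* b)) (_ ∷ _ ∷ []))))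

    -- Taking `s` to be a norm puts it into 𝔽q automatically and moves the counting of roots to the
    -- whole field, whose size is given.
    fixed-element : ∀ m → 4 ℕ.+ m ≤ q → ∃[ s ] Fixed s × s ^ (2 ℕ.+ m) ≉ s
    fixed-element m 4+m≤q with x , x^≉ ← powers-differ (suc q) (q ℕ.+ m ℕ.* suc q) (exponent-bound m 4+m≤q) =
      norm x , fixed-norm x , λ eq → x^≉ (begin
        x ^ (suc q ℕ.+ suc (q ℕ.+ m ℕ.* suc q)) ≈⟨ ^-congʳ x (ℕ.*-comm (2 ℕ.+ m) (suc q)) ⟩
        x ^ (suc q ℕ.* (2 ℕ.+ m))           ≈⟨ ^-assocʳ x (suc q) (2 ℕ.+ m) ⟨
        (x ^ suc q) ^ (2 ℕ.+ m)             ≈⟨ ^-congˡ (2 ℕ.+ m) (*-congˡ (bar-def x)) ⟩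
        norm x ^ (2 ℕ.+ m)                  ≈⟨ eq ⟩
        norm x                              ≈⟨ *-congˡ (bar-def x) ⟨
        x ^ suc q                           ∎)

  -- Homogeneous coordinates and membership in the unital

  ∼-refl : ∀ P → P ∼ P
  ∼-refl P = Setoid.refl homogeneousSetoid {P}

  ∼-sym : ∀ P Q → P ∼ Q → Q ∼ P
  ∼-sym P Q = Setoid.sym homogeneousSetoid {P} {Q}

  ∼-trans : ∀ P Q R → P ∼ Q → Q ∼ R → P ∼ R
  ∼-trans P Q R = Setoid.trans homogeneousSetoid {P} {Q} {R}

  homogeneous : (x y z : Carrier) (i : Fin 3) → (x Functional.∷ y Functional.∷ z Functional.∷ Functional.[]) i ≉ 0# → Homogeneous
  homogeneous x y z i ≉0 = (x Functional.∷ y Functional.∷ z Functional.∷ Functional.[]) , i , ≉0⇒#0 ≉0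

  scaled : ∀ P Q {k} → k ≉ 0# → coords P 0F ≈ k * coords Q 0F →
    coords P 1F ≈ k * coords Q 1F → coords P 2F ≈ k * coords Q 2F → P ∼ Q
  scaled P Q {k} k≉0 e₀ e₁ e₂ = k , ≉0⇒#0 k≉0 , λ where
    0F → e₀
    1F → e₁
    2F → e₂

  #⇒≉ : ∀ {x} → x # 0# → x ≉ 0#
  #⇒≉ x#0 x≈0 = #-irrefl x≈0 x#0

  dot : Coords → Coords → Carrier
  dot l v = l 0F * v 0F + l 1F * v 1F + l 2F * v 2F

  on⇒dot : ∀ P l → P on l → dot (coords l) (coords P) ≈ 0#
  on⇒dot P l P∈l = expand (coords l 0F) (coords l 1F) (coords l 2F) (coords P 0F) (coords P 1F) (coords P 2F) P∈l
    where
    expand : ∀ l m n x y z → l * x + (m * y + (n * z + 0#)) ≈ 0# → l * x + m * y + n * z ≈ 0#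
    expand l m n x y z eq = combine₁ 1# eq (ringIdentity 6 (λ a b c d e f → a :* b :+ c :* d :+ e :* f :- :0 := :1 :* (a :* b :+ (c :* d :+ (e
          :* f :+ :0)) :- :0)) (_ ∷ _ ∷ _ ∷ _ ∷ _ ∷ _ ∷ []))

  dot⇒on : ∀ P l → dot (coords l) (coords P) ≈ 0# → P on l
  dot⇒on P l P∈l = expand (coords l 0F) (coords l 1F) (coords l 2F) (coords P 0F) (coords P 1F) (coords P 2F) P∈l
    where
    expand : ∀ l m n x y z → l * x + m * y + n * z ≈ 0# → l * x + (m * y + (n * z + 0#)) ≈ 0#
    expand l m n x y z eq = combine₁ 1# eq (ringIdentity 6 (λ a b c d e f → a :* b :+ (c :* d :+ (e :* f :+ :0)) :- :0 := :1 :* (a :* b :+ c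
          :* d :+ e :* f :- :0)) (_ ∷ _ ∷ _ ∷ _ ∷ _ ∷ _ ∷ []))

  on-∼ : ∀ P Q l m → P ∼ Q → l ∼ m → Q on m → P on l
  on-∼ P Q l m (j , _ , P≈) (k , _ , l≈) Q∈m = dot⇒on P l
    (trans (+-cong (+-cong (*-cong (l≈ 0F) (P≈ 0F)) (*-cong (l≈ 1F) (P≈ 1F))) (*-cong (l≈ 2F) (P≈ 2F)))
      (rescale j k (coords m 0F) (coords m 1F) (coords m 2F) (coords Q 0F) (coords Q 1F) (coords Q 2F) (on⇒dot Q m Q∈m)))
    where
    rescale : ∀ j k l m n x y z → l * x + m * y + n * z ≈ 0# →
      (k * l) * (j * x) + (k * m) * (j * y) + (k * n) * (j * z) ≈ 0#
    rescale j k l m n x y z eq = combine₁ (j * k) eq (ringIdentity 8 (λ a b c d e f g h → a :* b :* (c :* d) :+ a :* e :* (c :* f) :+ a :* g :* (c :* h)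
          :- :0 := c :* a :* (b :* d :+ e :* f :+ g :* h :- :0)) (_ ∷ _ ∷ _ ∷ _ ∷ _ ∷ _ ∷ _ ∷ _ ∷ []))

  curve : (a b x : Carrier) → Carrier
  curve a b x = a * (x * x) + b * norm x

  curve-≈ : ∀ a b x → a * x ^ 2 + b * x ^ (q ℕ.+ 1) ≈ curve a b x
  curve-≈ a b x = +-cong (*-congˡ (*-congˡ (*-identityʳ x))) (*-congˡ (^1+q x))

  affine-cong : ∀ x {y y′} → y ≈ y′ → affine x y ∼ affine x y′
  affine-cong x {y} {y′} y≈y′ = scaled (affine x y) (affine x y′) 1≉0
    (sym (*-identityˡ x)) (trans y≈y′ (sym (*-identityˡ y′))) (sym (*-identityˡ 1#))

  𝓤-affine : ∀ a b P x y → P ∼ affine x y → Fixed (y - curve a b x) → 𝓤 a b P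
  𝓤-affine a b P x y P∼ fy = inj₁ (x , y - curve a b x , fixed⇒𝔽q fy ,
    ∼-trans P (affine x y) (affine x (a * x ^ 2 + b * x ^ (q ℕ.+ 1) + (y - curve a b x))) P∼ (affine-cong x
      (sym (trans (+-congʳ (curve-≈ a b x)) (cancel (curve a b x) y)))))
    where
    cancel : ∀ u y → u + (y - u) ≈ y
    cancel u y = (ringIdentity 2 (λ a b → a :+ (b :- a) := b) (_ ∷ _ ∷ []))

  𝓤-cases : ∀ a b P → 𝓤 a b P → (∃[ x ] ∃[ y ] P ∼ affine x y × Fixed (y - curve a b x)) ⊎ P ∼ T∞
  𝓤-cases a b P (inj₂ P∼) = inj₂ P∼
  𝓤-cases a b P (inj₁ (x , r , r∈ , P∼)) = inj₁ (x , curve a b x + r ,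
    ∼-trans P (affine x (a * x ^ 2 + b * x ^ (q ℕ.+ 1) + r)) (affine x (curve a b x + r)) P∼
      (affine-cong x (+-congʳ (curve-≈ a b x))) ,
    fixed-cong (cancel (curve a b x) r) (𝔽q⇒fixed r∈))
    where
    cancel : ∀ u r → r ≈ u + r - u
    cancel u r = (ringIdentity 2 (λ a b → a := b :+ a :- b) (_ ∷ _ ∷ []))

  𝓤-∼ : ∀ a b P Q → P ∼ Q → 𝓤 a b Q → 𝓤 a b P
  𝓤-∼ a b P Q P∼Q (inj₂ Q∼) = inj₂ (∼-trans P Q T∞ P∼Q Q∼)
  𝓤-∼ a b P Q P∼Q (inj₁ (x , r , r∈ , Q∼)) = inj₁ (x , r , r∈ , ∼-trans P Q (affine x _) P∼Q Q∼)

  T∞∈𝓤 : ∀ a b → 𝓤 a b T∞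
  T∞∈𝓤 a b = inj₂ (∼-refl T∞)

  -- With a = w g the point (1 , y , w) lies on the unital exactly when
  -- (y - g) w̄ - b is fixed: multiply its affine equation by w w̄.
  𝓤-dual : ∀ a b P y w g → coords P 0F ≈ 1# → coords P 1F ≈ y → coords P 2F ≈ w → w ≉ 0# →
    a ≈ w * g → Fixed ((y - g) * bar w - b) → 𝓤 a b P
  𝓤-dual a b P y w g P₀ P₁ P₂ w≉0 a≈wg f = 𝓤-affine a b P (w ⁻¹) (y * w ⁻¹)
    (scaled P (affine (w ⁻¹) (y * w ⁻¹)) w≉0
      (trans P₀ (combine₁ {1#} {w * w ⁻¹} (- 1#) (⁻¹-inverse w≉0) (ringIdentity 2 (λ a b → :1 :- a :* b := (:- :1) :* (b :* a :- :1)) (_ ∷ _ ∷ []))))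
      (trans P₁ (combine₁ {y} {w * (y * w ⁻¹)} (- y) (⁻¹-inverse w≉0) (ringIdentity 3 (λ a b c → a :- b :* (a :* c) := (:- a) :* (c :* b :- :1)) (_ ∷ _ ∷ _ ∷ []))))
      (trans P₂ (sym (*-identityʳ w))))
    (fixed-cong (equation a b w (w ⁻¹) (bar w) (bar (w ⁻¹)) y g (⁻¹-inverse w≉0)
        (trans (sym (bar-* (w ⁻¹) w)) (trans (bar-cong (⁻¹-inverse w≉0)) bar-1)) a≈wg)
      (fixed-* (fixed-norm (w ⁻¹)) f))
    where
    equation : ∀ a b w j w̄ j̄ y g → j * w ≈ 1# → j̄ * w̄ ≈ 1# → a ≈ w * g →
      (j * j̄) * ((y - g) * w̄ - b) ≈ y * j - (a * (j * j) + b * (j * j̄))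
    equation a b w j w̄ j̄ y g jw≈1 j̄w̄≈1 a≈wg =
      combine₃ (j * (y - g)) (j * g) (j * j) j̄w̄≈1 jw≈1 a≈wg (ringIdentity 8 (λ a b c d e f g h → a :* b :* ((c :- d) :* e :- f) :- (c :* a :- (g :* (a :* a)
            :+ f :* (a :* b))) := a :* (c :- d) :* (b :* e :- :1) :+ a :* d :* (a :* h :- :1) :+ a
            :* a :* (g :- h :* d)) (_ ∷ _ ∷ _ ∷ _ ∷ _ ∷ _ ∷ _ ∷ _ ∷ []))

  nonzero-coordinate : ∀ l → coords l 0F ≈ 0# → coords l 1F ≈ 0# → coords l 2F ≈ 0# → ⊥
  nonzero-coordinate (v , 0F , v#0) e₀ e₁ e₂ = #-irrefl e₀ v#0
  nonzero-coordinate (v , 1F , v#0) e₀ e₁ e₂ = #-irrefl e₁ v#0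
  nonzero-coordinate (v , 2F , v#0) e₀ e₁ e₂ = #-irrefl e₂ v#0

  -- The seven points of the configuration and its six sides

  -- Indexing by the omitted vertex `t` leaves four cases instead of all ordered triples.
  no-three-collinear : ∀ (vertex : Fin 4 → Point) →
    (∀ t → ¬ (∃[ l ] ∀ s → s ≢ t → vertex s on l)) →
    ∀ i j k → i ≢ j → j ≢ k → i ≢ k → ¬ (∃[ l ] vertex i on l × vertex j on l × vertex k on l)
  no-three-collinear vertex no-line i j k i≢j j≢k i≢k (l , i∈l , j∈l , k∈l) =
    let t , covered = remaining-vertex i j k i≢j j≢k i≢k in
    no-line t (l , λ s s≢t → [ (λ { ≡.refl → i∈l }) , [ (λ { ≡.refl → j∈l }) , (λ { ≡.refl → k∈l }) ]′ ]′ (covered s s≢t))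

  -- The affine point `(1 / w , y / w)` if `w` is nonzero.
  dualPoint : Carrier → Carrier → Point
  dualPoint y w = homogeneous 1# y w 0F 1≉0

  -- The join of `(0 , ρ , 1)` and `(1 , y , w)`.
  slanted : Carrier → Carrier → Carrier → Line
  slanted ρ y w = homogeneous (ρ * w - y) 1# (- ρ) 1F 1≉0

  vertical : Line
  vertical = homogeneous 1# 0# 0# 0F 1≉0

  -- The heights `R`, `S` on the special side satisfy `S - R = 2 e` and `κ = (R + S) / (R - S)`. The
  -- two other vertices share the height `M`, so their join `y = M x` passes through the origin.
  -- Intersecting opposite sides gives `(S - R) w₁ = S p (1 - n) - R p (1 + n)`, which is
  -- `2 e p (1 + κ n)`; changing the sign of `n` gives `w₂`.
  module Quadrangle (M e p n κ : Carrier)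
    (e≉0 : e ≉ 0#) (p≉0 : p ≉ 0#) (n≉0 : n ≉ 0#) (1-κ≉0 : 1# - κ ≉ 0#) (1+κ≉0 : 1# + κ ≉ 0#)
    where
    R S w₁ w₂ Y₁ Y₂ : Carrier
    R  = - ((1# + κ) * e)
    S  = (1# - κ) * e
    w₁ = p * (1# + κ * n)
    w₂ = p * (1# - κ * n)
    Y₁ = M + (1# - κ * κ) * (e * (p * n))
    Y₂ = M - (1# - κ * κ) * (e * (p * n))

    vertex : Fin 4 → Point
    vertex 0F = affine 0# R
    vertex 1F = affine 0# S
    vertex 2F = dualPoint M (p * (1# + n))
    vertex 3F = dualPoint M (p * (1# - n))

    diagonal : Fin 3 → Point
    diagonal 0F = affine 0# 0#
    diagonal 1F = dualPoint Y₁ w₁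
    diagonal 2F = dualPoint Y₂ w₂

    side : Fin 3 → Fin 2 → Line
    side 0F 0F = vertical
    side 0F 1F = slanted 0# M 0#
    side 1F 0F = slanted R M (p * (1# + n))
    side 1F 1F = slanted S M (p * (1# - n))
    side 2F 0F = slanted R M (p * (1# - n))
    side 2F 1F = slanted S M (p * (1# + n))

    affine-on-vertical : ∀ y → affine 0# y on vertical
    affine-on-vertical y = (ringIdentity 1 (λ a → :1 :* :0 :+ (:0 :* a :+ (:0 :* :1 :+ :0)) := :0) (_ ∷ []))

    affine-on-slanted : ∀ ρ y w → affine 0# ρ on slanted ρ y w
    affine-on-slanted ρ y w = (ringIdentity 3 (λ a b c → (a :* b :- c) :* :0 :+ (:1 :* a :+ ((:- a) :* :1 :+ :0)) := :0) (_ ∷ _ ∷ _ ∷ []))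

    dual-on-slanted : ∀ ρ y w → dualPoint y w on slanted ρ y w
    dual-on-slanted ρ y w = (ringIdentity 3 (λ a b c → (a :* b :- c) :* :1 :+ (:1 :* c :+ ((:- a) :* b :+ :0)) := :0) (_ ∷ _ ∷ _ ∷ []))

    joins : ∀ π s → vertex (proj₁ (pair π s)) on side π s × vertex (proj₂ (pair π s)) on side π s
    joins 0F 0F = affine-on-vertical R , affine-on-vertical S
    joins 0F 1F = (ringIdentity 3 (λ a b c → (:0 :* :0 :- a) :* :1 :+ (:1 :* a :+ ((:- :0) :* (b :* (:1 :+ c)) :+
          :0)) := :0) (_ ∷ _ ∷ _ ∷ [])) , (ringIdentity 3 (λ a b c → (:0 :* :0 :- a) :* :1 :+ (:1 :* a :+ ((:- :0) :* (b :* (:1 :- c)) :+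
          :0)) := :0) (_ ∷ _ ∷ _ ∷ []))
    joins 1F 0F = affine-on-slanted R M (p * (1# + n)) , dual-on-slanted R M (p * (1# + n))
    joins 1F 1F = affine-on-slanted S M (p * (1# - n)) , dual-on-slanted S M (p * (1# - n))
    joins 2F 0F = affine-on-slanted R M (p * (1# - n)) , dual-on-slanted R M (p * (1# - n))
    joins 2F 1F = affine-on-slanted S M (p * (1# + n)) , dual-on-slanted S M (p * (1# + n))

    meets : ∀ π → diagonal π on side π 0F × diagonal π on side π 1F
    meets 0F = affine-on-vertical 0# , (ringIdentity 1 (λ a → (:0 :* :0 :- a) :* :0 :+ (:1 :* :0 :+ ((:- :0) :* :1 :+ :0)) := :0) (_ ∷ []))
    meets 1F = (ringIdentity 5 (λ a b c d e → ((:- ((:1 :+ a) :* b)) :* (c :* (:1 :+ d)) :- e) :* :1 :+ (:1 :* (e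
          :+ (:1 :- a :* a) :* (b :* (c :* d))) :+ ((:- (:- ((:1 :+ a) :* b))) :* (c :* (:1 :+ a
          :* d)) :+ :0)) := :0) (_ ∷ _ ∷ _ ∷ _ ∷ _ ∷ [])) , (ringIdentity 5 (λ a b c d e → ((:1 :- a) :* b :* (c :* (:1 :- d)) :- e) :* :1 :+ (:1 :* (e :+ (:1
          :- a :* a) :* (b :* (c :* d))) :+ ((:- ((:1 :- a) :* b)) :* (c :* (:1 :+ a :* d)) :+
          :0)) := :0) (_ ∷ _ ∷ _ ∷ _ ∷ _ ∷ []))
    meets 2F = (ringIdentity 5 (λ a b c d e → ((:- ((:1 :+ a) :* b)) :* (c :* (:1 :- d)) :- e) :* :1 :+ (:1 :* (e
          :- (:1 :- a :* a) :* (b :* (c :* d))) :+ ((:- (:- ((:1 :+ a) :* b))) :* (c :* (:1 :- a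
          :* d)) :+ :0)) := :0) (_ ∷ _ ∷ _ ∷ _ ∷ _ ∷ [])) , (ringIdentity 5 (λ a b c d e → ((:1 :- a) :* b :* (c :* (:1 :+ d)) :- e) :* :1 :+ (:1 :* (e :- (:1
          :- a :* a) :* (b :* (c :* d))) :+ ((:- ((:1 :- a) :* b)) :* (c :* (:1 :- a :* d)) :+
          :0)) := :0) (_ ∷ _ ∷ _ ∷ _ ∷ _ ∷ []))

    R≉0 : R ≉ 0#
    R≉0 = -‿≉0 {(1# + κ) * e} (*-≉0 {1# + κ} {e} 1+κ≉0 e≉0)

    S≉0 : S ≉ 0#
    S≉0 = *-≉0 {1# - κ} {e} 1-κ≉0 e≉0

    two-vertical : ∀ l y w → affine 0# R on l → affine 0# S on l → dualPoint y w on l → ⊥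
    two-vertical l y w A∈l B∈l C∈l = nonzero-coordinate l l₀≈0 l₁≈0 l₂≈0
      where
      x = coords l 0F
      m = coords l 1F
      k = coords l 2F
      l₁≈0 : m ≈ 0#
      -- The heights of the two points on the special side differ by `2 e`, so the difference of the
      -- incidences isolates the middle coordinate of the line.
      l₁≈0 = *-cancel-0 {(1# + 1#) * e} {m} (*-≉0 {1# + 1#} {e} 2≉0 e≉0)
        (combine₂ {(1# + 1#) * e * m} {0#} (- 1#) 1# (on⇒dot (affine 0# R) l A∈l) (on⇒dot (affine 0# S) l B∈l) (ringIdentity 5 (λ a b c d e → (:1 :+ :1) :* a :* b :- :0 := (:- :1) :* (c :* :0 :+ b :* (:- ((:1
              :+ d) :* a)) :+ e :* :1 :- :0) :+ :1 :* (c :* :0 :+ b :* ((:1 :- d) :* a) :+ e :* :1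
              :- :0)) (_ ∷ _ ∷ _ ∷ _ ∷ _ ∷ [])))
      l₂≈0 : k ≈ 0#
      l₂≈0 = combine₂ {k} {0#} 1# (- R) (on⇒dot (affine 0# R) l A∈l) l₁≈0 (ringIdentity 5 (λ a b c d e → a :- :0 := :1 :* (b :* :0 :+ c :* (:- ((:1 :+ d) :* e)) :+ a :* :1
            :- :0) :+ (:- (:- ((:1 :+ d) :* e))) :* (c :- :0)) (_ ∷ _ ∷ _ ∷ _ ∷ _ ∷ []))
      l₀≈0 : x ≈ 0#
      l₀≈0 = combine₃ {x} {0#} 1# (- y) (- w) (on⇒dot (dualPoint y w) l C∈l) l₁≈0 l₂≈0 (ringIdentity 5 (λ a b c d e → a :- :0 := :1 :* (a :* :1 :+ b :* c :+ d :* e :- :0) :+ (:- c) :* (b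
            :- :0) :+ (:- e) :* (d :- :0)) (_ ∷ _ ∷ _ ∷ _ ∷ _ ∷ []))

    one-vertical : ∀ l ρ → ρ ≉ 0# → affine 0# ρ on l →
      dualPoint M (p * (1# + n)) on l → dualPoint M (p * (1# - n)) on l → ⊥
    one-vertical l ρ ρ≉0 A∈l C∈l E∈l = nonzero-coordinate l l₀≈0 l₁≈0 l₂≈0
      where
      x = coords l 0F
      m = coords l 1F
      k = coords l 2F
      l₂≈0 : k ≈ 0#
      -- The two points off the special side agree except in the dual coordinate, where they differ
      -- by `2 p n`.
      l₂≈0 = *-cancel-0 {(1# + 1#) * (p * n)} {k} (*-≉0 {1# + 1#} {p * n} 2≉0 (*-≉0 {p} {n} p≉0 n≉0))
        (combine₂ {(1# + 1#) * (p * n) * k} {0#} 1# (- 1#) (on⇒dot (dualPoint M (p * (1# + n))) l C∈l)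
          (on⇒dot (dualPoint M (p * (1# - n))) l E∈l) (ringIdentity 6 (λ a b c d e f → (:1 :+ :1) :* (a :* b) :* c :- :0 := :1 :* (d :* :1 :+ e :* f
                :+ c :* (a :* (:1 :+ b)) :- :0) :+ (:- :1) :* (d :* :1 :+ e :* f :+ c :* (a :* (:1
                :- b)) :- :0)) (_ ∷ _ ∷ _ ∷ _ ∷ _ ∷ _ ∷ [])))
      l₁≈0 : m ≈ 0#
      l₁≈0 = *-cancel-0 {ρ} {m} ρ≉0 (combine₂ {ρ * m} {0#} 1# (- 1#) (on⇒dot (affine 0# ρ) l A∈l) l₂≈0 (ringIdentity 4 (λ a b c d → a :* b :- :0 := :1 :* (c :* :0 :+ b :* a :+ d :* :1 :- :0) :+ (:-
            :1) :* (d :- :0)) (_ ∷ _ ∷ _ ∷ _ ∷ [])))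
      l₀≈0 : x ≈ 0#
      l₀≈0 = combine₃ {x} {0#} 1# (- M) (- (p * (1# + n))) (on⇒dot (dualPoint M (p * (1# + n))) l C∈l) l₁≈0 l₂≈0 (ringIdentity 6 (λ a b c d e f → a :- :0 := :1 :* (a :* :1 :+ b :* c :+ d :* (e :* (:1 :+ f)) :-
            :0) :+ (:- c) :* (b :- :0) :+ (:- (e :* (:1 :+ f))) :* (d :- :0)) (_ ∷ _ ∷ _ ∷ _ ∷ _ ∷ _ ∷ []))

    no-line : ∀ t → ¬ (∃[ l ] ∀ s → s ≢ t → vertex s on l)
    no-line 0F (l , on-l) = one-vertical l S S≉0 (on-l 1F λ ()) (on-l 2F λ ()) (on-l 3F λ ())
    no-line 1F (l , on-l) = one-vertical l R R≉0 (on-l 0F λ ()) (on-l 2F λ ()) (on-l 3F λ ())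
    no-line 2F (l , on-l) = two-vertical l M (p * (1# - n)) (on-l 0F λ ()) (on-l 1F λ ()) (on-l 3F λ ())
    no-line 3F (l , on-l) = two-vertical l M (p * (1# + n)) (on-l 0F λ ()) (on-l 1F λ ()) (on-l 2F λ ())

    configuration : ∀ (T : PointSet) → (∀ i → T (vertex i)) → (∀ π → T (diagonal π)) →
      ContainsBMSpecialTripleO'Nan T
    configuration T vertices diagonals = record
      { vertex     = vertex
      ; vertex∈    = vertices
      ; quadrangle = no-three-collinear vertex no-line
      ; side       = side
      ; joins      = joins
      ; meet       = λ π → diagonal π , diagonals π , meets π
      } , 0F , 0F , T∞-on-vertical
      where
      T∞-on-vertical : T∞ on vertical
      T∞-on-vertical = (ringIdentity 0 (:1 :* :0 :+ (:0 :* :1 :+ (:0 :* :0 :+ :0)) := :0) ([]))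

  -- Conditions for the seven points to lie on the unital

  infixl 6 _⟨+⟩_ _⟨-⟩_
  infixl 7 _⟨*⟩_
  -- These combinators follow the syntax of a term, so that the proof computing the conjugate of a
  -- long expression is written like the expression itself.
  _⟨+⟩_ : ∀ {x x̄ y ȳ} → bar x ≈ x̄ → bar y ≈ ȳ → bar (x + y) ≈ x̄ + ȳ
  _⟨+⟩_ {x} {x̄} {y} {ȳ} ex ey = trans (bar-+ x y) (+-cong ex ey)

  _⟨-⟩_ : ∀ {x x̄ y ȳ} → bar x ≈ x̄ → bar y ≈ ȳ → bar (x - y) ≈ x̄ - ȳ
  _⟨-⟩_ {x} {x̄} {y} {ȳ} ex ey = trans (bar-sub x y) (+-cong ex (-‿cong ey))

  _⟨*⟩_ : ∀ {x x̄ y ȳ} → bar x ≈ x̄ → bar y ≈ ȳ → bar (x * y) ≈ x̄ * ȳ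
  _⟨*⟩_ {x} {x̄} {y} {ȳ} ex ey = trans (bar-* x y) (*-cong ex ey)

  ⟨neg⟩ : ∀ {x x̄} → bar x ≈ x̄ → bar (- x) ≈ - x̄
  ⟨neg⟩ {x} ex = trans (bar-neg x) (-‿cong ex)

  -- The slope of the line joining the vertices off the special side,
  -- after scaling so that the midpoint of the dual coordinates is 1.
  slope : (n n̄ k γ θ : Carrier) → Carrier
  slope n n̄ k γ θ = n * γ * (n + n̄) * (1# - n * n̄) * (1# - k * (n * n̄)) + n * θ
    - γ * ((n - n̄) * (n - n̄)) * (1# + k * (n * n̄))

  bar-slope : ∀ {n n̄ k γ θ} → bar n ≈ n̄ → bar n̄ ≈ n → Fixed k → Fixed γ → Fixed θ →
    bar (slope n n̄ k γ θ) ≈ slope n̄ n k γ θ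
  bar-slope n n̄ k γ θ =
    n ⟨*⟩ γ ⟨*⟩ (n ⟨+⟩ n̄) ⟨*⟩ (bar-1 ⟨-⟩ n ⟨*⟩ n̄) ⟨*⟩ (bar-1 ⟨-⟩ k ⟨*⟩ (n ⟨*⟩ n̄)) ⟨+⟩ n ⟨*⟩ θ
    ⟨-⟩ γ ⟨*⟩ ((n ⟨-⟩ n̄) ⟨*⟩ (n ⟨-⟩ n̄)) ⟨*⟩ (bar-1 ⟨+⟩ k ⟨*⟩ (n ⟨*⟩ n̄))

  -- The term subtracted from the slope is `α / (1 + n)` for
  -- `α = γ n̄ (n - n̄) (1 - n²) (1 - k n²)`. The summand `n θ` of the slope contributes
  -- `θ (n - n̄)` to the difference from the conjugate, which cancels `b - b̄`; in this way every
  -- `b` is accommodated.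
  fixed-vertex : ∀ {n n̄ k γ θ b b̄} → bar n ≈ n̄ → bar n̄ ≈ n → Fixed k → Fixed γ → Fixed θ →
    bar b ≈ b̄ → b - b̄ ≈ θ * (n - n̄) →
    Fixed ((slope n n̄ k γ θ - γ * n̄ * (n - n̄) * (1# - n) * (1# - k * (n * n))) * (1# + n̄) - b)
  fixed-vertex {n} {n̄} {k} {γ} {θ} {b} {b̄} en en̄ ek eγ eθ eb b-b̄ = trans
    ((bar-slope en en̄ ek eγ eθ ⟨-⟩ eγ ⟨*⟩ en̄ ⟨*⟩ (en ⟨-⟩ en̄) ⟨*⟩ (bar-1 ⟨-⟩ en) ⟨*⟩ (bar-1 ⟨-⟩ ek ⟨*⟩ (en ⟨*⟩ en)))
      ⟨*⟩ (bar-1 ⟨+⟩ en̄) ⟨-⟩ eb)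
    (combine₁ 1# b-b̄ (ringIdentity 7 (λ a b c d e f g → (a :* b :* (a :+ c) :* (:1 :- a :* c) :* (:1 :- d :* (a :* c))
          :+ a :* e :- b :* ((a :- c) :* (a :- c)) :* (:1 :+ d :* (a :* c)) :- b :* c :* (a :- c)
          :* (:1 :- a) :* (:1 :- d :* (a :* a))) :* (:1 :+ c) :- f :- ((c :* b :* (c :+ a) :* (:1
          :- c :* a) :* (:1 :- d :* (c :* a)) :+ c :* e :- b :* ((c :- a) :* (c :- a)) :* (:1 :+ d
          :* (c :* a)) :- b :* a :* (c :- a) :* (:1 :- c) :* (:1 :- d :* (c :* c))) :* (:1 :+ a)
          :- g) := :1 :* (g :- f :- e :* (c :- a))) (_ ∷ _ ∷ _ ∷ _ ∷ _ ∷ _ ∷ _ ∷ [])))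

  -- The same for the dual coordinate `1 + κ n`: the height exceeds the slope by `(1 - κ²) e n`,
  -- with `e` scaled to `κ γ n n̄ (n - n̄)²`, and `α / (1 + κ n)` is subtracted.
  fixed-diagonal : ∀ {n n̄ κ γ θ b b̄} → bar n ≈ n̄ → bar n̄ ≈ n → Fixed κ → Fixed γ → Fixed θ →
    bar b ≈ b̄ → b - b̄ ≈ θ * (n - n̄) →
    Fixed ((slope n n̄ (κ * κ) γ θ
      + (1# - κ * κ) * (κ * γ * (n * n̄) * ((n - n̄) * (n - n̄)) * n)
      - γ * n̄ * (n - n̄) * (1# - n * n) * (1# - κ * n)) * (1# + κ * n̄) - b)
  fixed-diagonal {n} {n̄} {κ} {γ} {θ} {b} {b̄} en en̄ eκ eγ eθ eb b-b̄ = trans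
    ((bar-slope en en̄ (eκ ⟨*⟩ eκ) eγ eθ
      ⟨+⟩ (bar-1 ⟨-⟩ eκ ⟨*⟩ eκ) ⟨*⟩ (eκ ⟨*⟩ eγ ⟨*⟩ (en ⟨*⟩ en̄) ⟨*⟩ ((en ⟨-⟩ en̄) ⟨*⟩ (en ⟨-⟩ en̄)) ⟨*⟩ en)
      ⟨-⟩ eγ ⟨*⟩ en̄ ⟨*⟩ (en ⟨-⟩ en̄) ⟨*⟩ (bar-1 ⟨-⟩ en ⟨*⟩ en) ⟨*⟩ (bar-1 ⟨-⟩ eκ ⟨*⟩ en))
      ⟨*⟩ (bar-1 ⟨+⟩ eκ ⟨*⟩ en̄) ⟨-⟩ eb)
    (combine₁ 1# b-b̄ (ringIdentity 7 (λ a b c d e f g → (a :* b :* (a :+ c) :* (:1 :- a :* c) :* (:1 :- d :* d :* (a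
          :* c)) :+ a :* e :- b :* ((a :- c) :* (a :- c)) :* (:1 :+ d :* d :* (a :* c)) :+ (:1
          :- d :* d) :* (d :* b :* (a :* c) :* ((a :- c) :* (a :- c)) :* a) :- b :* c :* (a :- c)
          :* (:1 :- a :* a) :* (:1 :- d :* a)) :* (:1 :+ d :* c) :- f :- ((c :* b :* (c :+ a) :* (:1
          :- c :* a) :* (:1 :- d :* d :* (c :* a)) :+ c :* e :- b :* ((c :- a) :* (c :- a)) :* (:1
          :+ d :* d :* (c :* a)) :+ (:1 :- d :* d) :* (d :* b :* (c :* a) :* ((c :- a) :* (c :- a))
          :* c) :- b :* a :* (c :- a) :* (:1 :- c :* c) :* (:1 :- d :* c)) :* (:1 :+ d :* a) :- g)
          := :1 :* (g :- f :- e :* (c :- a))) (_ ∷ _ ∷ _ ∷ _ ∷ _ ∷ _ ∷ _ ∷ [])))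

  -- Zero is fixed, so an element that differs from its conjugate is nonzero.
  from-difference : ∀ {w w̄ d} → bar w ≈ w̄ → w - w̄ ≈ d → d ≉ 0# → w ≉ 0#
  from-difference {w} {w̄} {d} ew eq d≉0 w≈0 = d≉0 (combine₃ {d} {0#} (- 1#) 1# (- 1#) eq w≈0
    (trans (sym ew) (trans (bar-cong w≈0) bar-0)) (ringIdentity 3 (λ a b c → a :- :0 := (:- :1) :* (b :- c :- a) :+ :1 :* (b :- :0) :+ (:- :1) :* (c
          :- :0)) (_ ∷ _ ∷ _ ∷ [])))

  -- Dual coordinates are multiplied by `p` and heights by `π = 1 / p̄`. Membership involves a
  -- height times a conjugate dual coordinate, where the two factors cancel, so `p` enters only
  -- through `a p̄ = p α`.
  𝓤-scaled : ∀ a b p π α → π * bar p ≈ 1# → p ≉ 0# → a * bar p ≈ p * α →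
    ∀ P y w w̄ g → coords P 0F ≈ 1# → coords P 1F ≈ y * π → coords P 2F ≈ p * w →
    bar w ≈ w̄ → w ≉ 0# → w * g ≈ α → Fixed ((y - g) * w̄ - b) → 𝓤 a b P
  𝓤-scaled a b p π α πp̄≈1 p≉0 ap̄≈pα P y w w̄ g P₀ P₁ P₂ ew w≉0 wg≈α f =
    𝓤-dual a b P (y * π) (p * w) (π * g) P₀ P₁ P₂ (*-≉0 {p} {w} p≉0 w≉0)
      (factorise (bar p) πp̄≈1 ap̄≈pα)
      (fixed-cong (rescale (bar p) (bar (p * w)) πp̄≈1 (trans (bar-* p w) (*-congˡ ew))) f)
    where
    factorise : ∀ p̄ → π * p̄ ≈ 1# → a * p̄ ≈ p * α → a ≈ p * w * (π * g)
    factorise p̄ eq eq′ = combine₃ {a} {p * w * (π * g)} (- a) π (- (p * π)) eq eq′ wg≈α (ringIdentity 7 (λ a b c d e f g → a :- b :* c :* (d :* e) := (:- a) :* (d :* f :- :1) :+ d :* (a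
          :* f :- b :* g) :+ (:- (b :* d)) :* (c :* e :- g)) (_ ∷ _ ∷ _ ∷ _ ∷ _ ∷ _ ∷ _ ∷ []))
    rescale : ∀ p̄ v → π * p̄ ≈ 1# → v ≈ p̄ * w̄ → (y - g) * w̄ - b ≈ (y * π - π * g) * v - b
    rescale p̄ v eq eq′ = combine₂ {(y - g) * w̄ - b} {(y * π - π * g) * v - b}
      (- ((y - g) * w̄)) (- ((y - g) * π)) eq eq′ (ringIdentity 7 (λ a b c d e f g → (a :- b) :* c :- d :- ((a :* e :- e :* b) :* f :- d) := (:- ((a
            :- b) :* c)) :* (e :* g :- :1) :+ (:- ((a :- b) :* e)) :* (f :- g :* c)) (_ ∷ _ ∷ _ ∷ _ ∷ _ ∷ _ ∷ _ ∷ []))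

  fixed-quotient : ∀ {δ θ β} → bar δ ≈ - δ → bar β ≈ - β → δ ≉ 0# → β ≈ θ * δ → Fixed θ
  fixed-quotient {δ} {θ} {β} eδ eβ δ≉0 β≈θδ = combine₁ {bar θ} {θ} 1#
    (*-cancel-0 {δ} {bar θ - θ} δ≉0 (vanish (bar θ) (bar δ) (bar β) eδ eβ (trans (bar-cong β≈θδ) (bar-* θ δ)))) (ringIdentity 2 (λ a b → a :- b := :1 :* (a :- b :- :0)) (_ ∷ _ ∷ []))
    where
    vanish : ∀ θ̄ δ̄ β̄ → δ̄ ≈ - δ → β̄ ≈ - β → β̄ ≈ θ̄ * δ̄ → δ * (θ̄ - θ) ≈ 0#
    vanish θ̄ δ̄ β̄ e e′ e″ = combine₂ {δ * (θ̄ - θ)} {0#} 1# 1# β≈θδ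
      (combine₃ {θ̄ * δ} {β} 1# θ̄ (- 1#) e″ e e′ (ringIdentity 5 (λ a b c d e → a :* b :- c := :1 :* (d :- a :* e) :+ a :* (e :- (:- b)) :+ (:-
            :1) :* (d :- (:- c))) (_ ∷ _ ∷ _ ∷ _ ∷ _ ∷ []))) (ringIdentity 4 (λ a b c d → a :* (b :- c) :- :0 := :1 :* (d :- c :* a) :+ :1 :* (b :* a :- d)) (_ ∷ _ ∷ _ ∷ _ ∷ []))

  -- With this invariance the vertex at `1 - n` is the vertex at `1 + n` for the negated parameters.
  slope-even : ∀ n n̄ k γ θ π → slope n n̄ k γ θ * π ≈ slope (- n) (- n̄) k γ (- θ) * π
  slope-even n n̄ k γ θ π = (ringIdentity 6 (λ a b c d e f → (a :* b :* (a :+ c) :* (:1 :- a :* c) :* (:1 :- d :* (a :* c))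
        :+ a :* e :- b :* ((a :- c) :* (a :- c)) :* (:1 :+ d :* (a :* c))) :* f := ((:- a) :* b
        :* (:- a :- c) :* (:1 :- (:- a) :* (:- c)) :* (:1 :- d :* ((:- a) :* (:- c))) :+ (:- a)
        :* (:- e) :- b :* ((:- a :- (:- c)) :* (:- a :- (:- c))) :* (:1 :+ d :* ((:- a) :* (:- c))))
        :* f) (_ ∷ _ ∷ _ ∷ _ ∷ _ ∷ _ ∷ []))

  module _ (a b n κ γ p : Carrier) (eκ : Fixed κ) (eγ : Fixed γ)
    (κ≉0 : κ ≉ 0#) (1-κ≉0 : 1# - κ ≉ 0#) (1+κ≉0 : 1# + κ ≉ 0#) (γ≉0 : γ ≉ 0#) (p≉0 : p ≉ 0#)
    (δ≉0 : n - bar n ≉ 0#)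
    (ap̄≈pα : a * bar p ≈ p * (γ * bar n * (n - bar n) * (1# - n * n) * (1# - κ * κ * (n * n))))
    where
    private
      n̄ δ ν π e θ m : Carrier
      n̄ = bar n
      δ = n - n̄
      ν = norm p ⁻¹
      -- This is `1 / p̄`. The factor `ν` in `e` makes the summand `(1 - κ²) e p n` of a diagonal
      -- height equal to `π` times the corresponding summand in `fixed-diagonal`.
      π = ν * p
      e = κ * γ * (n * n̄) * (δ * δ) * ν
      θ = (b - bar b) * δ ⁻¹
      m = slope n n̄ (κ * κ) γ θ

      en̄ : bar n̄ ≈ n
      en̄ = bar-involutive n

      n≉0 : n ≉ 0#
      n≉0 n≈0 = δ≉0 (combine₂ {δ} {0#} 1# (- 1#) n≈0 (trans (bar-cong n≈0) bar-0) (ringIdentity 2 (λ a b → a :- b :- :0 := :1 :* (a :- :0) :+ (:- :1) :* (b :- :0)) (_ ∷ _ ∷ [])))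

      ν≉0 : ν ≉ 0#
      ν≉0 = ⁻¹≉0 {norm p} (norm≉0 p≉0)

      ν-fixed : Fixed ν
      ν-fixed = fixed-⁻¹ {norm p} (norm≉0 p≉0) (fixed-norm p)

      πp̄≈1 : π * bar p ≈ 1#
      πp̄≈1 = trans (*-assoc ν p (bar p)) (⁻¹-inverse (norm≉0 p≉0))

      e≉0 : e ≉ 0#
      e≉0 = *-≉0 {κ * γ * (n * n̄) * (δ * δ)} {ν} (*-≉0 {κ * γ * (n * n̄)} {δ * δ} (*-≉0 {κ * γ} {n * n̄}
        (*-≉0 {κ} {γ} κ≉0 γ≉0) (norm≉0 n≉0)) (*-≉0 {δ} {δ} δ≉0 δ≉0)) ν≉0

      δδ-fixed : ∀ n̿ → n̿ ≈ n → (n̄ - n̿) * (n̄ - n̿) ≈ δ * δ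
      δδ-fixed n̿ eq = combine₁ {(n̄ - n̿) * (n̄ - n̿)} {δ * δ} (n̿ + n - (1# + 1#) * n̄) eq (ringIdentity 3 (λ a b c → (a :- b) :* (a :- b) :- (c :- a) :* (c :- a) := (b :+ c :- (:1 :+ :1)
            :* a) :* (b :- c)) (_ ∷ _ ∷ _ ∷ []))

      e-fixed : Fixed e
      e-fixed = fixed-* {κ * γ * (n * n̄) * (δ * δ)} {ν} (fixed-* {κ * γ * (n * n̄)} {δ * δ} (fixed-* {κ * γ} {n * n̄}
        (fixed-* {κ} {γ} eκ eγ) (fixed-norm n))
        (trans (bar-* δ δ) (trans (*-cong (bar-sub n n̄) (bar-sub n n̄)) (δδ-fixed (bar n̄) en̄)))) ν-fixed

      b-b̄≈θδ : b - bar b ≈ θ * δ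
      b-b̄≈θδ = combine₁ {b - bar b} {θ * δ} (- (b - bar b)) (⁻¹-inverse δ≉0) (ringIdentity 5 (λ a b c d e → a :- b :- (a :- b) :* c :* (d :- e) := (:- (a :- b)) :* (c :* (d
            :- e) :- :1)) (_ ∷ _ ∷ _ ∷ _ ∷ _ ∷ []))

      θ-fixed : Fixed θ
      θ-fixed = fixed-quotient {δ} {θ} {b - bar b} (bar[x-bar] n) (bar[x-bar] b) δ≉0 b-b̄≈θδ

      fixed-affine : ∀ ρ → Fixed ρ → 𝓤 a b (affine 0# ρ)
      fixed-affine ρ fρ = 𝓤-affine a b (affine 0# ρ) 0# ρ (∼-refl (affine 0# ρ)) (fixed-cong (origin (bar 0#)) fρ)
        where
        origin : ∀ z → ρ ≈ ρ - (a * (0# * 0#) + b * (0# * z))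
        origin z = (ringIdentity 4 (λ a b c d → a := a :- (b :* (:0 :* :0) :+ c :* (:0 :* d))) (_ ∷ _ ∷ _ ∷ _ ∷ []))

      member = 𝓤-scaled a b p π _ πp̄≈1 p≉0 ap̄≈pα

      w≉0 : ∀ k → k ≉ 0# → (ek : Fixed k) → 1# + k * n ≉ 0#
      w≉0 k k≉0 ek = from-difference {1# + k * n} {1# + k * n̄} {k * δ}
        (bar-1 ⟨+⟩ ek ⟨*⟩ refl) (difference n̄) (*-≉0 {k} {δ} k≉0 δ≉0)
        where
        difference : ∀ n̄ → 1# + k * n - (1# + k * n̄) ≈ k * (n - n̄)
        difference n̄ = (ringIdentity 3 (λ a b c → :1 :+ a :* b :- (:1 :+ a :* c) := a :* (b :- c)) (_ ∷ _ ∷ _ ∷ []))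

    contains : ContainsBMSpecialTripleO'Nan (𝓤 a b)
    contains = Q.configuration (𝓤 a b) vertices diagonals
      where
      module Q = Quadrangle (m * π) e p n κ e≉0 p≉0 n≉0 1-κ≉0 1+κ≉0
      vertices : ∀ i → 𝓤 a b (Q.vertex i)
      vertices 0F = fixed-affine _ (fixed-neg (fixed-* {1# + κ} {e} (fixed-+ bar-1 eκ) e-fixed))
      vertices 1F = fixed-affine _ (fixed-* {1# - κ} {e} (fixed-- bar-1 eκ) e-fixed)
      vertices 2F = member (dualPoint (m * π) (p * (1# + n))) m (1# + n) (1# + n̄)
        (γ * n̄ * (n - n̄) * (1# - n) * (1# - κ * κ * (n * n))) refl refl refl
        (bar-1 ⟨+⟩ refl)
        (λ eq → w≉0 1# 1≉0 bar-1 (trans (+-congˡ (*-identityˡ n)) eq))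
        (split n̄)
        (fixed-vertex refl en̄ (eκ ⟨*⟩ eκ) eγ θ-fixed refl b-b̄≈θδ)
        where
        split : ∀ n̄ → (1# + n) * (γ * n̄ * (n - n̄) * (1# - n) * (1# - κ * κ * (n * n)))
          ≈ γ * n̄ * (n - n̄) * (1# - n * n) * (1# - κ * κ * (n * n))
        split n̄ = (ringIdentity 4 (λ a b c d → (:1 :+ a) :* (b :* c :* (a :- c) :* (:1 :- a) :* (:1 :- d :* d :* (a
              :* a))) := b :* c :* (a :- c) :* (:1 :- a :* a) :* (:1 :- d :* d :* (a :* a))) (_ ∷ _ ∷ _ ∷ _ ∷ []))
      -- Negating `n` and `θ` changes neither `θ (n - n̄)` nor `α`, in which `n̄ (n - n̄)` is even.
      vertices 3F = member (dualPoint (m * π) (p * (1# - n))) (slope (- n) (- n̄) (κ * κ) γ (- θ)) (1# + - n) (1# + - n̄)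
        (γ * - n̄ * (- n - - n̄) * (1# - - n) * (1# - κ * κ * (- n * - n))) refl
        (slope-even n n̄ (κ * κ) γ θ π) refl
        (bar-1 ⟨+⟩ ⟨neg⟩ refl)
        (λ eq → w≉0 (- 1#) (-‿≉0 1≉0) (fixed-neg bar-1) (trans (+-congˡ -1*) eq))
        (split n̄)
        (fixed-vertex (⟨neg⟩ refl) (⟨neg⟩ en̄) (eκ ⟨*⟩ eκ) eγ (⟨neg⟩ θ-fixed) refl
          (trans b-b̄≈θδ (flip θ n̄)))
        where
        -1* : - 1# * n ≈ - n
        -1* = (ringIdentity 1 (λ a → (:- :1) :* a := :- a) (_ ∷ []))
        flip : ∀ θ n̄ → θ * (n - n̄) ≈ - θ * (- n - - n̄)
        flip θ n̄ = (ringIdentity 3 (λ a b c → a :* (b :- c) := (:- a) :* (:- b :- (:- c))) (_ ∷ _ ∷ _ ∷ []))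
        split : ∀ n̄ → (1# + - n) * (γ * - n̄ * (- n - - n̄) * (1# - - n) * (1# - κ * κ * (- n * - n)))
          ≈ γ * n̄ * (n - n̄) * (1# - n * n) * (1# - κ * κ * (n * n))
        split n̄ = (ringIdentity 4 (λ a b c d → (:1 :- a) :* (b :* (:- c) :* (:- a :- (:- c)) :* (:1 :- (:- a)) :* (:1
              :- d :* d :* ((:- a) :* (:- a)))) := b :* c :* (a :- c) :* (:1 :- a :* a) :* (:1
              :- d :* d :* (a :* a))) (_ ∷ _ ∷ _ ∷ _ ∷ []))

      diagonals : ∀ i → 𝓤 a b (Q.diagonal i)
      diagonals 0F = fixed-affine 0# bar-0
      diagonals 1F = member (dualPoint _ _)
        (m + (1# - κ * κ) * (κ * γ * (n * n̄) * ((n - n̄) * (n - n̄)) * n)) (1# + κ * n) (1# + κ * n̄)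
        (γ * n̄ * (n - n̄) * (1# - n * n) * (1# - κ * n)) refl (scale m n̄ ν) refl
        (bar-1 ⟨+⟩ eκ ⟨*⟩ refl) (w≉0 κ κ≉0 eκ) (split n̄)
        (fixed-diagonal refl en̄ eκ eγ θ-fixed refl b-b̄≈θδ)
        where
        scale : ∀ m n̄ ν → m * (ν * p) + (1# - κ * κ) * (κ * γ * (n * n̄) * ((n - n̄) * (n - n̄)) * ν * (p * n))
          ≈ (m + (1# - κ * κ) * (κ * γ * (n * n̄) * ((n - n̄) * (n - n̄)) * n)) * (ν * p)
        scale m n̄ ν = (ringIdentity 7 (λ a b c d e f g → a :* (b :* c) :+ (:1 :- d :* d) :* (d :* e :* (f :* g) :* ((f
              :- g) :* (f :- g)) :* b :* (c :* f)) := (a :+ (:1 :- d :* d) :* (d :* e :* (f :* g)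
              :* ((f :- g) :* (f :- g)) :* f)) :* (b :* c)) (_ ∷ _ ∷ _ ∷ _ ∷ _ ∷ _ ∷ _ ∷ []))
        split : ∀ n̄ → (1# + κ * n) * (γ * n̄ * (n - n̄) * (1# - n * n) * (1# - κ * n))
          ≈ γ * n̄ * (n - n̄) * (1# - n * n) * (1# - κ * κ * (n * n))
        split n̄ = (ringIdentity 4 (λ a b c d → (:1 :+ a :* b) :* (c :* d :* (b :- d) :* (:1 :- b :* b) :* (:1 :- a
              :* b)) := c :* d :* (b :- d) :* (:1 :- b :* b) :* (:1 :- a :* a :* (b :* b))) (_ ∷ _ ∷ _ ∷ _ ∷ []))
      -- The other diagonal point with `κ` negated; the slope and `α` contain only `κ²`.
      diagonals 2F = member (dualPoint _ _)
        (slope n n̄ (- κ * - κ) γ θ + (1# - - κ * - κ) * (- κ * γ * (n * n̄) * ((n - n̄) * (n - n̄)) * n))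
        (1# + - κ * n) (1# + - κ * n̄)
        (γ * n̄ * (n - n̄) * (1# - n * n) * (1# - - κ * n)) refl (scale n̄ ν θ) w-eq
        (bar-1 ⟨+⟩ ⟨neg⟩ eκ ⟨*⟩ refl) (w≉0 (- κ) (-‿≉0 κ≉0) (⟨neg⟩ eκ)) (split n̄)
        (fixed-diagonal refl en̄ (⟨neg⟩ eκ) eγ θ-fixed refl b-b̄≈θδ)
        where
        w-eq : p * (1# - κ * n) ≈ p * (1# + - κ * n)
        w-eq = (ringIdentity 3 (λ a b c → a :* (:1 :- b :* c) := a :* (:1 :+ (:- b) :* c)) (_ ∷ _ ∷ _ ∷ []))
        scale : ∀ n̄ ν θ → slope n n̄ (κ * κ) γ θ * (ν * p)
            - (1# - κ * κ) * (κ * γ * (n * n̄) * ((n - n̄) * (n - n̄)) * ν * (p * n))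
          ≈ (slope n n̄ (- κ * - κ) γ θ + (1# - - κ * - κ) * (- κ * γ * (n * n̄) * ((n - n̄) * (n - n̄)) * n)) * (ν * p)
        scale n̄ ν θ = (ringIdentity 7 (λ a b c d e f g → (a :* b :* (a :+ c) :* (:1 :- a :* c) :* (:1 :- d :* d :* (a
              :* c)) :+ a :* e :- b :* ((a :- c) :* (a :- c)) :* (:1 :+ d :* d :* (a :* c))) :* (f
              :* g) :- (:1 :- d :* d) :* (d :* b :* (a :* c) :* ((a :- c) :* (a :- c)) :* f :* (g
              :* a)) := (a :* b :* (a :+ c) :* (:1 :- a :* c) :* (:1 :- (:- d) :* (:- d) :* (a
              :* c)) :+ a :* e :- b :* ((a :- c) :* (a :- c)) :* (:1 :+ (:- d) :* (:- d) :* (a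
              :* c)) :+ (:1 :- (:- d) :* (:- d)) :* ((:- d) :* b :* (a :* c) :* ((a :- c) :* (a
              :- c)) :* a)) :* (f :* g)) (_ ∷ _ ∷ _ ∷ _ ∷ _ ∷ _ ∷ _ ∷ []))
        split : ∀ n̄ → (1# + - κ * n) * (γ * n̄ * (n - n̄) * (1# - n * n) * (1# - - κ * n))
          ≈ γ * n̄ * (n - n̄) * (1# - n * n) * (1# - κ * κ * (n * n))
        split n̄ = (ringIdentity 4 (λ a b c d → (:1 :+ (:- a) :* b) :* (c :* d :* (b :- d) :* (:1 :- b :* b) :* (:1
              :- (:- a) :* b)) := c :* d :* (b :- d) :* (:1 :- b :* b) :* (:1 :- a :* a :* (b :* b))) (_ ∷ _ ∷ _ ∷ _ ∷ []))

  -- Solutions for square and for nonsquare norm of a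

  -- For nonzero `a` this amounts to `a` being a square in the field of the plane, because `N(a) ^
  -- ((q - 1) / 2) = a ^ ((q² - 1) / 2)`.
  SquareNorm : Carrier → Set _
  SquareNorm a = ∃[ s ] Fixed s × s * s ≈ norm a

  imaginary-nonfixed : ∀ {x} → bar x ≈ - x → x ≉ 0# → x - bar x ≉ 0#
  imaginary-nonfixed {x} x̄≈-x x≉0 x-x̄≈0 = x≉0 (*-cancel-0 {1# + 1#} {x} 2≉0
    (combine₂ {(1# + 1#) * x} {0#} 1# 1# x-x̄≈0 x̄≈-x (ringIdentity 2 (λ a b → (:1 :+ :1) :* a :- :0 := :1 :* (a :- b :- :0) :+ :1 :* (b :- (:- a))) (_ ∷ _ ∷ []))))

  1+kn≉0 : ∀ {n k} → n - bar n ≉ 0# → Fixed k → k ≉ 0# → 1# + k * n ≉ 0#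
  1+kn≉0 {n} {k} δ≉0 ek k≉0 = from-difference {1# + k * n} {1# + k * bar n} {k * (n - bar n)}
    (bar-1 ⟨+⟩ ek ⟨*⟩ refl) (difference (bar n)) (*-≉0 {k} {n - bar n} k≉0 δ≉0)
    where
    difference : ∀ n̄ → 1# + k * n - (1# + k * n̄) ≈ k * (n - n̄)
    difference n̄ = (ringIdentity 3 (λ a b c → :1 :+ a :* b :- (:1 :+ a :* c) := a :* (b :- c)) (_ ∷ _ ∷ _ ∷ []))

  1-kknn≉0 : ∀ {n k} → n - bar n ≉ 0# → Fixed k → k ≉ 0# → 1# - k * k * (n * n) ≉ 0#
  1-kknn≉0 {n} {k} δ≉0 ek k≉0 eq = *-≉0 {1# + k * n} {1# + - k * n} (1+kn≉0 δ≉0 ek k≉0)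
    (1+kn≉0 δ≉0 (fixed-neg ek) (-‿≉0 k≉0)) (combine₁ {(1# + k * n) * (1# + - k * n)} {0#} 1# eq (ringIdentity 2 (λ a b → (:1 :+ a :* b) :* (:1 :+ (:- a) :* b) :- :0 := :1 :* (:1 :- a :* a :* (b
          :* b) :- :0)) (_ ∷ _ ∷ [])))

  1-nn≉0 : ∀ {n} → n - bar n ≉ 0# → 1# - n * n ≉ 0#
  1-nn≉0 {n} δ≉0 eq = 1-kknn≉0 {n} {1#} δ≉0 bar-1 1≉0 (combine₁ {1# - 1# * 1# * (n * n)} {0#} 1# eq (ringIdentity 1 (λ a → :1 :- :1 :* :1 :* (a :* a) :- :0 := :1 :* (:1 :- a :* a :- :0)) (_ ∷ [])))

  -- If `a + s` and `a - s` were both zero, then `2 s` would be. The predicate keeps track of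
  -- whether the root is fixed or negated by conjugation.
  choose-sign : ∀ a {s} → s ≉ 0# → (P : Carrier → Set ℓ₁) → P s → P (- s) → ∃[ t ] P t × t ≉ 0# × t * t ≈ s * s × a + t ≉ 0#
  choose-sign a {s} s≉0 P Ps P-s with a + s ≟ 0#
  ... | no a+s≉0  = s , Ps , s≉0 , refl , a+s≉0
  ... | yes a+s≈0 = - s , P-s , -‿≉0 s≉0 , (ringIdentity 1 (λ a → (:- a) :* (:- a) := a :* a) (_ ∷ [])) , λ a-s≈0 → s≉0 (*-cancel-0 {1# + 1#} {s} 2≉0
    (combine₂ {(1# + 1#) * s} {0#} 1# (- 1#) a+s≈0 a-s≈0 (ringIdentity 2 (λ a b → (:1 :+ :1) :* a :- :0 := :1 :* (b :+ a :- :0) :+ (:- :1) :* (b :- a :-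
          :0)) (_ ∷ _ ∷ []))))

  square≉0 : ∀ {s t} → s * s ≈ t → t ≉ 0# → s ≉ 0#
  square≉0 {s} {t} ss≈t t≉0 s≈0 = t≉0 (combine₂ {t} {0#} (- 1#) s ss≈t s≈0 (ringIdentity 2 (λ a b → a :- :0 := (:- :1) :* (b :* b :- a) :+ b :* (b :- :0)) (_ ∷ _ ∷ [])))

  s³≉s⇒ : ∀ {s} → s ^ 3 ≉ s → s ≉ 0# × 1# - s ≉ 0# × 1# + s ≉ 0#
  s³≉s⇒ {s} s³≉s = (λ eq → s³≉s (combine₁ {s ^ 3} {s} (s * s - 1#) eq (ringIdentity 1 (λ a → a :* (a :* (a :* :1)) :- a := (a :* a :- :1) :* (a :- :0)) (_ ∷ [])))) ,
    (λ eq → s³≉s (combine₁ {s ^ 3} {s} (- (s * (1# + s))) eq (ringIdentity 1 (λ a → a :* (a :* (a :* :1)) :- a := (:- (a :* (:1 :+ a))) :* (:1 :- a :- :0)) (_ ∷ [])))) ,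
    (λ eq → s³≉s (combine₁ {s ^ 3} {s} (s * (s - 1#)) eq (ringIdentity 1 (λ a → a :* (a :* (a :* :1)) :- a := a :* (a :- :1) :* (:1 :+ a :- :0)) (_ ∷ []))))

  -- From `s⁵ - s = s (s² - 1) (s² + 1)`; these are the requirements on `κ = s²`.
  s⁵≉s⇒ : ∀ {s} → s ^ 5 ≉ s → s ≉ 0# × 1# - s * s ≉ 0# × 1# + s * s ≉ 0#
  s⁵≉s⇒ {s} s⁵≉s = (λ eq → s⁵≉s (combine₁ {s ^ 5} {s} (s * s * s * s - 1#) eq (ringIdentity 1 (λ a → a :* (a :* (a :* (a :* (a :* :1)))) :- a := (a :* a :* a :* a :- :1) :* (a
        :- :0)) (_ ∷ [])))) ,
    (λ eq → s⁵≉s (combine₁ {s ^ 5} {s} (- (s * (1# + s * s))) eq (ringIdentity 1 (λ a → a :* (a :* (a :* (a :* (a :* :1)))) :- a := (:- (a :* (:1 :+ a :* a))) :* (:1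
          :- a :* a :- :0)) (_ ∷ [])))) ,
    (λ eq → s⁵≉s (combine₁ {s ^ 5} {s} (s * (s * s - 1#)) eq (ringIdentity 1 (λ a → a :* (a :* (a :* (a :* (a :* :1)))) :- a := a :* (a :* a :- :1) :* (:1 :+ a
          :* a :- :0)) (_ ∷ []))))

  -- With `t² = N(a)` and `p = a + t` one has `a p̄ = N(a) + a t = t p`. For `n̄ = - n` the product
  -- `D` in the condition is even in `n`, hence fixed, and `γ = t / D` solves it. The bound on `q`
  -- provides `κ` with `κ³ ≠ κ`.
  contains-square : ∀ a b → a ≉ 0# → SquareNorm a → 5 ≤ q → ContainsBMSpecialTripleO'Nan (𝓤 a b)
  contains-square a b a≉0 (s , fs , ss≈N) 5≤q =
    let n , en , n≉0 = imaginary
        κ , fκ , κ³≉κ = fixed-element 1 5≤q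
        κ≉0 , 1-κ≉0 , 1+κ≉0 = s³≉s⇒ κ³≉κ
        t , ft , t≉0 , tt≈ss , p≉0 = choose-sign a (square≉0 ss≈N (norm≉0 a≉0)) Fixed fs (fixed-neg fs)
    in go n en n≉0 κ fκ κ≉0 1-κ≉0 1+κ≉0 t ft t≉0 (trans tt≈ss ss≈N) p≉0
    where
    go : ∀ n → bar n ≈ - n → n ≉ 0# → ∀ κ → Fixed κ → κ ≉ 0# → 1# - κ ≉ 0# → 1# + κ ≉ 0# →
      ∀ t → Fixed t → t ≉ 0# → t * t ≈ norm a → a + t ≉ 0# → ContainsBMSpecialTripleO'Nan (𝓤 a b)
    go n en n≉0 κ fκ κ≉0 1-κ≉0 1+κ≉0 t ft t≉0 tt≈N p≉0 =
      contains a b n κ (t * D ⁻¹) (a + t) fκ (fixed-* ft (fixed-⁻¹ D≉0 D-fixed)) κ≉0 1-κ≉0 1+κ≉0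
        (*-≉0 {t} {D ⁻¹} t≉0 (⁻¹≉0 D≉0)) p≉0 δ≉0
        (equation (bar a) (bar (a + t)) (bar n) (n - bar n) (D ⁻¹) (refl ⟨+⟩ ft) tt≈N (⁻¹-inverse D≉0))
      where
      D = bar n * (n - bar n) * (1# - n * n) * (1# - κ * κ * (n * n))
      δ≉0 : n - bar n ≉ 0#
      δ≉0 = imaginary-nonfixed en n≉0
      D≉0 : D ≉ 0#
      D≉0 = *-≉0 {bar n * (n - bar n) * (1# - n * n)} {1# - κ * κ * (n * n)} (*-≉0 {bar n * (n - bar n)} {1# - n * n}
        (*-≉0 {bar n} {n - bar n} (bar≉0 n≉0) δ≉0) (1-nn≉0 δ≉0)) (1-kknn≉0 δ≉0 fκ κ≉0)
      even : ∀ n̄ → n̄ ≈ - n → n * (n̄ - n) * (1# - n̄ * n̄) * (1# - κ * κ * (n̄ * n̄)) ≈ n̄ * (n - n̄) * (1# - n * n) * (1# - κ * κ * (n * n))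
      even n̄ eq = combine₁ {n * (n̄ - n) * (1# - n̄ * n̄) * (1# - κ * κ * (n̄ * n̄))} {n̄ * (n - n̄) * (1# - n * n) * (1# - κ * κ * (n * n))}
        ((n̄ - n) * (1# - (1# + κ * κ) * (n * n̄) + κ * κ * (n * n̄) * (n * n - n * n̄ + n̄ * n̄))) eq (ringIdentity 3 (λ a b c → a :* (b :- a) :* (:1 :- b :* b) :* (:1 :- c :* c :* (b :* b)) :- b :* (a
              :- b) :* (:1 :- a :* a) :* (:1 :- c :* c :* (a :* a)) := (b :- a) :* (:1 :- (:1 :+ c
              :* c) :* (a :* b) :+ c :* c :* (a :* b) :* (a :* a :- a :* b :+ b :* b)) :* (b :- (:- a))) (_ ∷ _ ∷ _ ∷ []))
      D-fixed : Fixed D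
      D-fixed = trans (bar-involutive n ⟨*⟩ (refl ⟨-⟩ bar-involutive n) ⟨*⟩ (bar-1 ⟨-⟩ refl ⟨*⟩ refl)
        ⟨*⟩ (bar-1 ⟨-⟩ fκ ⟨*⟩ fκ ⟨*⟩ (refl ⟨*⟩ refl))) (even (bar n) en)
      equation : ∀ ā p̄ n̄ δ d → p̄ ≈ ā + t → t * t ≈ a * ā → d * (n̄ * δ * (1# - n * n) * (1# - κ * κ * (n * n))) ≈ 1# →
        a * p̄ ≈ (a + t) * (t * d * n̄ * δ * (1# - n * n) * (1# - κ * κ * (n * n)))
      equation ā p̄ n̄ δ d e e′ e″ = combine₃ {a * p̄} {(a + t) * (t * d * n̄ * δ * (1# - n * n) * (1# - κ * κ * (n * n)))}
        a (- 1#) (- ((a + t) * t)) e e′ e″ (ringIdentity 9 (λ a b c d e f g h i → a :* b :- (a :+ c) :* (c :* d :* e :* f :* (:1 :- g :* g)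
              :* (:1 :- h :* h :* (g :* g))) := a :* (b :- (i :+ c)) :+ (:- :1) :* (c :* c :- a
              :* i) :+ (:- ((a :+ c) :* c)) :* (d :* (e :* f :* (:1 :- g :* g) :* (:1 :- h :* h
              :* (g :* g))) :- :1)) (_ ∷ _ ∷ _ ∷ _ ∷ _ ∷ _ ∷ _ ∷ _ ∷ _ ∷ []))

  -- For `n = ν / s` and `κ = s²` the product in the condition equals `- ε ν (ν - ν̄) Q / s⁴`, where
  -- `Q` is the norm of `s² - ν²`. As `β` and `ν - ν̄` are both negated by conjugation, their
  -- quotient is fixed, so `β ν` is an 𝔽q-multiple of the product; `γ` is the resulting factor.
  contains-unit : ∀ a b ν ε β p → ν * bar ν ≈ ε → Fixed ε → ε * ε ≈ 1# → ν - bar ν ≉ 0# →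
    bar β ≈ - β → β ≉ 0# → p ≉ 0# → a * bar p ≈ p * (β * ν) → 7 ≤ q → ContainsBMSpecialTripleO'Nan (𝓤 a b)
  contains-unit a b ν ε β p N≈ε fε εε≈1 δ≉0 eβ β≉0 p≉0 ap̄≈pβν 7≤q =
    let s , fs , s⁵≉s = fixed-element 3 7≤q
        s≉0 , 1-s²≉0 , 1+s²≉0 = s⁵≉s⇒ s⁵≉s
    in go s fs s≉0 1-s²≉0 1+s²≉0
    where
    go : ∀ s → Fixed s → s ≉ 0# → 1# - s * s ≉ 0# → 1# + s * s ≉ 0# → ContainsBMSpecialTripleO'Nan (𝓤 a b)
    go s fs s≉0 1-s²≉0 1+s²≉0 = contains a b (ν * j) (s * s) γ p (fixed-* fs fs) γ-fixed
      (*-≉0 {s} {s} s≉0 s≉0) 1-s²≉0 1+s²≉0 γ≉0 p≉0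
      (λ eq → *-≉0 {δ} {j} δ≉0 j≉0 (trans (sym δj≈) eq))
      (trans ap̄≈pβν (*-congˡ (trans (equation (bar ν) (Q ⁻¹) (δ ⁻¹) N≈ε
        (trans (*-congˡ (*-congˡ (sym bar-w))) (⁻¹-inverse Q≉0)) (⁻¹-inverse δ≉0))
        (replace γ (bar (ν * j)) (bar ν * j) (ν * j) (1# - ν * j * (ν * j)) (1# - s * s * (s * s) * (ν * j * (ν * j))) bar-νj))))
      where
      j = s ⁻¹
      δ = ν - bar ν
      w = s * s - ν * ν
      Q = w * bar w
      γ = - (ε * (β * δ ⁻¹) * (s * s * (s * s))) * Q ⁻¹
      j≉0 : j ≉ 0#
      j≉0 = ⁻¹≉0 s≉0
      fj : Fixed j
      fj = fixed-⁻¹ s≉0 fs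
      replace : ∀ g n̄ m n x y → n̄ ≈ m → g * m * (n - m) * x * y ≈ g * n̄ * (n - n̄) * x * y
      replace g n̄ m n x y eq = combine₁ {g * m * (n - m) * x * y} {g * n̄ * (n - n̄) * x * y} (g * x * y * (n̄ + m - n)) eq (ringIdentity 6 (λ a b c d e f → a :* b :* (c :- b) :* d :* e :- a :* f :* (c :- f) :* d :* e := a
            :* d :* e :* (f :+ b :- c) :* (f :- b)) (_ ∷ _ ∷ _ ∷ _ ∷ _ ∷ _ ∷ []))
      bar-νj : bar (ν * j) ≈ bar ν * j
      bar-νj = refl ⟨*⟩ fj
      δj≈ : ν * j - bar (ν * j) ≈ δ * j
      δj≈ = trans (+-congˡ (-‿cong bar-νj)) (collect (bar ν))
        where
        collect : ∀ ν̄ → ν * j - ν̄ * j ≈ (ν - ν̄) * j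
        collect ν̄ = (ringIdentity 3 (λ a b c → a :* b :- c :* b := (a :- c) :* b) (_ ∷ _ ∷ _ ∷ []))
      w≉0 : w ≉ 0#
      w≉0 eq = *-≉0 {s - ν} {s + ν}
        (from-difference {s - ν} {s - bar ν} (fs ⟨-⟩ refl) (minus (bar ν)) (-‿≉0 δ≉0))
        (from-difference {s + ν} {s + bar ν} (fs ⟨+⟩ refl) (plus (bar ν)) δ≉0)
        (combine₁ {(s - ν) * (s + ν)} {0#} 1# eq (ringIdentity 2 (λ a b → (a :- b) :* (a :+ b) :- :0 := :1 :* (a :* a :- b :* b :- :0)) (_ ∷ _ ∷ [])))
        where
        minus : ∀ ν̄ → s - ν - (s - ν̄) ≈ - (ν - ν̄)
        minus ν̄ = (ringIdentity 3 (λ a b c → a :- b :- (a :- c) := :- (b :- c)) (_ ∷ _ ∷ _ ∷ []))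
        plus : ∀ ν̄ → s + ν - (s + ν̄) ≈ ν - ν̄
        plus ν̄ = (ringIdentity 3 (λ a b c → a :+ b :- (a :+ c) := b :- c) (_ ∷ _ ∷ _ ∷ []))
      Q≉0 : Q ≉ 0#
      Q≉0 = norm≉0 w≉0
      θ-fixed : Fixed (β * δ ⁻¹)
      θ-fixed = fixed-quotient {δ} {β * δ ⁻¹} {β} (bar[x-bar] ν) eβ δ≉0
        (combine₁ {β} {β * δ ⁻¹ * δ} (- β) (⁻¹-inverse δ≉0) (ringIdentity 4 (λ a b c d → a :- a :* b :* (c :- d) := (:- a) :* (b :* (c :- d) :- :1)) (_ ∷ _ ∷ _ ∷ _ ∷ [])))
      γ-fixed : Fixed γ
      γ-fixed = fixed-* (fixed-neg (fixed-* (fixed-* fε θ-fixed) (fixed-* (fixed-* fs fs) (fixed-* fs fs))))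
        (fixed-⁻¹ Q≉0 (fixed-norm w))
      ε≉0 : ε ≉ 0#
      ε≉0 = square≉0 εε≈1 1≉0
      γ≉0 : γ ≉ 0#
      γ≉0 = *-≉0 { - (ε * (β * δ ⁻¹) * (s * s * (s * s)))} {Q ⁻¹} (-‿≉0 (*-≉0 {ε * (β * δ ⁻¹)} {s * s * (s * s)}
        (*-≉0 {ε} {β * δ ⁻¹} ε≉0 (*-≉0 {β} {δ ⁻¹} β≉0 (⁻¹≉0 δ≉0)))
        (*-≉0 {s * s} {s * s} (*-≉0 {s} {s} s≉0 s≉0) (*-≉0 {s} {s} s≉0 s≉0)))) (⁻¹≉0 Q≉0)
      js≈1 : j * s ≈ 1#
      js≈1 = ⁻¹-inverse s≉0
      bar-w : bar w ≈ s * s - bar ν * bar ν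
      bar-w = fs ⟨*⟩ fs ⟨-⟩ refl ⟨*⟩ refl
      equation : ∀ ν̄ i d → ν * ν̄ ≈ ε → i * ((s * s - ν * ν) * (s * s - ν̄ * ν̄)) ≈ 1# → d * (ν - ν̄) ≈ 1# →
        β * ν ≈ - (ε * (β * d) * (s * s * (s * s))) * i * (ν̄ * j) * (ν * j - ν̄ * j) * (1# - ν * j * (ν * j))
          * (1# - s * s * (s * s) * (ν * j * (ν * j)))
      equation ν̄ i d νν̄≈ε iQ≈1 dδ≈1 = sym (begin
        - (ε * (β * d) * (s * s * (s * s))) * i * (ν̄ * j) * (ν * j - ν̄ * j) * (1# - ν * j * (ν * j))
          * (1# - s * s * (s * s) * (ν * j * (ν * j)))
          ≈⟨ regroup ⟩
        - (ε * (β * d) * i) * (s * s * (ν̄ * j * (ν * j - ν̄ * j))) * (s * s * (1# - ν * j * (ν * j)))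
          * (1# - s * s * (s * s) * (ν * j * (ν * j)))
          ≈⟨ *-cong (*-cong (*-congˡ first) second) third ⟩
        - (ε * (β * d) * i) * (ν̄ * (ν - ν̄)) * (s * s - ν * ν) * (- (ν * ν) * (s * s - ν̄ * ν̄))
          ≈⟨ combine₂ (ε * β * ν * (d * (ν - ν̄)) * (i * ((s * s - ν * ν) * (s * s - ν̄ * ν̄))))
               (ε * ε * β * ν * (d * (ν - ν̄))) νν̄≈ε iQ≈1 (ringIdentity 7 (λ a b c d e f g → (:- (a :* (b :* c) :* d)) :* (e :* (f :- e)) :* (g :* g :- f
                     :* f) :* ((:- (f :* f)) :* (g :* g :- e :* e)) :- a :* a :* b :* f :* (c :* (f
                     :- e)) := a :* b :* f :* (c :* (f :- e)) :* (d :* ((g :* g :- f :* f) :* (g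
                     :* g :- e :* e))) :* (f :* e :- a) :+ a :* a :* b :* f :* (c :* (f :- e))
                     :* (d :* ((g :* g :- f :* f) :* (g :* g :- e :* e)) :- :1)) (_ ∷ _ ∷ _ ∷ _ ∷ _ ∷ _ ∷ _ ∷ [])) ⟩
        ε * ε * β * ν * (d * (ν - ν̄))
          ≈⟨ combine₂ (ε * ε * β * ν) (β * ν) dδ≈1 εε≈1 (ringIdentity 5 (λ a b c d e → a :* a :* b :* c :* (d :* (c :- e)) :- b :* c := a :* a :* b :* c
                :* (d :* (c :- e) :- :1) :+ b :* c :* (a :* a :- :1)) (_ ∷ _ ∷ _ ∷ _ ∷ _ ∷ [])) ⟩
        β * ν ∎)
        where
        regroup : - (ε * (β * d) * (s * s * (s * s))) * i * (ν̄ * j) * (ν * j - ν̄ * j) * (1# - ν * j * (ν * j))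
          * (1# - s * s * (s * s) * (ν * j * (ν * j)))
          ≈ - (ε * (β * d) * i) * (s * s * (ν̄ * j * (ν * j - ν̄ * j))) * (s * s * (1# - ν * j * (ν * j)))
          * (1# - s * s * (s * s) * (ν * j * (ν * j)))
        regroup = *-congʳ (assoc (ε * (β * d)) (s * s) i (ν̄ * j) (ν * j - ν̄ * j) (1# - ν * j * (ν * j)))
          where
          assoc : ∀ a b i c d e → - (a * (b * b)) * i * c * d * e ≈ - (a * i) * (b * (c * d)) * (b * e)
          assoc a b i c d e = (ringIdentity 6 (λ a b c d e f → (:- (a :* (b :* b))) :* c :* d :* e :* f := (:- (a :* c)) :* (b
                :* (d :* e)) :* (b :* f)) (_ ∷ _ ∷ _ ∷ _ ∷ _ ∷ _ ∷ []))
        first : s * s * (ν̄ * j * (ν * j - ν̄ * j)) ≈ ν̄ * (ν - ν̄)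
        first = combine₁ {s * s * (ν̄ * j * (ν * j - ν̄ * j))} {ν̄ * (ν - ν̄)} (ν̄ * (ν - ν̄) * (j * s + 1#)) js≈1 (ringIdentity 4 (λ a b c d → a :* a :* (b :* c :* (d :* c :- b :* c)) :- b :* (d :- b) := b :* (d
              :- b) :* (c :* a :+ :1) :* (c :* a :- :1)) (_ ∷ _ ∷ _ ∷ _ ∷ []))
        second : s * s * (1# - ν * j * (ν * j)) ≈ s * s - ν * ν
        second = combine₁ {s * s * (1# - ν * j * (ν * j))} {s * s - ν * ν} (- (ν * ν * (j * s + 1#))) js≈1 (ringIdentity 3 (λ a b c → a :* a :* (:1 :- b :* c :* (b :* c)) :- (a :* a :- b :* b) := (:- (b
              :* b :* (c :* a :+ :1))) :* (c :* a :- :1)) (_ ∷ _ ∷ _ ∷ []))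
        -- Here the norm of `ν` enters: `ν² ν̄² = ε² = 1` turns `1 - s² ν²` into a multiple of the
        -- conjugate of `s² - ν²`.
        third : 1# - s * s * (s * s) * (ν * j * (ν * j)) ≈ - (ν * ν) * (s * s - ν̄ * ν̄)
        third = combine₃ {1# - s * s * (s * s) * (ν * j * (ν * j))} { - (ν * ν) * (s * s - ν̄ * ν̄)}
          (- (s * s * (ν * ν) * (j * s + 1#))) (- (ν * ν̄ + ε)) (- 1#) js≈1 νν̄≈ε εε≈1 (ringIdentity 5 (λ a b c d e → :1 :- a :* a :* (a :* a) :* (b :* c :* (b :* c)) :- (:- (b :* b))
                :* (a :* a :- d :* d) := (:- (a :* a :* (b :* b) :* (c :* a :+ :1))) :* (c :* a
                :- :1) :+ (:- (b :* d :+ e)) :* (b :* d :- e) :+ (:- :1) :* (e :* e :- :1)) (_ ∷ _ ∷ _ ∷ _ ∷ _ ∷ []))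

  -- Both -1 and `N(a)` have square roots in the field of the plane, whence `ι² = - N(a)`. As this
  -- is in 𝔽q, conjugation fixes or negates `ι`; the first case uses `ν` of norm -1, the second `ν`
  -- of norm 1.
  contains-nonsquare : ∀ a b → a ≉ 0# → ¬ SquareNorm a → 7 ≤ q → ContainsBMSpecialTripleO'Nan (𝓤 a b)
  contains-nonsquare a b a≉0 nonsquare 7≤q =
    let i , ii≈-1 = √-1
        g , gg≈N = √norm a
        ι = i * g
        ιι≈-N = combine₂ {ι * ι} { - norm a} (g * g) (- 1#) ii≈-1 gg≈N (ringIdentity 4 (λ a b c d → a :* b :* (a :* b) :- (:- (c :* d)) := b :* b :* (a :* a :- (:-
              :1)) :+ (:- :1) :* (b :* b :- c :* d)) (_ ∷ _ ∷ _ ∷ _ ∷ []))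
    in [ (λ fι → fixed-case i ii≈-1 ι ιι≈-N fι) , imaginary-case ι ιι≈-N ]′
         (√fixed {ι} (fixed-cong (sym ιι≈-N) (fixed-neg (fixed-norm a))))
    where
    -- A fixed square root of -1 times `ι` would be a fixed square root of `N(a)`, so conjugation
    -- negates `i`. Hence `p = 1 + i` has `p̄ / p = - i`, and `a p̄ / p = (- i ι) (a / ι)` with
    -- `a / ι` of norm -1. That quotient is not fixed, or it would itself be a square root of -1.
    fixed-case : ∀ i → i * i ≈ - 1# → ∀ ι → ι * ι ≈ - norm a → Fixed ι → ContainsBMSpecialTripleO'Nan (𝓤 a b)
    fixed-case i ii≈-1 ι ιι≈-N fι = contains-unit a b ν (- 1#) (- (i * ι)) (1# + i)
      νν̄≈-1 (fixed-neg bar-1) (ringIdentity 0 ((:- :1) :* (:- :1) := :1) ([])) δ≉0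
      (trans (⟨neg⟩ (ei ⟨*⟩ fι)) (ringIdentity 2 (λ a b → :- ((:- a) :* b) := :- (:- (a :* b))) (_ ∷ _ ∷ [])))
      (-‿≉0 (*-≉0 {i} {ι} i≉0 ι≉0))
      (from-difference {1# + i} {1# - i} (bar-1 ⟨+⟩ ei) (ringIdentity 1 (λ a → :1 :+ a :- (:1 :- a) := (:1 :+ :1) :* a) (_ ∷ [])) (*-≉0 {1# + 1#} {i} 2≉0 i≉0))
      (equation (bar (1# + i)) (bar-1 ⟨+⟩ ei)) 7≤q
      where
      ι≉0 : ι ≉ 0#
      ι≉0 = square≉0 ιι≈-N (-‿≉0 (norm≉0 a≉0))
      j = ι ⁻¹
      ν = a * j
      i≉0 : i ≉ 0#
      i≉0 = square≉0 ii≈-1 (-‿≉0 1≉0)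
      norm-ν : ∀ ā → ι * ι ≈ - (a * ā) → a * j * (ā * j) ≈ - 1#
      norm-ν ā eq = combine₂ {a * j * (ā * j)} { - 1#} (j * j) (- (j * ι + 1#)) eq (⁻¹-inverse ι≉0) (ringIdentity 4 (λ a b c d → a :* b :* (c :* b) :- (:- :1) := b :* b :* (d :* d :- (:- (a :* c)))
            :+ (:- (b :* d :+ :1)) :* (b :* d :- :1)) (_ ∷ _ ∷ _ ∷ _ ∷ []))
      νν̄≈-1 : ν * bar ν ≈ - 1#
      νν̄≈-1 = trans (*-congˡ (refl ⟨*⟩ fixed-⁻¹ ι≉0 fι)) (norm-ν (bar a) ιι≈-N)
      square-if : ∀ k → Fixed k → k * k ≈ - 1# → SquareNorm a
      square-if k fk kk≈-1 = k * ι , fixed-* fk fι , squared (norm a) ιι≈-N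
        where
        squared : ∀ N → ι * ι ≈ - N → k * ι * (k * ι) ≈ N
        squared N eq = combine₂ {k * ι * (k * ι)} {N} (ι * ι) (- 1#) kk≈-1 eq (ringIdentity 3 (λ a b c → a :* b :* (a :* b) :- c := b :* b :* (a :* a :- (:- :1)) :+ (:- :1)
              :* (b :* b :- (:- c))) (_ ∷ _ ∷ _ ∷ []))
      ei : bar i ≈ - i
      ei = [ (λ fi → contradiction (square-if i fi ii≈-1) nonsquare) , (λ ei → ei) ]′
        (√fixed {i} (fixed-cong (sym ii≈-1) (fixed-neg bar-1)))
      δ≉0 : ν - bar ν ≉ 0#
      δ≉0 eq = nonsquare (square-if ν (sym (combine₁ {ν} {bar ν} 1# eq (ringIdentity 3 (λ a b c → a :* b :- c := :1 :* (a :* b :- c :- :0)) (_ ∷ _ ∷ _ ∷ []))))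
        (trans (*-congˡ (combine₁ {ν} {bar ν} 1# eq (ringIdentity 3 (λ a b c → a :* b :- c := :1 :* (a :* b :- c :- :0)) (_ ∷ _ ∷ _ ∷ [])))) νν̄≈-1))
      equation : ∀ p̄ → p̄ ≈ 1# - i → a * p̄ ≈ (1# + i) * (- (i * ι) * (a * j))
      equation p̄ eq = combine₃ {a * p̄} {(1# + i) * (- (i * ι) * (a * j))} a ((i + i * i) * a) a eq
        (⁻¹-inverse ι≉0) ii≈-1 (ringIdentity 5 (λ a b c d e → a :* b :- (:1 :+ c) :* ((:- (c :* d)) :* (a :* e)) := a :* (b :- (:1
              :- c)) :+ (c :+ c :* c) :* a :* (e :* d :- :1) :+ a :* (c :* c :- (:- :1))) (_ ∷ _ ∷ _ ∷ _ ∷ _ ∷ []))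

    -- For `τ = ± ι` one has `a (ā - τ) = - τ (a + τ)`, so `p = (a + τ) ȳ` gives
    -- `a p̄ / p = - τ (y / ȳ)` for any `y`. The choice `y = 1 + ι` makes `ν = y / ȳ` nonfixed,
    -- because `y² - ȳ² = 4 ι`.
    imaginary-case : ∀ ι → ι * ι ≈ - norm a → bar ι ≈ - ι → ContainsBMSpecialTripleO'Nan (𝓤 a b)
    imaginary-case ι ιι≈-N eι =
      let τ , eτ , τ≉0 , ττ≈ιι , w≉0 = choose-sign a ι≉0 (λ x → bar x ≈ - x) eι (⟨neg⟩ eι)
      in go τ eτ τ≉0 (trans ττ≈ιι ιι≈-N) w≉0
      where
      ι≉0 : ι ≉ 0#
      ι≉0 = square≉0 ιι≈-N (-‿≉0 (norm≉0 a≉0))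
      y ȳ ν : Carrier
      y = 1# + ι
      ȳ = 1# - ι
      ν = y * ȳ ⁻¹
      ey : bar y ≈ ȳ
      ey = bar-1 ⟨+⟩ eι
      eȳ : bar ȳ ≈ y
      eȳ = trans (bar-1 ⟨-⟩ eι) (ringIdentity 1 (λ a → :1 :- (:- a) := :1 :+ a) (_ ∷ []))
      y≉0 : y ≉ 0#
      y≉0 = from-difference {y} {ȳ} ey (ringIdentity 1 (λ a → :1 :+ a :- (:1 :- a) := (:1 :+ :1) :* a) (_ ∷ [])) (*-≉0 {1# + 1#} {ι} 2≉0 ι≉0)
      ȳ≉0 : ȳ ≉ 0#
      ȳ≉0 eq = y≉0 (trans (sym eȳ) (trans (bar-cong eq) bar-0))
      yȳ⁻¹ : ∀ {u v} → u * y ≈ 1# → v * ȳ ≈ 1# → y * v * (ȳ * u) ≈ 1#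
      yȳ⁻¹ {u} {v} eu ev = combine₂ {y * v * (ȳ * u)} {1#} (v * ȳ) 1# eu ev (ringIdentity 3 (λ a b c → (:1 :+ a) :* b :* ((:1 :- a) :* c) :- :1 := b :* (:1 :- a) :* (c :* (:1
            :+ a) :- :1) :+ :1 :* (b :* (:1 :- a) :- :1)) (_ ∷ _ ∷ _ ∷ []))
      bar-ν : bar ν ≈ ȳ * bar (ȳ ⁻¹)
      bar-ν = ey ⟨*⟩ refl
      bar-inverse : bar (ȳ ⁻¹) * y ≈ 1#
      bar-inverse = trans (*-congˡ (sym eȳ)) (trans (sym (bar-* (ȳ ⁻¹) ȳ)) (trans (bar-cong (⁻¹-inverse ȳ≉0)) bar-1))
      νν̄≈1 : ν * bar ν ≈ 1#
      νν̄≈1 = trans (*-congˡ bar-ν) (yȳ⁻¹ bar-inverse (⁻¹-inverse ȳ≉0))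
      δ≉0 : ν - bar ν ≉ 0#
      δ≉0 eq = *-≉0 {(1# + 1#) * (1# + 1#)} {ι} (*-≉0 {1# + 1#} {1# + 1#} 2≉0 2≉0) ι≉0
        (four-ι (bar (ȳ ⁻¹)) (ȳ ⁻¹) bar-inverse (⁻¹-inverse ȳ≉0) (trans (+-congˡ (-‿cong (sym bar-ν))) eq))
        where
        four-ι : ∀ u v → u * y ≈ 1# → v * ȳ ≈ 1# → y * v - ȳ * u ≈ 0# → (1# + 1#) * (1# + 1#) * ι ≈ 0#
        four-ι u v eu ev eq = combine₃ {(1# + 1#) * (1# + 1#) * ι} {0#} (ȳ * ȳ) (- (y * y)) (y * ȳ) eu ev eq (ringIdentity 3 (λ a b c → (:1 :+ :1) :* (:1 :+ :1) :* a :- :0 := (:1 :- a) :* (:1 :- a) :* (b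
              :* (:1 :+ a) :- :1) :+ (:- ((:1 :+ a) :* (:1 :+ a))) :* (c :* (:1 :- a) :- :1) :+ (:1
              :+ a) :* (:1 :- a) :* ((:1 :+ a) :* c :- (:1 :- a) :* b :- :0)) (_ ∷ _ ∷ _ ∷ []))
      go : ∀ τ → bar τ ≈ - τ → τ ≉ 0# → τ * τ ≈ - norm a → a + τ ≉ 0# → ContainsBMSpecialTripleO'Nan (𝓤 a b)
      go τ eτ τ≉0 ττ≈-N w≉0 = contains-unit a b ν 1# (- τ) ((a + τ) * ȳ) νν̄≈1 bar-1 (*-identityˡ 1#) δ≉0
        (⟨neg⟩ eτ) (-‿≉0 τ≉0) (*-≉0 {a + τ} {ȳ} w≉0 ȳ≉0)
        (equation (bar a) (bar ((a + τ) * ȳ)) (ȳ ⁻¹) ((refl ⟨+⟩ eτ) ⟨*⟩ eȳ) (⁻¹-inverse ȳ≉0) ττ≈-N) 7≤q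
        where
        equation : ∀ ā p̄ v → p̄ ≈ (ā + - τ) * y → v * ȳ ≈ 1# → τ * τ ≈ - (a * ā) →
          a * p̄ ≈ (a + τ) * ȳ * (- τ * (y * v))
        equation ā p̄ v e e′ e″ = combine₃ {a * p̄} {(a + τ) * ȳ * (- τ * (y * v))}
          a ((a + τ) * τ * y) y e e′ e″ (ringIdentity 6 (λ a b c d e f → a :* b :- (a :+ c) :* (:1 :- d) :* ((:- c) :* ((:1 :+ d) :* e))
                := a :* (b :- (f :- c) :* (:1 :+ d)) :+ (a :+ c) :* c :* (:1 :+ d) :* (e :* (:1
                :- d) :- :1) :+ (:1 :+ d) :* (c :* c :- (:- (a :* f)))) (_ ∷ _ ∷ _ ∷ _ ∷ _ ∷ _ ∷ []))

  -- Discriminant, tangency and sublines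

  discriminant : Carrier → Carrier → Carrier
  discriminant a b = (b - bar b) * (b - bar b) + (1# + 1#) * (1# + 1#) * norm a

  discriminant-≈ : ∀ a b → discriminant a b ≈ (b - b ^ q) ^ 2 + 4 · (a ^ (q ℕ.+ 1))
  discriminant-≈ a b = sym (trans (+-cong (square (b - b ^ q) (b - bar b) (+-congˡ (-‿cong (bar-def b)))) (four (a ^ (q ℕ.+ 1)))) (+-congˡ (*-congˡ (^1+q a))))
    where
    square : ∀ u v → u ≈ v → u * (u * 1#) ≈ v * v
    square u v u≈v = *-cong u≈v (trans (*-identityʳ u) u≈v)
    four : ∀ x → x + (x + (x + (x + 0#))) ≈ (1# + 1#) * (1# + 1#) * x
    four x = (ringIdentity 1 (λ a → a :+ (a :+ (a :+ (a :+ :0))) := (:1 :+ :1) :* (:1 :+ :1) :* a) (_ ∷ []))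

  admissible⇒ : ∀ {a b} → Admissible a b → ∀ s → Fixed s → ¬ (s * s ≈ discriminant a b)
  admissible⇒ {a} {b} adm s fs eq = adm (s , fixed⇒𝔽q fs , trans eq (discriminant-≈ a b))

  ⇒admissible : ∀ {a b} → (∀ s → Fixed s → ¬ (s * s ≈ discriminant a b)) → Admissible a b
  ⇒admissible {a} {b} nonsq (s , s∈ , eq) = nonsq s (𝔽q⇒fixed s∈) (trans eq (sym (discriminant-≈ a b)))

  -- If a z² + b z z̄ is fixed then g = a z / z̄ satisfies g - ḡ = b̄ - b, so
  -- that (g + ḡ)² is the discriminant.
  tangent : ∀ {a b} → Admissible a b → ∀ z → z ≉ 0# → ¬ Fixed (curve a b z)
  tangent {a} {b} adm z z≉0 f = admissible⇒ adm (g + bar g) (trans (refl ⟨+⟩ refl′) (+-comm (bar g) g))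
    (identity (bar a) (bar b) (bar z) (z ⁻¹) (bar (z ⁻¹)) (bar g) (⁻¹-inverse z≉0)
      (trans (sym (bar-* (z ⁻¹) z)) (trans (bar-cong (⁻¹-inverse z≉0)) bar-1))
      (trans (bar-* (a * z) (bar (z ⁻¹))) (*-cong (bar-* a z) (bar-involutive (z ⁻¹))))
      (trans (sym (refl ⟨*⟩ (refl ⟨*⟩ refl) ⟨+⟩ refl ⟨*⟩ fixed-norm z)) f))
    where
    g = a * z * bar (z ⁻¹)
    refl′ : bar (bar g) ≈ g
    refl′ = bar-involutive g
    identity : ∀ ā b̄ z̄ j j̄ ḡ → j * z ≈ 1# → j̄ * z̄ ≈ 1# → ḡ ≈ ā * z̄ * j →
      ā * (z̄ * z̄) + b̄ * (z * z̄) ≈ a * (z * z) + b * (z * z̄) →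
      (a * z * j̄ + ḡ) * (a * z * j̄ + ḡ) ≈ (b - b̄) * (b - b̄) + (1# + 1#) * (1# + 1#) * (a * ā)
    identity ā b̄ z̄ j j̄ ḡ jz≈1 j̄z̄≈1 eg f = combine₃
      {(a * z * j̄ + ḡ) * (a * z * j̄ + ḡ)} {(b - b̄) * (b - b̄) + (1# + 1#) * (1# + 1#) * (a * ā)}
      1# ((1# + 1#) * (1# + 1#)) (difference + (b̄ - b)) square product difference≈ (ringIdentity 7 (λ a b c d e f g → (a :* b :* c :+ d) :* (a :* b :* c :+ d) :- ((e :- f) :* (e
            :- f) :+ (:1 :+ :1) :* (:1 :+ :1) :* (a :* g)) := :1 :* ((a :* b :* c :+ d) :* (a :* b
            :* c :+ d) :- ((a :* b :* c :- d) :* (a :* b :* c :- d) :+ (:1 :+ :1) :* (:1 :+ :1)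
            :* (a :* b :* c :* d))) :+ (:1 :+ :1) :* (:1 :+ :1) :* (a :* b :* c :* d :- a :* g)
            :+ (a :* b :* c :- d :+ (f :- e)) :* (a :* b :* c :- d :- (f :- e))) (_ ∷ _ ∷ _ ∷ _ ∷ _ ∷ _ ∷ _ ∷ []))
      where
      difference = a * z * j̄ - ḡ
      product : a * z * j̄ * ḡ ≈ a * ā
      product = combine₃ {a * z * j̄ * ḡ} {a * ā} (a * z * j̄) (a * ā * (j̄ * z̄)) (a * ā) eg jz≈1 j̄z̄≈1 (ringIdentity 7 (λ a b c d e f g → a :* b :* c :* d :- a :* e := a :* b :* c :* (d :- e :* f :* g)
            :+ a :* e :* (c :* f) :* (g :* b :- :1) :+ a :* e :* (c :* f :- :1)) (_ ∷ _ ∷ _ ∷ _ ∷ _ ∷ _ ∷ _ ∷ []))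
      square : (a * z * j̄ + ḡ) * (a * z * j̄ + ḡ) ≈ difference * difference + (1# + 1#) * (1# + 1#) * (a * z * j̄ * ḡ)
      square = (ringIdentity 4 (λ a b c d → (a :* b :* c :+ d) :* (a :* b :* c :+ d) := (a :* b :* c :- d) :* (a
            :* b :* c :- d) :+ (:1 :+ :1) :* (:1 :+ :1) :* (a :* b :* c :* d)) (_ ∷ _ ∷ _ ∷ _ ∷ []))
      scaled-f : j * j̄ * (ā * (z̄ * z̄) + b̄ * (z * z̄)) ≈ j * j̄ * (a * (z * z) + b * (z * z̄))
      scaled-f = *-congˡ f
      difference≈ : difference ≈ b̄ - b
      difference≈ = trans (+-congˡ (-‿cong eg)) (combine₃ {a * z * j̄ - ā * z̄ * j} {b̄ - b} (- 1#)
        (ā * z̄ * j + b̄ * (j * z) - b * (j * z)) (b̄ - b - a * z * j̄) scaled-f j̄z̄≈1 jz≈1 (ringIdentity 8 (λ a b c d e f g h → a :* b :* c :- d :* e :* f :- (g :- h) := (:- :1) :* (f :* c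
              :* (d :* (e :* e) :+ g :* (b :* e)) :- f :* c :* (a :* (b :* b) :+ h :* (b :* e)))
              :+ (d :* e :* f :+ g :* (f :* b) :- h :* (f :* b)) :* (c :* e :- :1) :+ (g :- h :- a
              :* b :* c) :* (f :* b :- :1)) (_ ∷ _ ∷ _ ∷ _ ∷ _ ∷ _ ∷ _ ∷ _ ∷ [])))

  -- No line meets the unital in three affine points whose first
  -- coordinates are collinear over the subfield.
  no-subline : ∀ {a b} → Admissible a b → ∀ M x z w l →
    Fixed (M * z - (curve a b (x + z) - curve a b x)) →
    Fixed (M * w - (curve a b (x + w) - curve a b x)) →
    Fixed l → w ≈ l * z → z ≉ 0# → w ≉ 0# → w ≉ z → ⊥
  no-subline {a} {b} adm M x z w l fz fw fl w≈lz z≉0 w≉0 w≉z = tangent {a} {b} adm z z≉0 fixed-curve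
    where
    L = l * (l - 1#)
    u = M * z - (curve a b (x + z) - curve a b x)
    v = M * w - (curve a b (x + w) - curve a b x)
    L≉0 : L ≉ 0#
    L≉0 = *-≉0 {l} {l - 1#} (λ l≈0 → w≉0 (combine₂ {w} {0#} 1# z w≈lz l≈0 (ringIdentity 3 (λ a b c → a :- :0 := :1 :* (a :- b :* c) :+ c :* (b :- :0)) (_ ∷ _ ∷ _ ∷ []))))
      (λ eq → w≉z (combine₂ {w} {z} 1# z w≈lz eq (ringIdentity 3 (λ a b c → a :- b := :1 :* (a :- c :* b) :+ b :* (c :- :1 :- :0)) (_ ∷ _ ∷ _ ∷ []))))
    -- For `l` in 𝔽q the terms of degree one in `z` and `z̄` cancel, and the terms of degree two are
    -- multiplied by `l²` on one side and by `l` on the other.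
    identity : ∀ x̄ z̄ w̄ s̄ t̄ → s̄ ≈ x̄ + z̄ → t̄ ≈ x̄ + w̄ → w̄ ≈ l * z̄ →
      l * (M * z - (a * ((x + z) * (x + z)) + b * ((x + z) * s̄) - (a * (x * x) + b * (x * x̄))))
      - (M * w - (a * ((x + w) * (x + w)) + b * ((x + w) * t̄) - (a * (x * x) + b * (x * x̄))))
      ≈ l * (l - 1#) * (a * (z * z) + b * (z * z̄))
    identity x̄ z̄ w̄ s̄ t̄ es et ew = trans
      (combine₁ {l * (M * z - (a * ((x + z) * (x + z)) + b * ((x + z) * s̄) - (a * (x * x) + b * (x * x̄)))) - v′ w t̄}
        {l * u′ - v′ w t̄} (- (l * b * (x + z))) es (ringIdentity 11 (λ a b c d e f g h i j k → a :* (b :* c :- (d :* ((e :+ c) :* (e :+ c)) :+ f :* ((e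
              :+ c) :* g) :- (d :* (e :* e) :+ f :* (e :* h)))) :- (b :* i :- (d :* ((e :+ i) :* (e
              :+ i)) :+ f :* ((e :+ i) :* j) :- (d :* (e :* e) :+ f :* (e :* h)))) :- (a :* (b
              :* c :- (d :* ((e :+ c) :* (e :+ c)) :+ f :* ((e :+ c) :* (h :+ k)) :- (d :* (e :* e)
              :+ f :* (e :* h)))) :- (b :* i :- (d :* ((e :+ i) :* (e :+ i)) :+ f :* ((e :+ i)
              :* j) :- (d :* (e :* e) :+ f :* (e :* h))))) := (:- (a :* f :* (e :+ c))) :* (g :- (h
              :+ k))) (_ ∷ _ ∷ _ ∷ _ ∷ _ ∷ _ ∷ _ ∷ _ ∷ _ ∷ _ ∷ _ ∷ [])))
      (trans (combine₃ {l * u′ - v′ w t̄} {l * u′ - v′ (l * z) (x̄ + l * z̄)}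
        (a * (x + x + w + l * z) + b * (x̄ + l * z̄) - M) (b * (x + w)) (b * (x + w)) w≈lz et ew (ringIdentity 11 (λ a b c d e f g h i j k → a :* (b :* c :- (d :* ((e :+ c) :* (e :+ c)) :+ f :* ((e
              :+ c) :* (g :+ h)) :- (d :* (e :* e) :+ f :* (e :* g)))) :- (b :* i :- (d :* ((e
              :+ i) :* (e :+ i)) :+ f :* ((e :+ i) :* j) :- (d :* (e :* e) :+ f :* (e :* g))))
              :- (a :* (b :* c :- (d :* ((e :+ c) :* (e :+ c)) :+ f :* ((e :+ c) :* (g :+ h)) :- (d
              :* (e :* e) :+ f :* (e :* g)))) :- (b :* (a :* c) :- (d :* ((e :+ a :* c) :* (e :+ a
              :* c)) :+ f :* ((e :+ a :* c) :* (g :+ a :* h)) :- (d :* (e :* e) :+ f :* (e :* g)))))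
              := (d :* (e :+ e :+ i :+ a :* c) :+ f :* (g :+ a :* h) :- b) :* (i :- a :* c) :+ f
              :* (e :+ i) :* (j :- (g :+ k)) :+ f :* (e :+ i) :* (k :- a :* h)) (_ ∷ _ ∷ _ ∷ _ ∷ _ ∷ _ ∷ _ ∷ _ ∷ _ ∷ _ ∷ _ ∷ []))) (ringIdentity 8 (λ a b c d e f g h → a :* (b :* c :- (d :* ((e :+ c) :* (e :+ c)) :+ f :* ((e :+ c)
              :* (g :+ h)) :- (d :* (e :* e) :+ f :* (e :* g)))) :- (b :* (a :* c) :- (d :* ((e
              :+ a :* c) :* (e :+ a :* c)) :+ f :* ((e :+ a :* c) :* (g :+ a :* h)) :- (d :* (e
              :* e) :+ f :* (e :* g)))) := a :* (a :- :1) :* (d :* (c :* c) :+ f :* (c :* h))) (_ ∷ _ ∷ _ ∷ _ ∷ _ ∷ _ ∷ _ ∷ _ ∷ [])))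
      where
      u′ : Carrier
      u′ = M * z - (a * ((x + z) * (x + z)) + b * ((x + z) * (x̄ + z̄)) - (a * (x * x) + b * (x * x̄)))
      v′ : Carrier → Carrier → Carrier
      v′ w t̄ = M * w - (a * ((x + w) * (x + w)) + b * ((x + w) * t̄) - (a * (x * x) + b * (x * x̄)))
    w̄≈ : bar w ≈ l * bar z
    w̄≈ = trans (bar-cong w≈lz) (trans (bar-* l z) (*-congʳ fl))
    L-fixed : Fixed L
    L-fixed = fixed-* {l} {l - 1#} fl (fixed-- {l} {1#} fl bar-1)
    difference : Fixed (L * curve a b z)
    difference = fixed-cong {l * u - v} {L * curve a b z}
      (identity (bar x) (bar z) (bar w) (bar (x + z)) (bar (x + w)) (bar-+ x z) (bar-+ x w) w̄≈)
      (fixed-- {l * u} {v} (fixed-* {l} {u} fl fz) fw)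
    fixed-curve : Fixed (curve a b z)
    fixed-curve = fixed-cong {L ⁻¹ * (L * curve a b z)} {curve a b z} (⁻¹-cancelˡ L≉0 (curve a b z))
      (fixed-* {L ⁻¹} {L * curve a b z} (fixed-⁻¹ {L} L≉0 L-fixed) difference)

  -- O'Nan configurations at T∞ and at affine points

  -- Four lines whose six points of intersection are `P` and `X₁` to `X₅`: `P` is on `l₁` and `l₂`,
  -- opposite to `X₅` on `l₃` and `l₄`. Distinctness is expressed by points missing lines, which
  -- automorphisms preserve.
  record ONanAt (S : PointSet) (P : Point) : Set (c Level.⊔ ℓ₁ Level.⊔ ℓ₂) where
    field
      X₁ X₂ X₃ X₄ X₅ : Point
      l₁ l₂ l₃ l₄ : Line
      X₁∈S : S X₁
      X₂∈S : S X₂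
      X₃∈S : S X₃
      X₄∈S : S X₄
      X₅∈S : S X₅
      P∈l₁ : P on l₁
      X₁∈l₁ : X₁ on l₁
      X₂∈l₁ : X₂ on l₁
      P∈l₂ : P on l₂
      X₃∈l₂ : X₃ on l₂
      X₄∈l₂ : X₄ on l₂
      X₁∈l₃ : X₁ on l₃
      X₃∈l₃ : X₃ on l₃
      X₅∈l₃ : X₅ on l₃
      X₂∈l₄ : X₂ on l₄
      X₄∈l₄ : X₄ on l₄
      X₅∈l₄ : X₅ on l₄
      P∉l₃ : ¬ P on l₃
      P∉l₄ : ¬ P on l₄
      X₁∉l₄ : ¬ X₁ on l₄
      X₄∉l₃ : ¬ X₄ on l₃
      X₁∉l₂ : ¬ X₁ on l₂

  on-cong : ∀ P Q l → P ∼ Q → Q on l → P on l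
  on-cong P Q l P∼Q Q∈l = on-∼ P Q l l P∼Q (∼-refl l) Q∈l

  affine-on : ∀ x y l → affine x y on l → coords l 0F * x + coords l 1F * y + coords l 2F ≈ 0#
  affine-on x y l P∈l = trans (+-congˡ (sym (*-identityʳ (coords l 2F)))) (on⇒dot (affine x y) l P∈l)

  on-affine : ∀ x y l → coords l 0F * x + coords l 1F * y + coords l 2F ≈ 0# → affine x y on l
  on-affine x y l eq = dot⇒on (affine x y) l (trans (+-congˡ (*-identityʳ (coords l 2F))) eq)

  T∞-on : ∀ l → T∞ on l → coords l 1F ≈ 0#
  T∞-on l T∈l = trans (expand (coords l 0F) (coords l 1F) (coords l 2F)) (on⇒dot T∞ l T∈l)
    where
    expand : ∀ x y z → y ≈ x * 0# + y * 1# + z * 0#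
    expand x y z = (ringIdentity 3 (λ a b c → a := b :* :0 :+ a :* :1 :+ c :* :0) (_ ∷ _ ∷ _ ∷ []))

  on-T∞ : ∀ l → coords l 1F ≈ 0# → T∞ on l
  on-T∞ l eq = dot⇒on T∞ l (trans (sym (expand (coords l 0F) (coords l 1F) (coords l 2F))) eq)
    where
    expand : ∀ x y z → y ≈ x * 0# + y * 1# + z * 0#
    expand x y z = (ringIdentity 3 (λ a b c → a := b :* :0 :+ a :* :1 :+ c :* :0) (_ ∷ _ ∷ _ ∷ []))

  vertical-≉0 : ∀ x y l → T∞ on l → affine x y on l → coords l 0F ≉ 0#
  vertical-≉0 x y l T∈l P∈l l₀≈0 = nonzero-coordinate l l₀≈0 (T∞-on l T∈l)
    (combine₃ {coords l 2F} {0#} 1# (- x) (- y) (affine-on x y l P∈l) l₀≈0 (T∞-on l T∈l) (ringIdentity 5 (λ a b c d e → a :- :0 := :1 :* (b :* c :+ d :* e :+ a :- :0) :+ (:- c) :* (b :-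
          :0) :+ (:- e) :* (d :- :0)) (_ ∷ _ ∷ _ ∷ _ ∷ _ ∷ [])))

  vertical-≈ : ∀ x y x′ y′ l → T∞ on l → affine x y on l → affine x′ y′ on l → x ≈ x′
  vertical-≈ x y x′ y′ l T∈l P∈l P′∈l = combine₁ {x} {x′} 1# (*-cancel-0 {coords l 0F} {x - x′}
    (vertical-≉0 x y l T∈l P∈l)
    (combine₃ {coords l 0F * (x - x′)} {0#} 1# (- 1#) (y′ - y) (affine-on x y l P∈l) (affine-on x′ y′ l P′∈l) (T∞-on l T∈l) (ringIdentity 7 (λ a b c d e f g → a :* (b :- c) :- :0 := :1 :* (a :* b :+ d :* e :+ f :- :0) :+ (:-
          :1) :* (a :* c :+ d :* g :+ f :- :0) :+ (g :- e) :* (d :- :0)) (_ ∷ _ ∷ _ ∷ _ ∷ _ ∷ _ ∷ _ ∷ [])))) (ringIdentity 2 (λ a b → a :- b := :1 :* (a :- b :- :0)) (_ ∷ _ ∷ []))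

  verticals-meet : ∀ x y l m R → T∞ on l → T∞ on m → affine x y on l → affine x y on m → R on m → R on l
  verticals-meet x y l m R T∈l T∈m P∈l P∈m R∈m = dot⇒on R l
    (combine₃ {dot (coords l) (coords R)} {0#} (coords l 0F) (coords R 2F) (coords R 1F - coords R 2F * y) R₀≈ (affine-on x y l P∈l) (T∞-on l T∈l) (ringIdentity 8 (λ a b c d e f g h → a :* b :+ c :* d :+ e :* f :- :0 := a :* (b :- g :* f) :+ f
          :* (a :* g :+ c :* h :+ e :- :0) :+ (d :- f :* h) :* (c :- :0)) (_ ∷ _ ∷ _ ∷ _ ∷ _ ∷ _ ∷ _ ∷ _ ∷ [])))
    where
    R₀≈ : coords R 0F ≈ x * coords R 2F
    R₀≈ = combine₁ {coords R 0F} {x * coords R 2F} 1# (*-cancel-0 {coords m 0F} {coords R 0F - x * coords R 2F}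
      (vertical-≉0 x y m T∈m P∈m)
      (combine₃ {coords m 0F * (coords R 0F - x * coords R 2F)} {0#} 1# (- coords R 2F) (coords R 2F * y - coords R 1F)
        (on⇒dot R m R∈m) (affine-on x y m P∈m) (T∞-on m T∈m) (ringIdentity 8 (λ a b c d e f g h → a :* (b :- c :* d) :- :0 := :1 :* (a :* b :+ e :* f :+ g :* d
              :- :0) :+ (:- d) :* (a :* c :+ e :* h :+ g :- :0) :+ (d :* h :- f) :* (e :- :0)) (_ ∷ _ ∷ _ ∷ _ ∷ _ ∷ _ ∷ _ ∷ _ ∷ [])))) (ringIdentity 3 (λ a b c → a :- b :* c := :1 :* (a :- b :* c :- :0)) (_ ∷ _ ∷ _ ∷ []))

  slopeOf interceptOf : Line → Carrier
  slopeOf l     = - (coords l 1F ⁻¹ * coords l 0F)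
  interceptOf l = - (coords l 1F ⁻¹ * coords l 2F)

  on⇒height : ∀ x y l → ¬ T∞ on l → affine x y on l → y ≈ slopeOf l * x + interceptOf l
  on⇒height x y l T∉l P∈l = combine₂ {y} {slopeOf l * x + interceptOf l} (coords l 1F ⁻¹) (- y)
    (affine-on x y l P∈l) (⁻¹-inverse (λ l₁≈0 → T∉l (on-T∞ l l₁≈0))) (ringIdentity 6 (λ a b c d e f → a :- ((:- (b :* c)) :* d :- b :* e) := b :* (c :* d :+ f :* a
          :+ e :- :0) :+ (:- a) :* (b :* f :- :1)) (_ ∷ _ ∷ _ ∷ _ ∷ _ ∷ _ ∷ []))

  height⇒on : ∀ x y l → ¬ T∞ on l → y ≈ slopeOf l * x + interceptOf l → affine x y on l
  height⇒on x y l T∉l eq = on-affine x y l (combine₂ {coords l 0F * x + coords l 1F * y + coords l 2F} {0#}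
    (coords l 1F) (- (coords l 0F * x + coords l 2F)) eq (⁻¹-inverse (λ l₁≈0 → T∉l (on-T∞ l l₁≈0))) (ringIdentity 6 (λ a b c d e f → a :* b :+ c :* d :+ e :- :0 := c :* (d :- ((:- (f :* a)) :* b
          :- f :* e)) :+ (:- (a :* b :+ e)) :* (f :* c :- :1)) (_ ∷ _ ∷ _ ∷ _ ∷ _ ∷ _ ∷ [])))

  Affine : Carrier → Carrier → Point → Set _
  Affine a b P = ∃[ x ] ∃[ y ] P ∼ affine x y × Fixed (y - curve a b x)

  affine-point : ∀ a b P l → 𝓤 a b P → P on l → ¬ T∞ on l → Affine a b P
  affine-point a b P l P∈U P∈l T∉l = [ (λ aff → aff) , (λ P∼T∞ → contradiction (on-cong T∞ P l (∼-sym P T∞ P∼T∞) P∈l) T∉l) ]′ (𝓤-cases a b P P∈U)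

  curve-cong : ∀ a b {x x′} → x ≈ x′ → curve a b x ≈ curve a b x′
  curve-cong a b x≈x′ = +-cong (*-congˡ (*-cong x≈x′ x≈x′)) (*-congˡ (*-cong x≈x′ (bar-cong x≈x′)))

  -- Points of the unital on one vertical line have heights that differ by elements of 𝔽q. So the
  -- vertical gaps `r` and `r′` between the two lines at `x` and `x′` are fixed. They are
  -- proportional to `x - z` and `x′ - z`, where `z` is the abscissa of the crossing, and `z`, `x`,
  -- `x′` become collinear over 𝔽q.
  no-O'Nan-heights : ∀ {a b} → Admissible a b → ∀ M K M′ K′ x x′ z →
    Fixed (M * x + K - curve a b x) → Fixed (M′ * x + K′ - curve a b x) →
    Fixed (M * x′ + K - curve a b x′) → Fixed (M′ * x′ + K′ - curve a b x′) →
    Fixed (M * z + K - curve a b z) → M * z + K ≈ M′ * z + K′ →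
    M * x + K ≉ M′ * x + K′ → M * x′ + K ≉ M′ * x′ + K′ → x ≉ x′ → ⊥
  no-O'Nan-heights {a} {b} adm M K M′ K′ x x′ z f₁ f₂ f₃ f₄ f₅ meet h≉ h′≉ x≉x′ =
    no-subline {a} {b} adm M z (x - z) (x′ - z) (r′ * r ⁻¹)
      (shift x f₁) (shift x′ f₃) (fixed-* {r′} {r ⁻¹} fr′ (fixed-⁻¹ {r} r≉0 fr))
      ratio x-z≉0 x′-z≉0 (λ eq → x≉x′ (combine₁ {x} {x′} (- 1#) eq (ringIdentity 3 (λ a b c → a :- b := (:- :1) :* (b :- c :- (a :- c))) (_ ∷ _ ∷ _ ∷ []))))
    where
    r = M * x + K - (M′ * x + K′)
    r′ = M * x′ + K - (M′ * x′ + K′)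
    r≉0 : r ≉ 0#
    r≉0 = -≉0 h≉
    r′≉0 : r′ ≉ 0#
    r′≉0 = -≉0 h′≉
    fixed-difference : ∀ {y y′ w} → Fixed (y - w) → Fixed (y′ - w) → Fixed (y - y′)
    fixed-difference {y} {y′} {w} f f′ = fixed-cong {y - w - (y′ - w)} {y - y′} (ringIdentity 3 (λ a b c → a :- b :- (c :- b) := a :- c) (_ ∷ _ ∷ _ ∷ [])) (fixed-- {y - w} {y′ - w} f f′)
    fr : Fixed r
    fr = fixed-difference {M * x + K} {M′ * x + K′} {curve a b x} f₁ f₂
    fr′ : Fixed r′
    fr′ = fixed-difference {M * x′ + K} {M′ * x′ + K′} {curve a b x′} f₃ f₄
    r≈ : r ≈ (M - M′) * (x - z)
    r≈ = combine₁ {r} {(M - M′) * (x - z)} 1# meet (ringIdentity 6 (λ a b c d e f → a :* b :+ c :- (d :* b :+ e) :- (a :- d) :* (b :- f) := :1 :* (a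
          :* f :+ c :- (d :* f :+ e))) (_ ∷ _ ∷ _ ∷ _ ∷ _ ∷ _ ∷ []))
    r′≈ : r′ ≈ (M - M′) * (x′ - z)
    r′≈ = combine₁ {r′} {(M - M′) * (x′ - z)} 1# meet (ringIdentity 6 (λ a b c d e f → a :* b :+ c :- (d :* b :+ e) :- (a :- d) :* (b :- f) := :1 :* (a
          :* f :+ c :- (d :* f :+ e))) (_ ∷ _ ∷ _ ∷ _ ∷ _ ∷ _ ∷ []))
    ΔM≉0 : M - M′ ≉ 0#
    ΔM≉0 eq = r≉0 (combine₂ {r} {0#} 1# (x - z) r≈ eq (ringIdentity 6 (λ a b c d e f → a :* b :+ c :- (d :* b :+ e) :- :0 := :1 :* (a :* b :+ c :- (d
          :* b :+ e) :- (a :- d) :* (b :- f)) :+ (b :- f) :* (a :- d :- :0)) (_ ∷ _ ∷ _ ∷ _ ∷ _ ∷ _ ∷ [])))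
    x-z≉0 : x - z ≉ 0#
    x-z≉0 eq = r≉0 (combine₂ {r} {0#} 1# (M - M′) r≈ eq (ringIdentity 6 (λ a b c d e f → a :* b :+ c :- (d :* b :+ e) :- :0 := :1 :* (a :* b :+ c :- (d
          :* b :+ e) :- (a :- d) :* (b :- f)) :+ (a :- d) :* (b :- f :- :0)) (_ ∷ _ ∷ _ ∷ _ ∷ _ ∷ _ ∷ [])))
    x′-z≉0 : x′ - z ≉ 0#
    x′-z≉0 eq = r′≉0 (combine₂ {r′} {0#} 1# (M - M′) r′≈ eq (ringIdentity 6 (λ a b c d e f → a :* b :+ c :- (d :* b :+ e) :- :0 := :1 :* (a :* b :+ c :- (d
          :* b :+ e) :- (a :- d) :* (b :- f)) :+ (a :- d) :* (b :- f :- :0)) (_ ∷ _ ∷ _ ∷ _ ∷ _ ∷ _ ∷ [])))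
    ratio : x′ - z ≈ r′ * r ⁻¹ * (x - z)
    ratio = combine₁ {x′ - z} {r′ * r ⁻¹ * (x - z)} 1# (*-cancel-0 {M - M′} {x′ - z - r′ * r ⁻¹ * (x - z)} ΔM≉0
      (abstracted r r′ (r ⁻¹) r≈ r′≈ (⁻¹-inverse {r} r≉0))) (ringIdentity 8 (λ a b c d e f g h → a :- b :- (c :* a :+ d :- (e :* a :+ f)) :* g :* (h :- b)
            := :1 :* (a :- b :- (c :* a :+ d :- (e :* a :+ f)) :* g :* (h :- b) :- :0)) (_ ∷ _ ∷ _ ∷ _ ∷ _ ∷ _ ∷ _ ∷ _ ∷ []))
      where
      abstracted : ∀ r r′ j → r ≈ (M - M′) * (x - z) → r′ ≈ (M - M′) * (x′ - z) → j * r ≈ 1# →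
        (M - M′) * (x′ - z - r′ * j * (x - z)) ≈ 0#
      abstracted r r′ j e e′ e″ = combine₃ {(M - M′) * (x′ - z - r′ * j * (x - z))} {0#}
        (r′ * j) (- 1#) (- r′) e e′ e″ (ringIdentity 8 (λ a b c d e f g h → (a :- b) :* (c :- d :- e :* f :* (g :- d)) :- :0 := e :* f
              :* (h :- (a :- b) :* (g :- d)) :+ (:- :1) :* (e :- (a :- b) :* (c :- d)) :+ (:- e)
              :* (f :* h :- :1)) (_ ∷ _ ∷ _ ∷ _ ∷ _ ∷ _ ∷ _ ∷ _ ∷ []))
    shift : ∀ x → Fixed (M * x + K - curve a b x) → Fixed (M * (x - z) - (curve a b (z + (x - z)) - curve a b z))
    shift x f = fixed-cong {M * x + K - curve a b x - (M * z + K - curve a b z)} {M * (x - z) - (curve a b (z + (x - z)) - curve a b z)}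
      (trans (regroup (curve a b x) (curve a b z)) (+-congˡ {M * (x - z)} (-‿cong (+-congʳ { - curve a b z} (curve-cong a b x≈)))))
      (fixed-- {M * x + K - curve a b x} {M * z + K - curve a b z} f f₅)
      where
      x≈ : x ≈ z + (x - z)
      x≈ = (ringIdentity 2 (λ a b → a := b :+ (a :- b)) (_ ∷ _ ∷ []))
      regroup : ∀ u v → M * x + K - u - (M * z + K - v) ≈ M * (x - z) - (u - v)
      regroup u v = (ringIdentity 6 (λ a b c d e f → a :* b :+ c :- d :- (a :* e :+ c :- f) := a :* (b :- e) :- (d
            :- f)) (_ ∷ _ ∷ _ ∷ _ ∷ _ ∷ _ ∷ []))

  height-fixed : ∀ a b x y l → ¬ T∞ on l → affine x y on l → Fixed (y - curve a b x) →
    ∀ x′ → x ≈ x′ → Fixed (slopeOf l * x′ + interceptOf l - curve a b x′)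
  height-fixed a b x y l T∉l P∈l f x′ x≈x′ = fixed-cong {y - curve a b x} {slopeOf l * x′ + interceptOf l - curve a b x′}
    (+-cong {y} {slopeOf l * x′ + interceptOf l} (trans (on⇒height x y l T∉l P∈l) (+-congʳ {interceptOf l} (*-congˡ {slopeOf l} x≈x′)))
      (-‿cong (curve-cong a b x≈x′))) f

  no-O'Nan-at-T∞ : ∀ {a b} → Admissible a b → ¬ ONanAt (𝓤 a b) T∞
  no-O'Nan-at-T∞ {a} {b} adm o = go
    (affine-point a b X₁ l₃ X₁∈S X₁∈l₃ P∉l₃) (affine-point a b X₂ l₄ X₂∈S X₂∈l₄ P∉l₄)
    (affine-point a b X₃ l₃ X₃∈S X₃∈l₃ P∉l₃) (affine-point a b X₄ l₄ X₄∈S X₄∈l₄ P∉l₄)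
    (affine-point a b X₅ l₃ X₅∈S X₅∈l₃ P∉l₃)
    where
    open ONanAt o
    go : Affine a b X₁ → Affine a b X₂ → Affine a b X₃ → Affine a b X₄ → Affine a b X₅ → ⊥
    go (x₁ , y₁ , ∼₁ , f₁) (x₂ , y₂ , ∼₂ , f₂) (x₃ , y₃ , ∼₃ , f₃) (x₄ , y₄ , ∼₄ , f₄) (x₅ , y₅ , ∼₅ , f₅) =
      no-O'Nan-heights {a} {b} adm (slopeOf l₃) (interceptOf l₃) (slopeOf l₄) (interceptOf l₄) x₁ x₃ x₅
        (height-fixed a b x₁ y₁ l₃ P∉l₃ (to X₁ x₁ y₁ l₃ ∼₁ X₁∈l₃) f₁ x₁ refl)
        (height-fixed a b x₂ y₂ l₄ P∉l₄ (to X₂ x₂ y₂ l₄ ∼₂ X₂∈l₄) f₂ x₁ x₂≈x₁)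
        (height-fixed a b x₃ y₃ l₃ P∉l₃ (to X₃ x₃ y₃ l₃ ∼₃ X₃∈l₃) f₃ x₃ refl)
        (height-fixed a b x₄ y₄ l₄ P∉l₄ (to X₄ x₄ y₄ l₄ ∼₄ X₄∈l₄) f₄ x₃ x₄≈x₃)
        (height-fixed a b x₅ y₅ l₃ P∉l₃ (to X₅ x₅ y₅ l₃ ∼₅ X₅∈l₃) f₅ x₅ refl)
        (trans (sym (on⇒height x₅ y₅ l₃ P∉l₃ (to X₅ x₅ y₅ l₃ ∼₅ X₅∈l₃)))
          (on⇒height x₅ y₅ l₄ P∉l₄ (to X₅ x₅ y₅ l₄ ∼₅ X₅∈l₄)))
        (λ eq → X₁∉l₄ (on-cong X₁ (affine x₁ y₁) l₄ ∼₁ (height⇒on x₁ y₁ l₄ P∉l₄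
          (trans (on⇒height x₁ y₁ l₃ P∉l₃ (to X₁ x₁ y₁ l₃ ∼₁ X₁∈l₃)) eq))))
        (λ eq → X₄∉l₃ (on-cong X₄ (affine x₄ y₄) l₃ ∼₄ (height⇒on x₄ y₄ l₃ P∉l₃
          (trans (on⇒height x₄ y₄ l₄ P∉l₄ (to X₄ x₄ y₄ l₄ ∼₄ X₄∈l₄))
            (trans (+-congʳ {interceptOf l₄} (*-congˡ {slopeOf l₄} x₄≈x₃))
              (trans (sym eq) (+-congʳ {interceptOf l₃} (*-congˡ {slopeOf l₃} (sym x₄≈x₃)))))))))
        (λ x₁≈x₃ → X₁∉l₂ (on-cong X₁ (affine x₁ y₁) l₂ ∼₁ (same-vertical x₁≈x₃)))
      where
      to : ∀ X x y l → X ∼ affine x y → X on l → affine x y on l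
      to X x y l X∼ X∈l = on-cong (affine x y) X l (∼-sym X (affine x y) X∼) X∈l
      x₂≈x₁ : x₂ ≈ x₁
      x₂≈x₁ = vertical-≈ x₂ y₂ x₁ y₁ l₁ P∈l₁ (to X₂ x₂ y₂ l₁ ∼₂ X₂∈l₁) (to X₁ x₁ y₁ l₁ ∼₁ X₁∈l₁)
      x₄≈x₃ : x₄ ≈ x₃
      x₄≈x₃ = vertical-≈ x₄ y₄ x₃ y₃ l₂ P∈l₂ (to X₄ x₄ y₄ l₂ ∼₄ X₄∈l₂) (to X₃ x₃ y₃ l₂ ∼₃ X₃∈l₂)
      same-vertical : x₁ ≈ x₃ → affine x₁ y₁ on l₂
      same-vertical x₁≈x₃ = on-affine x₁ y₁ l₂ (combine₃ {coords l₂ 0F * x₁ + coords l₂ 1F * y₁ + coords l₂ 2F} {0#}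
        1# (coords l₂ 0F) (y₁ - y₃) (affine-on x₃ y₃ l₂ (to X₃ x₃ y₃ l₂ ∼₃ X₃∈l₂)) x₁≈x₃ (T∞-on l₂ P∈l₂) (ringIdentity 7 (λ a b c d e f g → a :* b :+ c :* d :+ e :- :0 := :1 :* (a :* f :+ c :* g :+ e
              :- :0) :+ a :* (b :- f) :+ (d :- g) :* (c :- :0)) (_ ∷ _ ∷ _ ∷ _ ∷ _ ∷ _ ∷ _ ∷ [])))

  sloped : Carrier → Carrier → Line
  sloped M K = homogeneous M (- 1#) K 1F (-‿≉0 1≉0)

  on-sloped : ∀ x y M K → y ≈ M * x + K → affine x y on sloped M K
  on-sloped x y M K eq = on-affine x y (sloped M K) (combine₁ {M * x + - 1# * y + K} {0#} (- 1#) eq (ringIdentity 4 (λ a b c d → a :* b :+ (:- :1) :* c :+ d :- :0 := (:- :1) :* (c :- (a :* b :+ d))) (_ ∷ _ ∷ _ ∷ _ ∷ [])))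

  sloped-on : ∀ x y M K → affine x y on sloped M K → y ≈ M * x + K
  sloped-on x y M K P∈l = combine₁ {y} {M * x + K} (- 1#) (affine-on x y (sloped M K) P∈l) (ringIdentity 4 (λ a b c d → a :- (b :* c :+ d) := (:- :1) :* (b :* c :+ (:- :1) :* a :+ d :-
        :0)) (_ ∷ _ ∷ _ ∷ _ ∷ []))

  -- On the parabola `y = a x²`, which lies in the unital, the chord between abscissae `x₁` and `x₂`
  -- meets `x = 0` at height `- a x₁ x₂`. The abscissae ±1 and ±1/a thus give chords through
  -- `(0 , 1)` and `(0 , -1)`, both on the unital. They are distinct because `a` is not ±1, whose
  -- norm is the square 1.
  O'Nan-at-affine : ∀ a → a ≉ 0# → ¬ SquareNorm a → ∀ Q s t → Q ∼ affine s t → Fixed (t - curve a 0# s) →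
    ONanAt (𝓤 a 0#) Q
  O'Nan-at-affine a a≉0 nonsquare Q s t Q∼ f = record
    { X₁ = pt 1# a ; X₂ = pt (- j) j ; X₃ = pt j j ; X₄ = pt (- 1#) a ; X₅ = pt 0# (- 1#)
    ; l₁ = ln (a - 1#) 1# ; l₂ = ln (- (a - 1#)) 1# ; l₃ = ln (a + 1#) (- 1#) ; l₄ = ln (- (a + 1#)) (- 1#)
    ; X₁∈S = pt∈ 1# a 0# bar-0 (ringIdentity 1 (λ a → a :- a :* (:1 :* :1) := :0) (_ ∷ []))
    ; X₂∈S = pt∈ (- j) j 0# bar-0 (combine₁ {j - a * (- j * - j)} {0#} (- j) ja≈1 (ringIdentity 2 (λ a b → a :- b :* ((:- a) :* (:- a)) :- :0 := (:- a) :* (a :* b :- :1)) (_ ∷ _ ∷ [])))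
    ; X₃∈S = pt∈ j j 0# bar-0 (combine₁ {j - a * (j * j)} {0#} (- j) ja≈1 (ringIdentity 2 (λ a b → a :- b :* (a :* a) :- :0 := (:- a) :* (a :* b :- :1)) (_ ∷ _ ∷ [])))
    ; X₄∈S = pt∈ (- 1#) a 0# bar-0 (ringIdentity 1 (λ a → a :- a :* ((:- :1) :* (:- :1)) := :0) (_ ∷ []))
    ; X₅∈S = pt∈ 0# (- 1#) (- 1#) (fixed-neg bar-1) (ringIdentity 1 (λ a → :- :1 :- a :* (:0 :* :0) := :- :1) (_ ∷ []))
    ; P∈l₁ = Q-on (a - 1#) 1# (ringIdentity 0 (:1 := :1) ([]))
    ; X₁∈l₁ = pt-on 1# a (a - 1#) 1# (ringIdentity 1 (λ a → a := (a :- :1) :* :1 :+ :1) (_ ∷ []))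
    ; X₂∈l₁ = pt-on (- j) j (a - 1#) 1# (combine₁ {j} {(a - 1#) * - j + 1#} 1# ja≈1 (ringIdentity 2 (λ a b → a :- ((b :- :1) :* (:- a) :+ :1) := :1 :* (a :* b :- :1)) (_ ∷ _ ∷ [])))
    ; P∈l₂ = Q-on (- (a - 1#)) 1# (ringIdentity 0 (:1 := :1) ([]))
    ; X₃∈l₂ = pt-on j j (- (a - 1#)) 1# (combine₁ {j} { - (a - 1#) * j + 1#} 1# ja≈1 (ringIdentity 2 (λ a b → a :- ((:- (b :- :1)) :* a :+ :1) := :1 :* (a :* b :- :1)) (_ ∷ _ ∷ [])))
    ; X₄∈l₂ = pt-on (- 1#) a (- (a - 1#)) 1# (ringIdentity 1 (λ a → a := (:- (a :- :1)) :* (:- :1) :+ :1) (_ ∷ []))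
    ; X₁∈l₃ = pt-on 1# a (a + 1#) (- 1#) (ringIdentity 1 (λ a → a := (a :+ :1) :* :1 :- :1) (_ ∷ []))
    ; X₃∈l₃ = pt-on j j (a + 1#) (- 1#) (combine₁ {j} {(a + 1#) * j + - 1#} (- 1#) ja≈1 (ringIdentity 2 (λ a b → a :- ((b :+ :1) :* a :- :1) := (:- :1) :* (a :* b :- :1)) (_ ∷ _ ∷ [])))
    ; X₅∈l₃ = pt-on 0# (- 1#) (a + 1#) (- 1#) (ringIdentity 1 (λ a → :- :1 := (a :+ :1) :* :0 :- :1) (_ ∷ []))
    ; X₂∈l₄ = pt-on (- j) j (- (a + 1#)) (- 1#) (combine₁ {j} { - (a + 1#) * - j + - 1#} (- 1#) ja≈1 (ringIdentity 2 (λ a b → a :- ((:- (b :+ :1)) :* (:- a) :- :1) := (:- :1) :* (a :* b :- :1)) (_ ∷ _ ∷ [])))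
    ; X₄∈l₄ = pt-on (- 1#) a (- (a + 1#)) (- 1#) (ringIdentity 1 (λ a → a := (:- (a :+ :1)) :* (:- :1) :- :1) (_ ∷ []))
    ; X₅∈l₄ = pt-on 0# (- 1#) (- (a + 1#)) (- 1#) (ringIdentity 1 (λ a → :- :1 := (:- (a :+ :1)) :* :0 :- :1) (_ ∷ []))
    ; P∉l₃ = λ P∈ → Q-off (a + 1#) P∈
    ; P∉l₄ = λ P∈ → Q-off (- (a + 1#)) P∈
    ; X₁∉l₄ = λ P∈ → a+1≉0 (*-cancel-0 {1# + 1#} {a + 1#} 2≉0
        (combine₁ {(1# + 1#) * (a + 1#)} {0#} 1# (pt-off 1# a (- (a + 1#)) (- 1#) P∈) (ringIdentity 1 (λ a → (:1 :+ :1) :* (a :+ :1) :- :0 := :1 :* (a :- ((:- (a :+ :1)) :* :1 :-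
              :1))) (_ ∷ []))))
    ; X₄∉l₃ = λ P∈ → a+1≉0 (*-cancel-0 {1# + 1#} {a + 1#} 2≉0
        (combine₁ {(1# + 1#) * (a + 1#)} {0#} 1# (pt-off (- 1#) a (a + 1#) (- 1#) P∈) (ringIdentity 1 (λ a → (:1 :+ :1) :* (a :+ :1) :- :0 := :1 :* (a :- ((a :+ :1) :* (:- :1) :-
              :1))) (_ ∷ []))))
    ; X₁∉l₂ = λ P∈ → a-1≉0 (*-cancel-0 {1# + 1#} {a - 1#} 2≉0
        (combine₁ {(1# + 1#) * (a - 1#)} {0#} 1# (pt-off 1# a (- (a - 1#)) 1# P∈) (ringIdentity 1 (λ a → (:1 :+ :1) :* (a :- :1) :- :0 := :1 :* (a :- ((:- (a :- :1)) :* :1 :+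
              :1))) (_ ∷ []))))
    }
    where
    j = a ⁻¹
    ja≈1 : j * a ≈ 1#
    ja≈1 = ⁻¹-inverse a≉0
    a-1≉0 : a - 1# ≉ 0#
    a-1≉0 eq = nonsquare (1# , bar-1 , norm-1 (bar a) a≈1 (trans (bar-cong a≈1) bar-1))
      where
      a≈1 : a ≈ 1#
      a≈1 = combine₁ {a} {1#} 1# eq (ringIdentity 1 (λ a → a :- :1 := :1 :* (a :- :1 :- :0)) (_ ∷ []))
      norm-1 : ∀ ā → a ≈ 1# → ā ≈ 1# → 1# * 1# ≈ a * ā
      norm-1 ā e e′ = sym (*-cong e e′)
    a+1≉0 : a + 1# ≉ 0#
    a+1≉0 eq = nonsquare (1# , bar-1 , norm-1 (bar a) a≈-1 (trans (bar-cong a≈-1) (trans (bar-neg 1#) (-‿cong bar-1))))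
      where
      a≈-1 : a ≈ - 1#
      a≈-1 = combine₁ {a} { - 1#} 1# eq (ringIdentity 1 (λ a → a :- (:- :1) := :1 :* (a :+ :1 :- :0)) (_ ∷ []))
      norm-1 : ∀ ā → a ≈ - 1# → ā ≈ - 1# → 1# * 1# ≈ a * ā
      norm-1 ā e e′ = trans (ringIdentity 0 (:1 :* :1 := (:- :1) :* (:- :1)) ([])) (sym (*-cong e e′))

    -- The translation of the unital that moves (0 , 1) to (s , t).
    X Y : Carrier → Carrier → Carrier
    X x y = x + s
    Y x y = y + (1# + 1#) * a * s * x + t - 1#
    pt : Carrier → Carrier → Point
    pt x y = affine (X x y) (Y x y)
    slope′ intercept′ : Carrier → Carrier → Carrier
    slope′ M K = M + (1# + 1#) * a * s
    intercept′ M K = K - slope′ M K * s + t - 1#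
    ln : Carrier → Carrier → Line
    ln M K = sloped (slope′ M K) (intercept′ M K)
    pt-on : ∀ x y M K → y ≈ M * x + K → pt x y on ln M K
    pt-on x y M K eq = on-sloped (X x y) (Y x y) (slope′ M K) (intercept′ M K)
      (combine₁ {Y x y} {slope′ M K * X x y + intercept′ M K} 1# eq (ringIdentity 7 (λ a b c d e f g → a :+ (:1 :+ :1) :* b :* c :* d :+ e :- :1 :- ((f :+ (:1 :+
            :1) :* b :* c) :* (d :+ c) :+ (g :- (f :+ (:1 :+ :1) :* b :* c) :* c :+ e :- :1)) := :1
            :* (a :- (f :* d :+ g))) (_ ∷ _ ∷ _ ∷ _ ∷ _ ∷ _ ∷ _ ∷ [])))
    pt-off : ∀ x y M K → pt x y on ln M K → y ≈ M * x + K
    pt-off x y M K P∈l = combine₁ {y} {M * x + K} 1# (sloped-on (X x y) (Y x y) (slope′ M K) (intercept′ M K) P∈l) (ringIdentity 7 (λ a b c d e f g → a :- (b :* c :+ d) := :1 :* (a :+ (:1 :+ :1) :* e :* f :* c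
          :+ g :- :1 :- ((b :+ (:1 :+ :1) :* e :* f) :* (c :+ f) :+ (d :- (b :+ (:1 :+ :1) :* e
          :* f) :* f :+ g :- :1)))) (_ ∷ _ ∷ _ ∷ _ ∷ _ ∷ _ ∷ _ ∷ []))
    pt∈ : ∀ x y r → Fixed r → y - a * (x * x) ≈ r → 𝓤 a 0# (pt x y)
    pt∈ x y r fr eq = 𝓤-affine a 0# (pt x y) (X x y) (Y x y) (∼-refl (pt x y))
      (fixed-cong {r + (t - curve a 0# s) - 1#} {Y x y - curve a 0# (X x y)}
        (moved (bar s) (bar (X x y))) (fixed-- {r + (t - curve a 0# s)} {1#} (fixed-+ {r} {t - curve a 0# s} fr f) bar-1))
      where
      moved : ∀ s̄ X̄ → r + (t - (a * (s * s) + 0# * (s * s̄))) - 1# ≈ Y x y - (a * (X x y * X x y) + 0# * (X x y * X̄))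
      moved s̄ X̄ = combine₁ {r + (t - (a * (s * s) + 0# * (s * s̄))) - 1#} {Y x y - (a * (X x y * X x y) + 0# * (X x y * X̄))}
        (- 1#) eq (ringIdentity 8 (λ a b c d e f g h → a :+ (b :- (c :* (d :* d) :+ :0 :* (d :* e))) :- :1 :- (f
              :+ (:1 :+ :1) :* c :* d :* g :+ b :- :1 :- (c :* ((g :+ d) :* (g :+ d)) :+ :0 :* ((g
              :+ d) :* h))) := (:- :1) :* (f :- c :* (g :* g) :- a)) (_ ∷ _ ∷ _ ∷ _ ∷ _ ∷ _ ∷ _ ∷ _ ∷ []))
    Q∼′ : ∀ M K → t ≈ slope′ M K * s + intercept′ M K → Q on ln M K
    Q∼′ M K eq = on-cong Q (affine s t) (ln M K) Q∼ (on-sloped s t (slope′ M K) (intercept′ M K) eq)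
    Q-on : ∀ M K → 1# ≈ K → Q on ln M K
    Q-on M K eq = Q∼′ M K (combine₁ {t} {slope′ M K * s + intercept′ M K} 1# eq (ringIdentity 5 (λ a b c d e → a :- ((b :+ (:1 :+ :1) :* c :* d) :* d :+ (e :- (b :+ (:1 :+ :1)
          :* c :* d) :* d :+ a :- :1)) := :1 :* (:1 :- e)) (_ ∷ _ ∷ _ ∷ _ ∷ _ ∷ [])))
    Q-off : ∀ M → ¬ Q on ln M (- 1#)
    Q-off M Q∈l = 2≉0 (combine₁ {1# + 1#} {0#} 1#
      (sloped-on s t (slope′ M (- 1#)) (intercept′ M (- 1#)) (on-cong (affine s t) Q (ln M (- 1#)) (∼-sym Q (affine s t) Q∼) Q∈l)) (ringIdentity 4 (λ a b c d → :1 :+ :1 :- :0 := :1 :* (a :- ((b :+ (:1 :+ :1) :* c :* d) :* d :+ (:- :1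
            :- (b :+ (:1 :+ :1) :* c :* d) :* d :+ a :- :1)))) (_ ∷ _ ∷ _ ∷ _ ∷ [])))

  -- Special configurations and their transport by automorphisms

  -- The quadrangle is `A`, `B`, `C`, `E` with `P` on the side `AB`; the diagonal points on `AB`,
  -- `AC` and `AE` are `D`, `D₁` and `D₂`. As before, nondegeneracy is stated by non-incidence.
  record SpecialAt (S : PointSet) (P : Point) : Set (c Level.⊔ ℓ₁ Level.⊔ ℓ₂) where
    field
      A B C E D D₁ D₂ : Point
      AB CE AC BE AE BC : Line
      A∈S : S A
      B∈S : S B
      C∈S : S C
      E∈S : S E
      D∈S : S D
      D₁∈S : S D₁
      D₂∈S : S D₂
      P∈AB : P on AB
      A∈AB : A on AB
      B∈AB : B on AB
      D∈AB : D on AB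
      C∈CE : C on CE
      E∈CE : E on CE
      D∈CE : D on CE
      A∈AC : A on AC
      C∈AC : C on AC
      D₁∈AC : D₁ on AC
      B∈BE : B on BE
      E∈BE : E on BE
      D₁∈BE : D₁ on BE
      A∈AE : A on AE
      E∈AE : E on AE
      D₂∈AE : D₂ on AE
      B∈BC : B on BC
      C∈BC : C on BC
      D₂∈BC : D₂ on BC
      C∉AB : ¬ C on AB
      E∉AB : ¬ E on AB
      A∉CE : ¬ A on CE
      B∉CE : ¬ B on CE
      B∉AC : ¬ B on AC
      E∉AC : ¬ E on AC
      A∉BE : ¬ A on BE
      C∉BE : ¬ C on BE
      B∉AE : ¬ B on AE
      C∉AE : ¬ C on AE
      A∉BC : ¬ A on BC
      E∉BC : ¬ E on BC

  -- The vertices are relabelled so that the side through T∞ becomes `AB`; there are six sides and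
  -- hence six relabellings.
  flatten : ∀ S → (t : TripleO'Nan S) → BMSpecial t → SpecialAt S T∞
  flatten S t (π , s , T∈) = cases π s T∈
    where
    open TripleO'Nan t
    build : ∀ i j k l → i ≢ j → i ≢ k → i ≢ l → j ≢ k → j ≢ l → k ≢ l → (m₁ m₂ m₃ m₄ m₅ m₆ : Line) →
      T∞ on m₁ → vertex i on m₁ × vertex j on m₁ → vertex k on m₂ × vertex l on m₂ →
      vertex i on m₃ × vertex k on m₃ → vertex j on m₄ × vertex l on m₄ →
      vertex i on m₅ × vertex l on m₅ → vertex j on m₆ × vertex k on m₆ →
      (∃[ M ] S M × M on m₁ × M on m₂) → (∃[ M ] S M × M on m₃ × M on m₄) → (∃[ M ] S M × M on m₅ × M on m₆) →
      SpecialAt S T∞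
    build i j k l i≢j i≢k i≢l j≢k j≢l k≢l m₁ m₂ m₃ m₄ m₅ m₆ T∈ (A∈AB , B∈AB) (C∈CE , E∈CE)
      (A∈AC , C∈AC) (B∈BE , E∈BE) (A∈AE , E∈AE) (B∈BC , C∈BC)
      (D , D∈S , D∈AB , D∈CE) (D₁ , D₁∈S , D₁∈AC , D₁∈BE) (D₂ , D₂∈S , D₂∈AE , D₂∈BC) = record
      { A = vertex i ; B = vertex j ; C = vertex k ; E = vertex l ; D = D ; D₁ = D₁ ; D₂ = D₂
      ; AB = m₁ ; CE = m₂ ; AC = m₃ ; BE = m₄ ; AE = m₅ ; BC = m₆
      ; A∈S = vertex∈ i ; B∈S = vertex∈ j ; C∈S = vertex∈ k ; E∈S = vertex∈ l ; D∈S = D∈S ; D₁∈S = D₁∈S ; D₂∈S = D₂∈S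
      ; P∈AB = T∈ ; A∈AB = A∈AB ; B∈AB = B∈AB ; D∈AB = D∈AB ; C∈CE = C∈CE ; E∈CE = E∈CE ; D∈CE = D∈CE
      ; A∈AC = A∈AC ; C∈AC = C∈AC ; D₁∈AC = D₁∈AC ; B∈BE = B∈BE ; E∈BE = E∈BE ; D₁∈BE = D₁∈BE
      ; A∈AE = A∈AE ; E∈AE = E∈AE ; D₂∈AE = D₂∈AE ; B∈BC = B∈BC ; C∈BC = C∈BC ; D₂∈BC = D₂∈BC
      ; C∉AB = λ C∈ → ijk (m₁ , A∈AB , B∈AB , C∈)
      ; E∉AB = λ E∈ → ijl (m₁ , A∈AB , B∈AB , E∈)
      ; A∉CE = λ A∈ → ikl (m₂ , A∈ , C∈CE , E∈CE)
      ; B∉CE = λ B∈ → jkl (m₂ , B∈ , C∈CE , E∈CE)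
      ; B∉AC = λ B∈ → ijk (m₃ , A∈AC , B∈ , C∈AC)
      ; E∉AC = λ E∈ → ikl (m₃ , A∈AC , C∈AC , E∈)
      ; A∉BE = λ A∈ → ijl (m₄ , A∈ , B∈BE , E∈BE)
      ; C∉BE = λ C∈ → jkl (m₄ , B∈BE , C∈ , E∈BE)
      ; B∉AE = λ B∈ → ijl (m₅ , A∈AE , B∈ , E∈AE)
      ; C∉AE = λ C∈ → ikl (m₅ , A∈AE , C∈ , E∈AE)
      ; A∉BC = λ A∈ → ijk (m₆ , A∈ , B∈BC , C∈BC)
      ; E∉BC = λ E∈ → jkl (m₆ , B∈BC , C∈BC , E∈)
      }
      where
      ijk = quadrangle i j k i≢j j≢k i≢k
      ijl = quadrangle i j l i≢j j≢l i≢l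
      ikl = quadrangle i k l i≢k k≢l i≢l
      jkl = quadrangle j k l j≢k k≢l j≢l
    swap : ∀ {a b} {P : Set a} {Q : Set b} → P × Q → Q × P
    swap (x , y) = y , x
    swap-meet : ∀ π → ∃[ M ] S M × M on side π 1F × M on side π 0F
    swap-meet π = let M , M∈S , M∈l , M∈m = meet π in M , M∈S , M∈m , M∈l
    cases : ∀ π s → T∞ on side π s → SpecialAt S T∞
    cases 0F 0F T∈ = build 0F 1F 2F 3F (λ ()) (λ ()) (λ ()) (λ ()) (λ ()) (λ ())
      (side 0F 0F) (side 0F 1F) (side 1F 0F) (side 1F 1F) (side 2F 0F) (side 2F 1F) T∈
      (joins 0F 0F) (joins 0F 1F) (joins 1F 0F) (joins 1F 1F) (joins 2F 0F) (joins 2F 1F)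
      (meet 0F) (meet 1F) (meet 2F)
    cases 0F 1F T∈ = build 2F 3F 0F 1F (λ ()) (λ ()) (λ ()) (λ ()) (λ ()) (λ ())
      (side 0F 1F) (side 0F 0F) (side 1F 0F) (side 1F 1F) (side 2F 1F) (side 2F 0F) T∈
      (joins 0F 1F) (joins 0F 0F) (swap (joins 1F 0F)) (swap (joins 1F 1F)) (swap (joins 2F 1F)) (swap (joins 2F 0F))
      (swap-meet 0F) (meet 1F) (swap-meet 2F)
    cases 1F 0F T∈ = build 0F 2F 1F 3F (λ ()) (λ ()) (λ ()) (λ ()) (λ ()) (λ ())
      (side 1F 0F) (side 1F 1F) (side 0F 0F) (side 0F 1F) (side 2F 0F) (side 2F 1F) T∈
      (joins 1F 0F) (joins 1F 1F) (joins 0F 0F) (joins 0F 1F) (joins 2F 0F) (swap (joins 2F 1F))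
      (meet 1F) (meet 0F) (meet 2F)
    cases 1F 1F T∈ = build 1F 3F 0F 2F (λ ()) (λ ()) (λ ()) (λ ()) (λ ()) (λ ())
      (side 1F 1F) (side 1F 0F) (side 0F 0F) (side 0F 1F) (side 2F 1F) (side 2F 0F) T∈
      (joins 1F 1F) (joins 1F 0F) (swap (joins 0F 0F)) (swap (joins 0F 1F)) (joins 2F 1F) (swap (joins 2F 0F))
      (swap-meet 1F) (meet 0F) (swap-meet 2F)
    cases 2F 0F T∈ = build 0F 3F 1F 2F (λ ()) (λ ()) (λ ()) (λ ()) (λ ()) (λ ())
      (side 2F 0F) (side 2F 1F) (side 0F 0F) (side 0F 1F) (side 1F 0F) (side 1F 1F) T∈
      (joins 2F 0F) (joins 2F 1F) (joins 0F 0F) (swap (joins 0F 1F)) (joins 1F 0F) (swap (joins 1F 1F))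
      (meet 2F) (meet 0F) (meet 1F)
    cases 2F 1F T∈ = build 1F 2F 0F 3F (λ ()) (λ ()) (λ ()) (λ ()) (λ ()) (λ ())
      (side 2F 1F) (side 2F 0F) (side 0F 0F) (side 0F 1F) (side 1F 1F) (side 1F 0F) T∈
      (joins 2F 1F) (joins 2F 0F) (swap (joins 0F 0F)) (joins 0F 1F) (joins 1F 1F) (swap (joins 1F 0F))
      (swap-meet 2F) (meet 0F) (swap-meet 1F)

  module _ {S T : PointSet} (f : Point → Point) (g : Line → Line)
    (on⇒ : ∀ P l → P on l → f P on g l) (⇒on : ∀ P l → f P on g l → P on l)
    (∈⇒ : ∀ P → S P → T (f P)) where

    transport-O'Nan : ∀ {P Q} → Q ∼ f P → ONanAt S P → ONanAt T Q
    transport-O'Nan {P} {Q} Q∼fP o = record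
      { X₁ = f X₁ ; X₂ = f X₂ ; X₃ = f X₃ ; X₄ = f X₄ ; X₅ = f X₅
      ; l₁ = g l₁ ; l₂ = g l₂ ; l₃ = g l₃ ; l₄ = g l₄
      ; X₁∈S = ∈⇒ X₁ X₁∈S ; X₂∈S = ∈⇒ X₂ X₂∈S ; X₃∈S = ∈⇒ X₃ X₃∈S ; X₄∈S = ∈⇒ X₄ X₄∈S ; X₅∈S = ∈⇒ X₅ X₅∈S
      ; P∈l₁ = on-cong Q (f P) (g l₁) Q∼fP (on⇒ P l₁ P∈l₁)
      ; X₁∈l₁ = on⇒ X₁ l₁ X₁∈l₁ ; X₂∈l₁ = on⇒ X₂ l₁ X₂∈l₁
      ; P∈l₂ = on-cong Q (f P) (g l₂) Q∼fP (on⇒ P l₂ P∈l₂)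
      ; X₃∈l₂ = on⇒ X₃ l₂ X₃∈l₂ ; X₄∈l₂ = on⇒ X₄ l₂ X₄∈l₂
      ; X₁∈l₃ = on⇒ X₁ l₃ X₁∈l₃ ; X₃∈l₃ = on⇒ X₃ l₃ X₃∈l₃ ; X₅∈l₃ = on⇒ X₅ l₃ X₅∈l₃
      ; X₂∈l₄ = on⇒ X₂ l₄ X₂∈l₄ ; X₄∈l₄ = on⇒ X₄ l₄ X₄∈l₄ ; X₅∈l₄ = on⇒ X₅ l₄ X₅∈l₄
      ; P∉l₃ = P∉l₃ ∘ ⇒on P l₃ ∘ on-cong (f P) Q (g l₃) (∼-sym Q (f P) Q∼fP)
      ; P∉l₄ = P∉l₄ ∘ ⇒on P l₄ ∘ on-cong (f P) Q (g l₄) (∼-sym Q (f P) Q∼fP)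
      ; X₁∉l₄ = X₁∉l₄ ∘ ⇒on X₁ l₄
      ; X₄∉l₃ = X₄∉l₃ ∘ ⇒on X₄ l₃
      ; X₁∉l₂ = X₁∉l₂ ∘ ⇒on X₁ l₂
      }
      where open ONanAt o

    transport-special : ∀ {P Q} → Q ∼ f P → SpecialAt S P → SpecialAt T Q
    transport-special {P} {Q} Q∼fP t = record
      { A = f A ; B = f B ; C = f C ; E = f E ; D = f D ; D₁ = f D₁ ; D₂ = f D₂
      ; AB = g AB ; CE = g CE ; AC = g AC ; BE = g BE ; AE = g AE ; BC = g BC
      ; A∈S = ∈⇒ A A∈S ; B∈S = ∈⇒ B B∈S ; C∈S = ∈⇒ C C∈S ; E∈S = ∈⇒ E E∈S
      ; D∈S = ∈⇒ D D∈S ; D₁∈S = ∈⇒ D₁ D₁∈S ; D₂∈S = ∈⇒ D₂ D₂∈S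
      ; P∈AB = on-cong Q (f P) (g AB) Q∼fP (on⇒ P AB P∈AB)
      ; A∈AB = on⇒ A AB A∈AB ; B∈AB = on⇒ B AB B∈AB ; D∈AB = on⇒ D AB D∈AB
      ; C∈CE = on⇒ C CE C∈CE ; E∈CE = on⇒ E CE E∈CE ; D∈CE = on⇒ D CE D∈CE
      ; A∈AC = on⇒ A AC A∈AC ; C∈AC = on⇒ C AC C∈AC ; D₁∈AC = on⇒ D₁ AC D₁∈AC
      ; B∈BE = on⇒ B BE B∈BE ; E∈BE = on⇒ E BE E∈BE ; D₁∈BE = on⇒ D₁ BE D₁∈BE
      ; A∈AE = on⇒ A AE A∈AE ; E∈AE = on⇒ E AE E∈AE ; D₂∈AE = on⇒ D₂ AE D₂∈AE
      ; B∈BC = on⇒ B BC B∈BC ; C∈BC = on⇒ C BC C∈BC ; D₂∈BC = on⇒ D₂ BC D₂∈BC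
      ; C∉AB = C∉AB ∘ ⇒on C AB ; E∉AB = E∉AB ∘ ⇒on E AB
      ; A∉CE = A∉CE ∘ ⇒on A CE ; B∉CE = B∉CE ∘ ⇒on B CE
      ; B∉AC = B∉AC ∘ ⇒on B AC ; E∉AC = E∉AC ∘ ⇒on E AC
      ; A∉BE = A∉BE ∘ ⇒on A BE ; C∉BE = C∉BE ∘ ⇒on C BE
      ; B∉AE = B∉AE ∘ ⇒on B AE ; C∉AE = C∉AE ∘ ⇒on C AE
      ; A∉BC = A∉BC ∘ ⇒on A BC ; E∉BC = E∉BC ∘ ⇒on E BC
      }
      where open SpecialAt t

  -- O'Nan configurations distinguish T∞ from the affine points of the conic
  -- unital, so the equivalence fixes T∞.
  special-transfers : ∀ {a b a′} → Admissible a b → a′ ≉ 0# → ¬ SquareNorm a′ →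
    Equivalent (𝓤 a b) (𝓤 a′ 0#) → SpecialAt (𝓤 a b) T∞ → SpecialAt (𝓤 a′ 0#) T∞
  special-transfers {a} {b} {a′} adm a′≉0 nonsquare (φ , ∈⇔) special =
    transport-special {𝓤 a b} {𝓤 a′ 0#} f g (λ P l → Equivalence.to (incidence P l)) (λ P l → Equivalence.from (incidence P l))
      (λ P → Equivalence.to (∈⇔ P)) {T∞} {T∞} (∼-sym (f T∞) T∞ f-T∞) special
    where
    open Automorphism φ
    f = Inverse.to onPoints
    g = Inverse.to onLines
    f⁻¹ = Inverse.from onPoints
    g⁻¹ = Inverse.from onLines
    ff⁻¹ : ∀ P → f (f⁻¹ P) ∼ P
    ff⁻¹ = Inverse.strictlyInverseˡ onPoints
    gg⁻¹ : ∀ l → g (g⁻¹ l) ∼ l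
    gg⁻¹ = Inverse.strictlyInverseˡ onLines
    on⇒ : ∀ P l → P on l → f⁻¹ P on g⁻¹ l
    on⇒ P l P∈l = Equivalence.from (incidence (f⁻¹ P) (g⁻¹ l)) (on-∼ (f (f⁻¹ P)) P (g (g⁻¹ l)) l (ff⁻¹ P) (gg⁻¹ l) P∈l)
    ⇒on : ∀ P l → f⁻¹ P on g⁻¹ l → P on l
    ⇒on P l P∈l = on-∼ P (f (f⁻¹ P)) l (g (g⁻¹ l)) (∼-sym (f (f⁻¹ P)) P (ff⁻¹ P)) (∼-sym (g (g⁻¹ l)) l (gg⁻¹ l))
      (Equivalence.to (incidence (f⁻¹ P) (g⁻¹ l)) P∈l)
    ∈⇒ : ∀ P → 𝓤 a′ 0# P → 𝓤 a b (f⁻¹ P)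
    ∈⇒ P P∈ = Equivalence.from (∈⇔ (f⁻¹ P)) (𝓤-∼ a′ 0# (f (f⁻¹ P)) P (ff⁻¹ P) P∈)
    f-T∞ : f T∞ ∼ T∞
    f-T∞ = [ (λ (x , y , ∼xy , fy) → contradiction
        (transport-O'Nan {𝓤 a′ 0#} {𝓤 a b} f⁻¹ g⁻¹ on⇒ ⇒on ∈⇒ {f T∞} {T∞}
          (∼-sym (f⁻¹ (f T∞)) T∞ (Inverse.strictlyInverseʳ onPoints T∞))
          (O'Nan-at-affine a′ a′≉0 nonsquare (f T∞) x y ∼xy fy))
        (no-O'Nan-at-T∞ {a} {b} adm)) , (λ ∼T∞ → ∼T∞) ]′
      (𝓤-cases a′ 0# (f T∞) (Equivalence.to (∈⇔ T∞) (T∞∈𝓤 a b)))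

  -- Nonexistence for conic unitals with q = 3 and q = 5

  bar-3 : q ≡ 3 → ∀ x → bar x ≈ x * (x * x)
  bar-3 q≡3 x = trans (sym (bar-def x)) (trans (^-congʳ x q≡3) (*-congˡ {x} (*-congˡ {x} (*-identityʳ x))))

  bar-5 : q ≡ 5 → ∀ x → bar x ≈ x * (x * x * (x * x))
  bar-5 q≡5 x = trans (sym (bar-def x)) (trans (^-congʳ x q≡5) (fifth x))
    where
    fifth : ∀ x → x * (x * (x * (x * (x * 1#)))) ≈ x * (x * x * (x * x))
    fifth x = (ringIdentity 1 (λ a → a :* (a :* (a :* (a :* (a :* :1)))) := a :* (a :* a :* (a :* a))) (_ ∷ []))

  3≈0 : q ≡ 3 → 1# + 1# + 1# ≈ 0#
  3≈0 q≡3 = trans (ringIdentity 0 (:1 :+ :1 :+ :1 := :1 :+ (:1 :+ (:1 :+ :0))) ([])) (trans (reflexive (≡.cong (_· 1#) (≡.sym q≡3))) q·1≈0)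

  5≈0 : q ≡ 5 → 1# + 1# + 1# + 1# + 1# ≈ 0#
  5≈0 q≡5 = trans (ringIdentity 0 (:1 :+ :1 :+ :1 :+ :1 :+ :1 := :1 :+ (:1 :+ (:1 :+ (:1 :+ (:1 :+ :0))))) ([])) (trans (reflexive (≡.cong (_· 1#) (≡.sym q≡5))) q·1≈0)

  square-3 : q ≡ 3 → ∀ {x} → Fixed x → x ≉ 0# → x * x ≈ 1#
  square-3 q≡3 {x} fx x≉0 = *-cancel-1 {x} {x * x} x≉0
    (trans (*-comm (x * x) x) (trans (sym (bar-3 q≡3 x)) fx))

  quartic : Carrier → Carrier
  quartic x = x * x * (x * x)

  quartic-5 : q ≡ 5 → ∀ {x} → Fixed x → x ≉ 0# → quartic x ≈ 1#
  quartic-5 q≡5 {x} fx x≉0 = *-cancel-1 {x} {quartic x} x≉0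
    (trans (*-comm (quartic x) x) (trans (sym (bar-5 q≡5 x)) fx))

  no-subline₀ : ∀ {a} → Admissible a 0# → ∀ m z w l → Fixed (m * z - a * (z * z)) → Fixed (m * w - a * (w * w)) →
    Fixed l → w ≈ l * z → z ≉ 0# → w ≉ 0# → w ≉ z → ⊥
  no-subline₀ {a} adm m z w l fz fw = no-subline {a} {0#} adm m 0# z w l (shifted z fz) (shifted w fw)
    where
    shifted : ∀ z → Fixed (m * z - a * (z * z)) → Fixed (m * z - (curve a 0# (0# + z) - curve a 0# 0#))
    shifted z f = fixed-cong {m * z - a * (z * z)} {m * z - (curve a 0# (0# + z) - curve a 0# 0#)}
      (expand (bar (0# + z)) (bar 0#)) f
      where
      expand : ∀ s t → m * z - a * (z * z) ≈
        m * z - (a * ((0# + z) * (0# + z)) + 0# * ((0# + z) * s) - (a * (0# * 0#) + 0# * (0# * t)))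
      expand s t = (ringIdentity 5 (λ a b c d e → a :* b :- c :* (b :* b) := a :* b :- (c :* ((:0 :+ b) :* (:0 :+ b))
            :+ :0 :* ((:0 :+ b) :* d) :- (c :* (:0 :* :0) :+ :0 :* (:0 :* e)))) (_ ∷ _ ∷ _ ∷ _ ∷ _ ∷ []))

  -- The dual coordinates u, v, w₁, w₂ of the four points off the special
  -- line, r and s the heights on it, relative to the diagonal point.
  module _ {a : Carrier} (adm : Admissible a 0#) (nonsquare : ¬ SquareNorm a)
    (m u v w₁ w₂ ξ₃ ξ₄ ξ₅ ξ₆ r s : Carrier) (fr : Fixed r) (fs : Fixed s)
    (r≉0 : r ≉ 0#) (s≉0 : s ≉ 0#) (s-r≉0 : s - r ≉ 0#)
    (uξ₃≈1 : u * ξ₃ ≈ 1#) (vξ₄≈1 : v * ξ₄ ≈ 1#) (w₁ξ₅≈1 : w₁ * ξ₅ ≈ 1#) (w₂ξ₆≈1 : w₂ * ξ₆ ≈ 1#)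
    (ξ₄≉ξ₃ : ξ₄ ≉ ξ₃)
    (w₁≈ : (s - r) * w₁ ≈ s * v - r * u) (w₂≈ : (s - r) * w₂ ≈ s * u - r * v)
    (f₃ : Fixed (m * ξ₃ - a * (ξ₃ * ξ₃))) (f₄ : Fixed (m * ξ₄ - a * (ξ₄ * ξ₄)))
    (f₅ : Fixed ((m - r * u) * ξ₅ - a * (ξ₅ * ξ₅))) (f₆ : Fixed ((m - r * v) * ξ₆ - a * (ξ₆ * ξ₆)))
    where
    private
      inverse≉0ʳ : ∀ {x y} → x * y ≈ 1# → y ≉ 0#
      inverse≉0ʳ {x} {y} xy≈1 = *≉0ʳ {x} {y} (λ eq → 1≉0 (trans (sym xy≈1) eq))

      subline : ∀ l → Fixed l → ξ₄ ≈ l * ξ₃ → ⊥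
      subline l fl eq = no-subline₀ {a} adm m ξ₃ ξ₄ l f₃ f₄ fl eq (inverse≉0ʳ uξ₃≈1) (inverse≉0ʳ vξ₄≈1) ξ₄≉ξ₃

    -- Now `w₁ = w₂ = (u + v) / 2`, so the two diagonal points off the special side have the same
    -- abscissa. The difference of their conditions shows that
    -- `φ = (v - u) ξ₅ = 2 (v - u) / (u + v)` is fixed, and with it
    -- `ξ₄ / ξ₃ = u / v = (2 - φ) / (2 + φ)`, against `no-subline₀`.
    harmonic-case : s ≈ - r → ⊥
    harmonic-case s≈-r = subline (((1# + 1#) - φ) * ((1# + 1#) + φ) ⁻¹)
      (fixed-* {(1# + 1#) - φ} {((1# + 1#) + φ) ⁻¹} (fixed-- {1# + 1#} {φ} f2 fφ)
        (fixed-⁻¹ {(1# + 1#) + φ} 2+φ≉0 (fixed-+ {1# + 1#} {φ} f2 fφ)))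
      (combine₂ {ξ₄} {((1# + 1#) - φ) * ((1# + 1#) + φ) ⁻¹ * ξ₃} (- ξ₄) (- (((1# + 1#) + φ) ⁻¹))
        (⁻¹-inverse {(1# + 1#) + φ} 2+φ≉0) proportional (ringIdentity 6 (λ a b c d e f → a :- (:1 :+ :1 :- (b :- c) :* d) :* e :* f := (:- a) :* (e :* (:1
              :+ :1 :+ (b :- c) :* d) :- :1) :+ (:- e) :* ((:1 :+ :1 :- (b :- c) :* d) :* f :- (:1
              :+ :1 :+ (b :- c) :* d) :* a)) (_ ∷ _ ∷ _ ∷ _ ∷ _ ∷ _ ∷ [])))
      where
      φ = (v - u) * ξ₅
      f2 : Fixed (1# + 1#)
      f2 = fixed-+ {1#} {1#} bar-1 bar-1
      2w₁≈ : (1# + 1#) * w₁ ≈ u + v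
      2w₁≈ = combine₁ {(1# + 1#) * w₁} {u + v} 1# (*-cancel-0 {r} {(1# + 1#) * w₁ - (u + v)} r≉0
        (combine₂ {r * ((1# + 1#) * w₁ - (u + v))} {0#} (- 1#) (w₁ - v) w₁≈ s≈-r (ringIdentity 5 (λ a b c d e → a :* ((:1 :+ :1) :* b :- (c :+ d)) :- :0 := (:- :1) :* ((e :- a)
              :* b :- (e :* d :- a :* c)) :+ (b :- d) :* (e :- (:- a))) (_ ∷ _ ∷ _ ∷ _ ∷ _ ∷ [])))) (ringIdentity 3 (λ a b c → (:1 :+ :1) :* a :- (b :+ c) := :1 :* ((:1 :+ :1) :* a :- (b :+ c) :-
              :0)) (_ ∷ _ ∷ _ ∷ []))
      2w₂≈ : (1# + 1#) * w₂ ≈ u + v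
      2w₂≈ = combine₁ {(1# + 1#) * w₂} {u + v} 1# (*-cancel-0 {r} {(1# + 1#) * w₂ - (u + v)} r≉0
        (combine₂ {r * ((1# + 1#) * w₂ - (u + v))} {0#} (- 1#) (w₂ - u) w₂≈ s≈-r (ringIdentity 5 (λ a b c d e → a :* ((:1 :+ :1) :* b :- (c :+ d)) :- :0 := (:- :1) :* ((e :- a)
              :* b :- (e :* c :- a :* d)) :+ (b :- c) :* (e :- (:- a))) (_ ∷ _ ∷ _ ∷ _ ∷ _ ∷ [])))) (ringIdentity 3 (λ a b c → (:1 :+ :1) :* a :- (b :+ c) := :1 :* ((:1 :+ :1) :* a :- (b :+ c) :-
              :0)) (_ ∷ _ ∷ _ ∷ []))
      w₁≈w₂ : w₁ ≈ w₂
      w₁≈w₂ = combine₁ {w₁} {w₂} 1# (*-cancel-0 {1# + 1#} {w₁ - w₂} 2≉0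
        (combine₂ {(1# + 1#) * (w₁ - w₂)} {0#} 1# (- 1#) 2w₁≈ 2w₂≈ (ringIdentity 4 (λ a b c d → (:1 :+ :1) :* (a :- b) :- :0 := :1 :* ((:1 :+ :1) :* a :- (c :+ d))
              :+ (:- :1) :* ((:1 :+ :1) :* b :- (c :+ d))) (_ ∷ _ ∷ _ ∷ _ ∷ [])))) (ringIdentity 2 (λ a b → a :- b := :1 :* (a :- b :- :0)) (_ ∷ _ ∷ []))
      ξ₆≈ξ₅ : ξ₆ ≈ ξ₅
      ξ₆≈ξ₅ = combine₃ {ξ₆} {ξ₅} (- ξ₆) ξ₅ (ξ₅ * ξ₆) w₁ξ₅≈1 w₂ξ₆≈1 w₁≈w₂ (ringIdentity 4 (λ a b c d → a :- b := (:- a) :* (c :* b :- :1) :+ b :* (d :* a :- :1) :+ b :* a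
            :* (c :- d)) (_ ∷ _ ∷ _ ∷ _ ∷ []))
      f₆′ : Fixed ((m - r * v) * ξ₅ - a * (ξ₅ * ξ₅))
      f₆′ = fixed-cong {(m - r * v) * ξ₆ - a * (ξ₆ * ξ₆)} {(m - r * v) * ξ₅ - a * (ξ₅ * ξ₅)}
        (+-cong {(m - r * v) * ξ₆} (*-congˡ {m - r * v} ξ₆≈ξ₅) (-‿cong (*-congˡ {a} (*-cong {ξ₆} ξ₆≈ξ₅ ξ₆≈ξ₅)))) f₆
      frφ : Fixed (r * φ)
      frφ = fixed-cong {(m - r * u) * ξ₅ - a * (ξ₅ * ξ₅) - ((m - r * v) * ξ₅ - a * (ξ₅ * ξ₅))} {r * φ} (ringIdentity 6 (λ a b c d e f → (a :- b :* c) :* d :- e :* (d :* d) :- ((a :- b :* f) :* d :- e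
            :* (d :* d)) := b :* ((f :- c) :* d)) (_ ∷ _ ∷ _ ∷ _ ∷ _ ∷ _ ∷ []))
        (fixed-- {(m - r * u) * ξ₅ - a * (ξ₅ * ξ₅)} {(m - r * v) * ξ₅ - a * (ξ₅ * ξ₅)} f₅ f₆′)
      fφ : Fixed φ
      fφ = fixed-cong {r ⁻¹ * (r * φ)} {φ} (⁻¹-cancelˡ {r} r≉0 φ)
        (fixed-* {r ⁻¹} {r * φ} (fixed-⁻¹ {r} r≉0 fr) frφ)
      2v-2u≈ : (1# + 1#) * (v - u) ≈ φ * (u + v)
      2v-2u≈ = combine₂ {(1# + 1#) * (v - u)} {φ * (u + v)} (- ((1# + 1#) * (v - u))) φ w₁ξ₅≈1 2w₁≈ (ringIdentity 4 (λ a b c d → (:1 :+ :1) :* (a :- b) :- (a :- b) :* c :* (b :+ a) := (:- ((:1 :+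
            :1) :* (a :- b))) :* (d :* c :- :1) :+ (a :- b) :* c :* ((:1 :+ :1) :* d :- (b :+ a))) (_ ∷ _ ∷ _ ∷ _ ∷ []))
      proportional : ((1# + 1#) - φ) * ξ₃ ≈ ((1# + 1#) + φ) * ξ₄
      proportional = combine₃ {((1# + 1#) - φ) * ξ₃} {((1# + 1#) + φ) * ξ₄}
        (ξ₃ * ξ₄) (((1# + 1#) + φ) * ξ₄) (- (((1# + 1#) - φ) * ξ₃)) 2v-2u≈ uξ₃≈1 vξ₄≈1 (ringIdentity 5 (λ a b c d e → (:1 :+ :1 :- (a :- b) :* c) :* d :- (:1 :+ :1 :+ (a :- b) :* c)
              :* e := d :* e :* ((:1 :+ :1) :* (a :- b) :- (a :- b) :* c :* (b :+ a)) :+ (:1 :+ :1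
              :+ (a :- b) :* c) :* e :* (b :* d :- :1) :+ (:- ((:1 :+ :1 :- (a :- b) :* c) :* d))
              :* (a :* e :- :1)) (_ ∷ _ ∷ _ ∷ _ ∷ _ ∷ []))
      2+φ≉0 : (1# + 1#) + φ ≉ 0#
      2+φ≉0 eq = *-≉0 {1# + 1#} {1# + 1#} 2≉0 2≉0 (combine₂ {(1# + 1#) * (1# + 1#)} {0#} 1# 1# 2-φ≈0 eq (ringIdentity 3 (λ a b c → (:1 :+ :1) :* (:1 :+ :1) :- :0 := :1 :* (:1 :+ :1 :- (a :- b) :* c :-
            :0) :+ :1 :* (:1 :+ :1 :+ (a :- b) :* c :- :0)) (_ ∷ _ ∷ _ ∷ [])))
        where
        2-φ≈0 : (1# + 1#) - φ ≈ 0#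
        2-φ≈0 = *-cancel-0 {ξ₃} {(1# + 1#) - φ} (inverse≉0ʳ uξ₃≈1)
          (combine₂ {ξ₃ * ((1# + 1#) - φ)} {0#} 1# ξ₄ proportional eq (ringIdentity 5 (λ a b c d e → a :* (:1 :+ :1 :- (b :- c) :* d) :- :0 := :1 :* ((:1 :+ :1 :- (b
                :- c) :* d) :* a :- (:1 :+ :1 :+ (b :- c) :* d) :* e) :+ e :* (:1 :+ :1 :+ (b :- c)
                :* d :- :0)) (_ ∷ _ ∷ _ ∷ _ ∷ _ ∷ [])))

    case-3 : q ≡ 3 → ⊥
    -- Distinct nonzero elements of the field with three elements are opposite.
    case-3 q≡3 = harmonic-case (combine₁ {s} { - r} 1# (*-cancel-0 {s - r} {s + r} s-r≉0
      (combine₂ {(s - r) * (s + r)} {0#} 1# (- 1#) (square-3 q≡3 fs s≉0) (square-3 q≡3 fr r≉0) (ringIdentity 2 (λ a b → (a :- b) :* (a :+ b) :- :0 := :1 :* (a :* a :- :1) :+ (:- :1) :* (b :* b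
            :- :1)) (_ ∷ _ ∷ [])))) (ringIdentity 2 (λ a b → a :- (:- b) := :1 :* (a :+ b :- :0)) (_ ∷ _ ∷ [])))

    module _ (q≡5 : q ≡ 5) (h≈0 : r * r + s * s ≈ 0#) where
      private
        -- Multiplication by the norm of `w` turns `a ξ²` into `a w̄ ξ`, and `w̄ = w⁵` makes this
        -- `a w⁴`: for q = 5 the conditions become polynomial in the dual coordinates apart from
        -- `y w̄`.
        scaled-fixed : ∀ y w ξ → w * ξ ≈ 1# → Fixed (y * ξ - a * (ξ * ξ)) → Fixed (y * bar w - a * quartic w)
        scaled-fixed y w ξ wξ≈1 f = fixed-cong {norm w * (y * ξ - a * (ξ * ξ))} {y * bar w - a * quartic w}
          (trans (reduce (bar w) wξ≈1) (+-congˡ {y * bar w} (-‿cong (*-congˡ {a} (trans (*-congʳ {ξ} (bar-5 q≡5 w)) (cancel wξ≈1))))))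
          (fixed-* {norm w} {y * ξ - a * (ξ * ξ)} (fixed-norm w) f)
          where
          reduce : ∀ w̄ → w * ξ ≈ 1# → w * w̄ * (y * ξ - a * (ξ * ξ)) ≈ y * w̄ - a * (w̄ * ξ)
          reduce w̄ eq = combine₁ {w * w̄ * (y * ξ - a * (ξ * ξ))} {y * w̄ - a * (w̄ * ξ)} (w̄ * (y - a * ξ)) eq (ringIdentity 5 (λ a b c d e → a :* b :* (c :* d :- e :* (d :* d)) :- (c :* b :- e :* (b :* d))
                := b :* (c :- e :* d) :* (a :* d :- :1)) (_ ∷ _ ∷ _ ∷ _ ∷ _ ∷ []))
          cancel : w * ξ ≈ 1# → w * (w * w * (w * w)) * ξ ≈ w * w * (w * w)
          cancel eq = combine₁ {w * (w * w * (w * w)) * ξ} {w * w * (w * w)} (w * w * (w * w)) eq (ringIdentity 2 (λ a b → a :* (a :* a :* (a :* a)) :* b :- a :* a :* (a :* a) := a :* a :* (a :* a)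
                :* (a :* b :- :1)) (_ ∷ _ ∷ []))

        r⁴≈1 : quartic r ≈ 1#
        r⁴≈1 = quartic-5 q≡5 fr r≉0

        -- As `r² + s² = 0`, the square of `s - r` is `- 2 r s`, and the fourth power is
        -- `4 r² s² = - 4 r⁴ = - 4`. So the denominators in `w₁` and `w₂` disappear from their
        -- fourth powers.
        [s-r]⁴≈1 : quartic (s - r) ≈ 1#
        [s-r]⁴≈1 = combine₃ {quartic (s - r)} {1#}
          (r * r + s * s - (1# + 1#) * (1# + 1#) * (r * s) + (1# + 1#) * (1# + 1#) * (r * r))
          (- ((1# + 1#) * (1# + 1#))) (- 1#) h≈0 r⁴≈1 (5≈0 q≡5) (ringIdentity 2 (λ a b → (a :- b) :* (a :- b) :* ((a :- b) :* (a :- b)) :- :1 := (b :* b :+ a :* a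
                :- (:1 :+ :1) :* (:1 :+ :1) :* (b :* a) :+ (:1 :+ :1) :* (:1 :+ :1) :* (b :* b))
                :* (b :* b :+ a :* a :- :0) :+ (:- ((:1 :+ :1) :* (:1 :+ :1))) :* (b :* b :* (b
                :* b) :- :1) :+ (:- :1) :* (:1 :+ :1 :+ :1 :+ :1 :+ :1 :- :0)) (_ ∷ _ ∷ []))

        quartic-cong : ∀ {x y} → x ≈ y → quartic x ≈ quartic y
        quartic-cong {x} {y} eq = *-cong {x * x} {y * y} (*-cong {x} {y} eq eq) (*-cong {x} {y} eq eq)

        unscale : ∀ w z → (s - r) * w ≈ z → quartic w ≈ quartic z
        unscale w z eq = trans (combine₁ {quartic w} {quartic ((s - r) * w)} (- quartic w) [s-r]⁴≈1 (ringIdentity 3 (λ a b c → a :* a :* (a :* a) :- (b :- c) :* a :* ((b :- c) :* a) :* ((b :- c)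
              :* a :* ((b :- c) :* a)) := (:- (a :* a :* (a :* a))) :* ((b :- c) :* (b :- c) :* ((b
              :- c) :* (b :- c)) :- :1)) (_ ∷ _ ∷ _ ∷ []))) (quartic-cong eq)

        quartics : quartic (s * v - r * u) + quartic (s * u - r * v) ≈
          (1# + 1#) * (quartic u + quartic v) - (1# + 1#) * ((1# + 1#) * (1# + 1# + 1#)) * (u * u * (v * v))
        quartics = combine₂
          {quartic (s * v - r * u) + quartic (s * u - r * v)}
          {(1# + 1#) * (quartic u + quartic v) - (1# + 1#) * ((1# + 1#) * (1# + 1# + 1#)) * (u * u * (v * v))}
          ((r * r + s * s - (1# + 1#) * (r * r)) * (quartic u + quartic v)
            - (1# + 1#) * (1# + 1#) * (r * s) * (u * u * u * v + u * v * v * v)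
            + (1# + 1#) * ((1# + 1#) * (1# + 1# + 1#)) * (r * r) * (u * u * (v * v)))
          ((1# + 1#) * (quartic u + quartic v) - (1# + 1#) * ((1# + 1#) * (1# + 1# + 1#)) * (u * u * (v * v)))
          h≈0 r⁴≈1 (ringIdentity 4 (λ a b c d → (a :* b :- c :* d) :* (a :* b :- c :* d) :* ((a :* b :- c :* d) :* (a
                :* b :- c :* d)) :+ (a :* d :- c :* b) :* (a :* d :- c :* b) :* ((a :* d :- c :* b)
                :* (a :* d :- c :* b)) :- ((:1 :+ :1) :* (d :* d :* (d :* d) :+ b :* b :* (b :* b))
                :- (:1 :+ :1) :* ((:1 :+ :1) :* (:1 :+ :1 :+ :1)) :* (d :* d :* (b :* b))) := ((c
                :* c :+ a :* a :- (:1 :+ :1) :* (c :* c)) :* (d :* d :* (d :* d) :+ b :* b :* (b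
                :* b)) :- (:1 :+ :1) :* (:1 :+ :1) :* (c :* a) :* (d :* d :* d :* b :+ d :* b :* b
                :* b) :+ (:1 :+ :1) :* ((:1 :+ :1) :* (:1 :+ :1 :+ :1)) :* (c :* c) :* (d :* d
                :* (b :* b))) :* (c :* c :+ a :* a :- :0) :+ ((:1 :+ :1) :* (d :* d :* (d :* d)
                :+ b :* b :* (b :* b)) :- (:1 :+ :1) :* ((:1 :+ :1) :* (:1 :+ :1 :+ :1)) :* (d
                :* d :* (b :* b))) :* (c :* c :* (c :* c) :- :1)) (_ ∷ _ ∷ _ ∷ _ ∷ []))

        h : Carrier
        h = u * u - v * v

        -- Modulo 5 the coefficient 12 in `quartics` is 2, which completes the square `(u² - v²)²`.
        total : quartic u + quartic v - (quartic w₁ + quartic w₂) ≈ - (h * h)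
        total = trans (+-congˡ {quartic u + quartic v} (-‿cong
            (trans (+-cong {quartic w₁} (unscale w₁ (s * v - r * u) w₁≈) (unscale w₂ (s * u - r * v) w₂≈)) quartics)))
          (combine₁ {quartic u + quartic v - ((1# + 1#) * (quartic u + quartic v)
              - (1# + 1#) * ((1# + 1#) * (1# + 1# + 1#)) * (u * u * (v * v)))} { - (h * h)}
            ((1# + 1#) * (u * u * (v * v))) (5≈0 q≡5) (ringIdentity 2 (λ a b → a :* a :* (a :* a) :+ b :* b :* (b :* b) :- ((:1 :+ :1) :* (a :* a :* (a
                  :* a) :+ b :* b :* (b :* b)) :- (:1 :+ :1) :* ((:1 :+ :1) :* (:1 :+ :1 :+ :1))
                  :* (a :* a :* (b :* b))) :- (:- ((a :* a :- b :* b) :* (a :* a :- b :* b))) := (:1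
                  :+ :1) :* (a :* a :* (b :* b)) :* (:1 :+ :1 :+ :1 :+ :1 :+ :1 :- :0)) (_ ∷ _ ∷ [])))

        barred : ∀ w x y → (s - r) * w ≈ s * x - r * y → (s - r) * bar w ≈ s * bar x - r * bar y
        barred w x y eq = trans (sym (_⟨*⟩′_ {s - r} (fixed-- {s} {r} fs fr) w)) (trans (bar-cong eq)
            (trans (bar-sub (s * x) (r * y)) (+-cong (fs ⟨*⟩′ x) (-‿cong (fr ⟨*⟩′ y)))))
          where
          _⟨*⟩′_ : ∀ {k} → Fixed k → ∀ x → bar (k * x) ≈ k * bar x
          _⟨*⟩′_ {k} fk x = trans (bar-* k x) (*-congʳ fk)

        mixed : Carrier
        mixed = u * bar w₁ + v * bar w₂

        mixed≈ : ∀ ū v̄ w̄₁ w̄₂ → (s - r) * w̄₁ ≈ s * v̄ - r * ū → (s - r) * w̄₂ ≈ s * ū - r * v̄ →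
          (s - r) * (u * w̄₁ + v * w̄₂) ≈ s * (u * v̄ + v * ū) - r * (u * ū + v * v̄)
        mixed≈ ū v̄ w̄₁ w̄₂ e e′ = combine₂ {(s - r) * (u * w̄₁ + v * w̄₂)}
          {s * (u * v̄ + v * ū) - r * (u * ū + v * v̄)} u v e e′ (ringIdentity 8 (λ a b c d e f g h → (a :- b) :* (c :* d :+ e :* f) :- (a :* (c :* g :+ e :* h)
                :- b :* (c :* h :+ e :* g)) := c :* ((a :- b) :* d :- (a :* g :- b :* h)) :+ e
                :* ((a :- b) :* f :- (a :* h :- b :* g))) (_ ∷ _ ∷ _ ∷ _ ∷ _ ∷ _ ∷ _ ∷ _ ∷ []))

        fixed-trace : Fixed (u * bar v + v * bar u)
        fixed-trace = trans (bar-+ (u * bar v) (v * bar u)) (trans (+-cong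
          (trans (bar-* u (bar v)) (*-congˡ {bar u} (bar-involutive v)))
          (trans (bar-* v (bar u)) (*-congˡ {bar v} (bar-involutive u)))) (rearrange (bar u) (bar v)))
          where
          rearrange : ∀ ū v̄ → ū * v + v̄ * u ≈ u * v̄ + v * ū
          rearrange ū v̄ = (ringIdentity 4 (λ a b c d → a :* b :+ c :* d := d :* c :+ b :* a) (_ ∷ _ ∷ _ ∷ _ ∷ []))

        -- Multiplied by `s - r`, this is a combination over 𝔽q of the trace of `u v̄` and of the
        -- norms of `u` and `v`.
        fixed-mixed : Fixed mixed
        fixed-mixed = fixed-cong {(s - r) ⁻¹ * ((s - r) * mixed)} {mixed} (⁻¹-cancelˡ {s - r} s-r≉0 mixed)
          (fixed-* {(s - r) ⁻¹} {(s - r) * mixed} (fixed-⁻¹ {s - r} s-r≉0 (fixed-- {s} {r} fs fr))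
            (fixed-cong {s * (u * bar v + v * bar u) - r * (norm u + norm v)} {(s - r) * mixed}
              (sym (mixed≈ (bar u) (bar v) (bar w₁) (bar w₂) (barred w₁ v u w₁≈) (barred w₂ u v w₂≈)))
              (fixed-- {s * (u * bar v + v * bar u)} {r * (norm u + norm v)}
                (fixed-* {s} {u * bar v + v * bar u} fs fixed-trace)
                (fixed-* {r} {norm u + norm v} fr (fixed-+ {norm u} {norm v} (fixed-norm u) (fixed-norm v))))))

        bar-sum : ∀ ū v̄ w̄₁ w̄₂ → (s - r) * w̄₁ ≈ s * v̄ - r * ū → (s - r) * w̄₂ ≈ s * ū - r * v̄ → w̄₁ + w̄₂ ≈ ū + v̄
        bar-sum ū v̄ w̄₁ w̄₂ e e′ = combine₁ {w̄₁ + w̄₂} {ū + v̄} 1#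
          (*-cancel-0 {s - r} {w̄₁ + w̄₂ - (ū + v̄)} s-r≉0
            (combine₂ {(s - r) * (w̄₁ + w̄₂ - (ū + v̄))} {0#} 1# 1# e e′ (ringIdentity 6 (λ a b c d e f → (a :- b) :* (c :+ d :- (e :+ f)) :- :0 := :1 :* ((a :- b) :* c
                  :- (a :* f :- b :* e)) :+ :1 :* ((a :- b) :* d :- (a :* e :- b :* f))) (_ ∷ _ ∷ _ ∷ _ ∷ _ ∷ _ ∷ [])))) (ringIdentity 4 (λ a b c d → a :+ b :- (c :+ d) := :1 :* (a :+ b :- (c :+ d) :- :0)) (_ ∷ _ ∷ _ ∷ _ ∷ []))

        -- Adding the conditions of the two vertices and subtracting those of the two diagonal
        -- points removes `m`, since `w̄₁ + w̄₂ = ū + v̄`; what remains besides the fixed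
        -- `r * mixed` is `a` times the quartic difference.
        fixed-ahh : Fixed (a * (h * h))
        fixed-ahh = fixed-cong {g₃ + g₄ - (g₅ + g₆) - r * mixed} {a * (h * h)}
            (collect (bar u) (bar v) (bar w₁) (bar w₂) (quartic u) (quartic v) (quartic w₁) (quartic w₂)
              (bar-sum (bar u) (bar v) (bar w₁) (bar w₂) (barred w₁ v u w₁≈) (barred w₂ u v w₂≈)) total)
            (fixed-- {g₃ + g₄ - (g₅ + g₆)} {r * mixed}
              (fixed-- {g₃ + g₄} {g₅ + g₆}
                (fixed-+ {g₃} {g₄} (scaled-fixed m u ξ₃ uξ₃≈1 f₃) (scaled-fixed m v ξ₄ vξ₄≈1 f₄))
                (fixed-+ {g₅} {g₆} (scaled-fixed (m - r * u) w₁ ξ₅ w₁ξ₅≈1 f₅) (scaled-fixed (m - r * v) w₂ ξ₆ w₂ξ₆≈1 f₆)))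
              (fixed-* {r} {mixed} fr fixed-mixed))
          where
          g₃ = m * bar u - a * quartic u
          g₄ = m * bar v - a * quartic v
          g₅ = (m - r * u) * bar w₁ - a * quartic w₁
          g₆ = (m - r * v) * bar w₂ - a * quartic w₂
          collect : ∀ ū v̄ w̄₁ w̄₂ u⁴ v⁴ w₁⁴ w₂⁴ → w̄₁ + w̄₂ ≈ ū + v̄ → u⁴ + v⁴ - (w₁⁴ + w₂⁴) ≈ - (h * h) →
            m * ū - a * u⁴ + (m * v̄ - a * v⁴) - ((m - r * u) * w̄₁ - a * w₁⁴ + ((m - r * v) * w̄₂ - a * w₂⁴))
              - r * (u * w̄₁ + v * w̄₂) ≈ a * (h * h)
          collect ū v̄ w̄₁ w̄₂ u⁴ v⁴ w₁⁴ w₂⁴ e e′ = combine₂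
            {m * ū - a * u⁴ + (m * v̄ - a * v⁴) - ((m - r * u) * w̄₁ - a * w₁⁴ + ((m - r * v) * w̄₂ - a * w₂⁴))
              - r * (u * w̄₁ + v * w̄₂)} {a * (h * h)} (- m) (- a) e e′ (ringIdentity 13 (λ a b c d e f g h i j k l m → a :* b :- c :* d :+ (a :* e :- c :* f) :- ((a :- g
                    :* h) :* i :- c :* j :+ ((a :- g :* k) :* l :- c :* m)) :- g :* (h :* i :+ k
                    :* l) :- c :* ((h :* h :- k :* k) :* (h :* h :- k :* k)) := (:- a) :* (i :+ l
                    :- (b :+ e)) :+ (:- c) :* (d :+ f :- (j :+ m) :- (:- ((h :* h :- k :* k) :* (h
                    :* h :- k :* k))))) (_ ∷ _ ∷ _ ∷ _ ∷ _ ∷ _ ∷ _ ∷ _ ∷ _ ∷ _ ∷ _ ∷ _ ∷ _ ∷ []))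

        -- If `u² = v²`, then `ξ₄ = ± ξ₃`; the sign + is excluded by distinctness, the sign - by
        -- `subline` with ratio -1.
        h≉0 : h ≉ 0#
        h≉0 eq = [ (λ u-v≈0 → ξ₄≉ξ₃ (combine₃ {ξ₄} {ξ₃} (- ξ₄) ξ₃ (ξ₃ * ξ₄) uξ₃≈1 vξ₄≈1 u-v≈0 (ringIdentity 4 (λ a b c d → a :- b := (:- a) :* (c :* b :- :1) :+ b :* (d :* a :- :1) :+ b :* a
              :* (c :- d :- :0)) (_ ∷ _ ∷ _ ∷ _ ∷ [])))) ,
          (λ u+v≈0 → subline (- 1#) (fixed-neg {1#} bar-1)
            (combine₃ {ξ₄} { - 1# * ξ₃} (- ξ₄) (- ξ₃) (ξ₃ * ξ₄) uξ₃≈1 vξ₄≈1 u+v≈0 (ringIdentity 4 (λ a b c d → a :- (:- :1) :* b := (:- a) :* (c :* b :- :1) :+ (:- b) :* (d :* a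
                  :- :1) :+ b :* a :* (c :+ d :- :0)) (_ ∷ _ ∷ _ ∷ _ ∷ [])))) ]′
          (*≈0⇒ {u - v} {u + v} (combine₁ {(u - v) * (u + v)} {0#} 1# eq (ringIdentity 2 (λ a b → (a :- b) :* (a :+ b) :- :0 := :1 :* (a :* a :- b :* b :- :0)) (_ ∷ _ ∷ []))))

        -- As `a h²` equals its conjugate `ā h̄²`, the square of `a h² / (h h̄)` is `a ā`.
        square-norm : SquareNorm a
        square-norm = a * (h * h) * norm h ⁻¹ ,
          fixed-* {a * (h * h)} {norm h ⁻¹} fixed-ahh (fixed-⁻¹ {norm h} nh≉0 (fixed-norm h)) ,
          rewritten (bar a) (bar h) (norm h ⁻¹) (trans (sym (trans (bar-* a (h * h)) (*-congˡ {bar a} (bar-* h h)))) fixed-ahh) (⁻¹-inverse {norm h} nh≉0)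
          where
          nh≉0 : norm h ≉ 0#
          nh≉0 = norm≉0 {h} h≉0
          rewritten : ∀ ā h̄ i → ā * (h̄ * h̄) ≈ a * (h * h) → i * (h * h̄) ≈ 1# →
            a * (h * h) * i * (a * (h * h) * i) ≈ a * ā
          rewritten = general h
            where
            general : ∀ h ā h̄ i → ā * (h̄ * h̄) ≈ a * (h * h) → i * (h * h̄) ≈ 1# →
              a * (h * h) * i * (a * (h * h) * i) ≈ a * ā
            general h ā h̄ i e e′ = combine₂ {a * (h * h) * i * (a * (h * h) * i)} {a * ā}
              (- (a * (h * h) * i * i)) (a * ā * (i * (h * h̄) + 1#)) e e′ (ringIdentity 5 (λ a b c d e → a :* (b :* b) :* c :* (a :* (b :* b) :* c) :- a :* d := (:- (a :* (b
                    :* b) :* c :* c)) :* (d :* (e :* e) :- a :* (b :* b)) :+ a :* d :* (c :* (b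
                    :* e) :+ :1) :* (c :* (b :* e) :- :1)) (_ ∷ _ ∷ _ ∷ _ ∷ _ ∷ []))

      quartic-case : ⊥
      quartic-case = nonsquare square-norm

    -- Nonzero elements of 𝔽q have fourth power 1, so `s⁴ = r⁴`; as `s` is not `r`, either `s = - r`
    -- or `s² = - r²`.
    case-5 : q ≡ 5 → ⊥
    case-5 q≡5 = [ (λ s+r≈0 → harmonic-case (combine₁ {s} { - r} 1# s+r≈0 (ringIdentity 2 (λ a b → a :- (:- b) := :1 :* (a :+ b :- :0)) (_ ∷ _ ∷ [])))) , quartic-case q≡5 ]′
      (*≈0⇒ {s + r} {r * r + s * s} (*-cancel-0 {s - r} {(s + r) * (r * r + s * s)} s-r≉0
        (combine₂ {(s - r) * ((s + r) * (r * r + s * s))} {0#} 1# (- 1#)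
          (quartic-5 q≡5 fs s≉0) (quartic-5 q≡5 fr r≉0) (ringIdentity 2 (λ a b → (a :- b) :* ((a :+ b) :* (b :* b :+ a :* a)) :- :0 := :1 :* (a :* a :* (a
                :* a) :- :1) :+ (:- :1) :* (b :* b :* (b :* b) :- :1)) (_ ∷ _ ∷ [])))))

  crossing : ∀ M K M′ K′ x₀ x y y′ → y ≈ M * x₀ + K → y′ ≈ M′ * x₀ + K′ → M * x + K ≈ M′ * x + K′ →
    (M - M′) * (x - x₀) ≈ y′ - y
  crossing M K M′ K′ x₀ x y y′ e e′ e″ = combine₃ {(M - M′) * (x - x₀)} {y′ - y} 1# (- 1#) 1# e e′ e″ (ringIdentity 8 (λ a b c d e f g h → (a :- b) :* (c :- d) :- (e :- f) := :1 :* (f :- (a :* d :+ g))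
        :+ (:- :1) :* (e :- (b :* d :+ h)) :+ :1 :* (a :* c :+ g :- (b :* c :+ h))) (_ ∷ _ ∷ _ ∷ _ ∷ _ ∷ _ ∷ _ ∷ _ ∷ []))

  -- The symmetry of the unital that carries `(x₀ , y₀)` to the origin subtracts `2 a x₀` from all
  -- slopes. The fixed offset `ρ` is the height at which the line meets the special side, and it
  -- drops out.
  shifted-member : ∀ a M x₀ x y₀ y ρ → Fixed (y₀ - curve a 0# x₀) → Fixed (y - curve a 0# x) → Fixed ρ →
    y - y₀ ≈ ρ + M * (x - x₀) → Fixed ((M - (1# + 1#) * a * x₀) * (x - x₀) - a * ((x - x₀) * (x - x₀)))
  shifted-member a M x₀ x y₀ y ρ f₀ f fρ eq = fixed-cong
    {y - curve a 0# x - (y₀ - curve a 0# x₀) - ρ} {(M - (1# + 1#) * a * x₀) * (x - x₀) - a * ((x - x₀) * (x - x₀))}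
    (identity (bar x) (bar x₀))
    (fixed-- {y - curve a 0# x - (y₀ - curve a 0# x₀)} {ρ} (fixed-- {y - curve a 0# x} {y₀ - curve a 0# x₀} f f₀) fρ)
    where
    identity : ∀ x̄ x̄₀ → y - (a * (x * x) + 0# * (x * x̄)) - (y₀ - (a * (x₀ * x₀) + 0# * (x₀ * x̄₀))) - ρ
      ≈ (M - (1# + 1#) * a * x₀) * (x - x₀) - a * ((x - x₀) * (x - x₀))
    identity x̄ x̄₀ = combine₁ {y - (a * (x * x) + 0# * (x * x̄)) - (y₀ - (a * (x₀ * x₀) + 0# * (x₀ * x̄₀))) - ρ}
      {(M - (1# + 1#) * a * x₀) * (x - x₀) - a * ((x - x₀) * (x - x₀))} 1# eq (ringIdentity 9 (λ a b c d e f g h i → a :- (b :* (c :* c) :+ :0 :* (c :* d)) :- (e :- (b :* (f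
            :* f) :+ :0 :* (f :* g))) :- h :- ((i :- (:1 :+ :1) :* b :* f) :* (c :- f) :- b :* ((c
            :- f) :* (c :- f))) := :1 :* (a :- e :- (h :+ i :* (c :- f)))) (_ ∷ _ ∷ _ ∷ _ ∷ _ ∷ _ ∷ _ ∷ _ ∷ _ ∷ []))

  module _ {a : Carrier} (adm : Admissible a 0#) (nonsquare : ¬ SquareNorm a) (q-small : q ≡ 3 ⊎ q ≡ 5)
    (t : SpecialAt (𝓤 a 0#) T∞) where
    open SpecialAt t
    private
      no-O'Nan : ¬ ONanAt (𝓤 a 0#) T∞
      no-O'Nan = no-O'Nan-at-T∞ {a} {0#} adm

      Aff : Point → Set _
      Aff = Affine a 0#

      at : ∀ {X l} → (p : Aff X) → X on l → affine (proj₁ p) (proj₁ (proj₂ p)) on l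
      at {X} {l} (x , y , X∼ , _) X∈l = on-cong (affine x y) X l (∼-sym X (affine x y) X∼) X∈l

      heights : (A′ : Aff A) (B′ : Aff B) (C′ : Aff C) (E′ : Aff E) (D′ : Aff D) (D₁′ : Aff D₁) (D₂′ : Aff D₂) →
        ¬ T∞ on CE → ¬ T∞ on AC → ¬ T∞ on BE → ¬ T∞ on AE → ¬ T∞ on BC → ⊥
      heights A′@(xA , yA , ∼A , fA) B′@(xB , yB , ∼B , fB) C′@(x₃ , y₃ , ∼C , f₃) E′@(x₄ , y₄ , ∼E , f₄)
        D′@(x₀ , y₀ , ∼D , f₀) D₁′@(x₅ , y₅ , ∼D₁ , f₅) D₂′@(x₆ , y₆ , ∼D₂ , f₆) T∉CE T∉AC T∉BE T∉AE T∉BC =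
        [ case-3 adm nonsquare m u v w₁ w₂ ξ₃ ξ₄ ξ₅ ξ₆ r s fr fs r≉0 s≉0 s-r≉0 uξ₃≈1 vξ₄≈1 w₁ξ₅≈1 w₂ξ₆≈1 ξ₄≉ξ₃ w₁≈ w₂≈ g₃ g₄ g₅ g₆
        , case-5 adm nonsquare m u v w₁ w₂ ξ₃ ξ₄ ξ₅ ξ₆ r s fr fs r≉0 s≉0 s-r≉0 uξ₃≈1 vξ₄≈1 w₁ξ₅≈1 w₂ξ₆≈1 ξ₄≉ξ₃ w₁≈ w₂≈ g₃ g₄ g₅ g₆
        ]′ q-small
        where
        M₀ = slopeOf CE
        K₀ = interceptOf CE
        M₁ = slopeOf AC
        K₁ = interceptOf AC
        M₂ = slopeOf BE
        K₂ = interceptOf BE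
        M₃ = slopeOf AE
        K₃ = interceptOf AE
        M₄ = slopeOf BC
        K₄ = interceptOf BC
        r = yA - y₀
        s = yB - y₀
        ξ₃ = x₃ - x₀
        ξ₄ = x₄ - x₀
        ξ₅ = x₅ - x₀
        ξ₆ = x₆ - x₀
        u = ξ₃ ⁻¹
        v = ξ₄ ⁻¹
        w₁ = ξ₅ ⁻¹
        w₂ = ξ₆ ⁻¹
        m = M₀ - (1# + 1#) * a * x₀
        xA≈x₀ : xA ≈ x₀
        xA≈x₀ = vertical-≈ xA yA x₀ y₀ AB P∈AB (at {A} {AB} A′ A∈AB) (at {D} {AB} D′ D∈AB)
        xB≈x₀ : xB ≈ x₀
        xB≈x₀ = vertical-≈ xB yB x₀ y₀ AB P∈AB (at {B} {AB} B′ B∈AB) (at {D} {AB} D′ D∈AB)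
        height : ∀ {X l} (p : Aff X) → ¬ T∞ on l → X on l → ∀ {x} → proj₁ p ≈ x → proj₁ (proj₂ p) ≈ slopeOf l * x + interceptOf l
        height {X} {l} p@(x′ , y′ , _) T∉l X∈l {x} x′≈x = trans (on⇒height x′ y′ l T∉l (at {X} {l} p X∈l))
          (+-congʳ {interceptOf l} (*-congˡ {slopeOf l} x′≈x))
        outside : ∀ {X l} (p : Aff X) → ¬ T∞ on l → ¬ X on l → ∀ {x} → proj₁ p ≈ x → ¬ (proj₁ (proj₂ p) ≈ slopeOf l * x + interceptOf l)
        outside {X} {l} (x′ , y′ , X∼ , _) T∉l X∉l {x} x′≈x eq = X∉l (on-cong X (affine x′ y′) l X∼ (height⇒on x′ y′ l T∉l
          (trans eq (+-congʳ {interceptOf l} (*-congˡ {slopeOf l} (sym x′≈x))))))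
        hD : y₀ ≈ M₀ * x₀ + K₀
        hD = height {D} {CE} D′ T∉CE D∈CE refl
        hA₁ : yA ≈ M₁ * x₀ + K₁
        hA₁ = height {A} {AC} A′ T∉AC A∈AC xA≈x₀
        hA₃ : yA ≈ M₃ * x₀ + K₃
        hA₃ = height {A} {AE} A′ T∉AE A∈AE xA≈x₀
        hB₂ : yB ≈ M₂ * x₀ + K₂
        hB₂ = height {B} {BE} B′ T∉BE B∈BE xB≈x₀
        hB₄ : yB ≈ M₄ * x₀ + K₄
        hB₄ = height {B} {BC} B′ T∉BC B∈BC xB≈x₀
        hC₀ : y₃ ≈ M₀ * x₃ + K₀
        hC₀ = height {C} {CE} C′ T∉CE C∈CE refl
        hC₁ : y₃ ≈ M₁ * x₃ + K₁
        hC₁ = height {C} {AC} C′ T∉AC C∈AC refl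
        hC₄ : y₃ ≈ M₄ * x₃ + K₄
        hC₄ = height {C} {BC} C′ T∉BC C∈BC refl
        hE₀ : y₄ ≈ M₀ * x₄ + K₀
        hE₀ = height {E} {CE} E′ T∉CE E∈CE refl
        hE₂ : y₄ ≈ M₂ * x₄ + K₂
        hE₂ = height {E} {BE} E′ T∉BE E∈BE refl
        hE₃ : y₄ ≈ M₃ * x₄ + K₃
        hE₃ = height {E} {AE} E′ T∉AE E∈AE refl
        h5₁ : y₅ ≈ M₁ * x₅ + K₁
        h5₁ = height {D₁} {AC} D₁′ T∉AC D₁∈AC refl
        h5₂ : y₅ ≈ M₂ * x₅ + K₂
        h5₂ = height {D₁} {BE} D₁′ T∉BE D₁∈BE refl
        h6₃ : y₆ ≈ M₃ * x₆ + K₃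
        h6₃ = height {D₂} {AE} D₂′ T∉AE D₂∈AE refl
        h6₄ : y₆ ≈ M₄ * x₆ + K₄
        h6₄ = height {D₂} {BC} D₂′ T∉BC D₂∈BC refl
        fixed-vertical : ∀ {x y} → Fixed (y - curve a 0# x) → x ≈ x₀ → Fixed (y - y₀)
        fixed-vertical {x} {y} f x≈x₀ = fixed-cong {y - curve a 0# x - (y₀ - curve a 0# x₀)} {y - y₀}
          (trans (+-congʳ { - (y₀ - curve a 0# x₀)} (+-congˡ {y} (-‿cong (curve-cong a 0# x≈x₀)))) (cancel (curve a 0# x₀)))
          (fixed-- {y - curve a 0# x} {y₀ - curve a 0# x₀} f f₀)
          where
          cancel : ∀ k → y - k - (y₀ - k) ≈ y - y₀
          cancel k = (ringIdentity 3 (λ a b c → a :- b :- (c :- b) := a :- c) (_ ∷ _ ∷ _ ∷ []))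
        fr : Fixed r
        fr = fixed-vertical {xA} {yA} fA xA≈x₀
        fs : Fixed s
        fs = fixed-vertical {xB} {yB} fB xB≈x₀
        r≉0 : r ≉ 0#
        r≉0 = -≉0 {yA} {y₀} λ eq → outside {A} {CE} A′ T∉CE A∉CE xA≈x₀ (trans eq hD)
        s≉0 : s ≉ 0#
        s≉0 = -≉0 {yB} {y₀} λ eq → outside {B} {CE} B′ T∉CE B∉CE xB≈x₀ (trans eq hD)
        yA≉yB : yA ≉ yB
        yA≉yB eq = outside {A} {BE} A′ T∉BE A∉BE xA≈x₀ (trans eq hB₂)
        s-r≉0 : s - r ≉ 0#
        s-r≉0 eq = yA≉yB (difference yA yB y₀ eq)
          where
          difference : ∀ yA yB y₀ → yB - y₀ - (yA - y₀) ≈ 0# → yA ≈ yB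
          difference yA yB y₀ eq = combine₁ {yA} {yB} (- 1#) eq (ringIdentity 3 (λ a b c → a :- b := (:- :1) :* (b :- c :- (a :- c) :- :0)) (_ ∷ _ ∷ _ ∷ []))
        c₁ : (M₀ - M₁) * ξ₃ ≈ r
        c₁ = crossing M₀ K₀ M₁ K₁ x₀ x₃ y₀ yA hD hA₁ (trans (sym hC₀) hC₁)
        c₄ : (M₀ - M₄) * ξ₃ ≈ s
        c₄ = crossing M₀ K₀ M₄ K₄ x₀ x₃ y₀ yB hD hB₄ (trans (sym hC₀) hC₄)
        c₂ : (M₀ - M₂) * ξ₄ ≈ s
        c₂ = crossing M₀ K₀ M₂ K₂ x₀ x₄ y₀ yB hD hB₂ (trans (sym hE₀) hE₂)
        c₃ : (M₀ - M₃) * ξ₄ ≈ r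
        c₃ = crossing M₀ K₀ M₃ K₃ x₀ x₄ y₀ yA hD hA₃ (trans (sym hE₀) hE₃)
        c₅ : (M₁ - M₂) * ξ₅ ≈ yB - yA
        c₅ = crossing M₁ K₁ M₂ K₂ x₀ x₅ yA yB hA₁ hB₂ (trans (sym h5₁) h5₂)
        c₆ : (M₃ - M₄) * ξ₆ ≈ yB - yA
        c₆ = crossing M₃ K₃ M₄ K₄ x₀ x₆ yA yB hA₃ hB₄ (trans (sym h6₃) h6₄)
        nonzero-ξ : ∀ {M ξ d} → M * ξ ≈ d → d ≉ 0# → ξ ≉ 0#
        nonzero-ξ {M} {ξ} {d} eq d≉0 = *≉0ʳ {M} {ξ} (λ eq′ → d≉0 (trans (sym eq) eq′))
        yB-yA≉0 : yB - yA ≉ 0#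
        yB-yA≉0 = -≉0 {yB} {yA} (yA≉yB ∘ sym)
        uξ₃≈1 : u * ξ₃ ≈ 1#
        uξ₃≈1 = ⁻¹-inverse {ξ₃} (nonzero-ξ c₁ r≉0)
        vξ₄≈1 : v * ξ₄ ≈ 1#
        vξ₄≈1 = ⁻¹-inverse {ξ₄} (nonzero-ξ c₂ s≉0)
        w₁ξ₅≈1 : w₁ * ξ₅ ≈ 1#
        w₁ξ₅≈1 = ⁻¹-inverse {ξ₅} (nonzero-ξ c₅ yB-yA≉0)
        w₂ξ₆≈1 : w₂ * ξ₆ ≈ 1#
        w₂ξ₆≈1 = ⁻¹-inverse {ξ₆} (nonzero-ξ c₆ yB-yA≉0)
        ξ₄≉ξ₃ : ξ₄ ≉ ξ₃
        ξ₄≉ξ₃ eq = outside {C} {BE} C′ T∉BE C∉BE {x₄} (sym x₄≈x₃)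
          (trans hC₀ (trans (+-congʳ {K₀} (*-congˡ {M₀} (sym x₄≈x₃))) (trans (sym hE₀) hE₂)))
          where
          cancel : ∀ x y z → x - z ≈ y - z → x ≈ y
          cancel x y z eq = combine₁ {x} {y} 1# eq (ringIdentity 3 (λ a b c → a :- b := :1 :* (a :- c :- (b :- c))) (_ ∷ _ ∷ _ ∷ []))
          x₄≈x₃ : x₄ ≈ x₃
          x₄≈x₃ = cancel x₄ x₃ x₀ eq
        quotient : ∀ M ξ j d → j * ξ ≈ 1# → M * ξ ≈ d → M ≈ d * j
        quotient M ξ j d eq eq′ = combine₂ {M} {d * j} (- M) j eq eq′ (ringIdentity 4 (λ a b c d → a :- b :* c := (:- a) :* (c :* d :- :1) :+ c :* (a :* d :- b)) (_ ∷ _ ∷ _ ∷ _ ∷ []))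
        -- A difference of slopes is a difference of heights times the dual coordinate of the
        -- crossing. Measuring both slopes from `M₀`, the slope of `CE`, gives the linear relations
        -- between `u`, `v`, `w₁` and `w₂`.
        dual : ∀ w ξ y y′ M M′ k k′ → w * ξ ≈ 1# → (M - M′) * ξ ≈ y′ - y → M₀ - M ≈ k → M₀ - M′ ≈ k′ →
          (y′ - y₀ - (y - y₀)) * w ≈ k′ - k
        dual w ξ y y′ M M′ k k′ eq e e′ e″ = dual′ M₀ y₀ (quotient (M - M′) ξ w (y′ - y) eq e) e′ e″
          where
          dual′ : ∀ M₀ y₀ → M - M′ ≈ (y′ - y) * w → M₀ - M ≈ k → M₀ - M′ ≈ k′ → (y′ - y₀ - (y - y₀)) * w ≈ k′ - k
          dual′ M₀ y₀ e e′ e″ = combine₃ {(y′ - y₀ - (y - y₀)) * w} {k′ - k} (- 1#) (- 1#) 1# e e′ e″ (ringIdentity 9 (λ a b c d e f g h i → (a :- b :- (c :- b)) :* d :- (e :- f) := (:- :1) :* (g :- h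
                :- (a :- c) :* d) :+ (:- :1) :* (i :- g :- f) :+ :1 :* (i :- h :- e)) (_ ∷ _ ∷ _ ∷ _ ∷ _ ∷ _ ∷ _ ∷ _ ∷ _ ∷ []))
        d₁ : M₀ - M₁ ≈ r * u
        d₁ = quotient (M₀ - M₁) ξ₃ u r uξ₃≈1 c₁
        d₂ : M₀ - M₂ ≈ s * v
        d₂ = quotient (M₀ - M₂) ξ₄ v s vξ₄≈1 c₂
        d₃ : M₀ - M₃ ≈ r * v
        d₃ = quotient (M₀ - M₃) ξ₄ v r vξ₄≈1 c₃
        d₄ : M₀ - M₄ ≈ s * u
        d₄ = quotient (M₀ - M₄) ξ₃ u s uξ₃≈1 c₄
        w₁≈ : (s - r) * w₁ ≈ s * v - r * u
        w₁≈ = dual w₁ ξ₅ yA yB M₁ M₂ (r * u) (s * v) w₁ξ₅≈1 c₅ d₁ d₂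
        w₂≈ : (s - r) * w₂ ≈ s * u - r * v
        w₂≈ = dual w₂ ξ₆ yA yB M₃ M₄ (r * v) (s * u) w₂ξ₆≈1 c₆ d₃ d₄
        rise : ∀ {M K x y y′ } → y ≈ M * x + K → y′ ≈ M * x₀ + K → y - y₀ ≈ y′ - y₀ + M * (x - x₀)
        rise {M} {K} {x} {y} {y′} e e′ = rise′ x₀ y₀ e e′
          where
          rise′ : ∀ x₀ y₀ → y ≈ M * x + K → y′ ≈ M * x₀ + K → y - y₀ ≈ y′ - y₀ + M * (x - x₀)
          rise′ x₀ y₀ e e′ = combine₂ {y - y₀} {y′ - y₀ + M * (x - x₀)} 1# (- 1#) e e′ (ringIdentity 7 (λ a b c d e f g → a :- b :- (c :- b :+ d :* (e :- f)) := :1 :* (a :- (d :* e :+ g))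
                :+ (:- :1) :* (c :- (d :* f :+ g))) (_ ∷ _ ∷ _ ∷ _ ∷ _ ∷ _ ∷ _ ∷ []))
        fixed-y₀-y₀ : Fixed (y₀ - y₀)
        fixed-y₀-y₀ = fixed-cong {0#} {y₀ - y₀} (sym (-‿inverseʳ y₀)) bar-0
        g₃ : Fixed (m * ξ₃ - a * (ξ₃ * ξ₃))
        g₃ = shifted-member a M₀ x₀ x₃ y₀ y₃ (y₀ - y₀) f₀ f₃ fixed-y₀-y₀ (rise {M₀} {K₀} hC₀ hD)
        g₄ : Fixed (m * ξ₄ - a * (ξ₄ * ξ₄))
        g₄ = shifted-member a M₀ x₀ x₄ y₀ y₄ (y₀ - y₀) f₀ f₄ fixed-y₀-y₀ (rise {M₀} {K₀} hE₀ hD)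
        tilt : ∀ {M k ξ} → M₀ - M ≈ k → (M - (1# + 1#) * a * x₀) * ξ - a * (ξ * ξ) ≈ (m - k) * ξ - a * (ξ * ξ)
        tilt {M} {k} {ξ} e = +-congʳ { - (a * (ξ * ξ))} (*-congʳ {ξ} (tilt′ M₀ x₀ e))
          where
          tilt′ : ∀ M₀ x₀ → M₀ - M ≈ k → M - (1# + 1#) * a * x₀ ≈ M₀ - (1# + 1#) * a * x₀ - k
          tilt′ M₀ x₀ e = combine₁ {M - (1# + 1#) * a * x₀} {M₀ - (1# + 1#) * a * x₀ - k} (- 1#) e (ringIdentity 5 (λ a b c d e → a :- (:1 :+ :1) :* b :* c :- (d :- (:1 :+ :1) :* b :* c :- e) := (:-
                :1) :* (d :- a :- e)) (_ ∷ _ ∷ _ ∷ _ ∷ _ ∷ []))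
        g₅ : Fixed ((m - r * u) * ξ₅ - a * (ξ₅ * ξ₅))
        g₅ = fixed-cong {(M₁ - (1# + 1#) * a * x₀) * ξ₅ - a * (ξ₅ * ξ₅)} {(m - r * u) * ξ₅ - a * (ξ₅ * ξ₅)} (tilt {M₁} {r * u} {ξ₅} d₁)
          (shifted-member a M₁ x₀ x₅ y₀ y₅ r f₀ f₅ fr (rise {M₁} {K₁} h5₁ hA₁))
        g₆ : Fixed ((m - r * v) * ξ₆ - a * (ξ₆ * ξ₆))
        g₆ = fixed-cong {(M₃ - (1# + 1#) * a * x₀) * ξ₆ - a * (ξ₆ * ξ₆)} {(m - r * v) * ξ₆ - a * (ξ₆ * ξ₆)} (tilt {M₃} {r * v} {ξ₆} d₃)
          (shifted-member a M₃ x₀ x₆ y₀ y₆ r f₀ f₆ fr (rise {M₃} {K₃} h6₃ hA₃))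

      -- A second line through an affine point of AB and T∞ would coincide with AB.
      not-vertical : ∀ {X Y l} → Aff X → X on AB → X on l → Y on l → ¬ Y on AB → ¬ T∞ on l
      not-vertical {X} {Y} {l} p@(x , y , _) X∈AB X∈l Y∈l Y∉AB T∈l =
        Y∉AB (verticals-meet x y AB l Y P∈AB T∈l (at {X} {AB} p X∈AB) (at {X} {l} p X∈l) Y∈l)

      affine-D : Aff A → Aff B → Aff D → ⊥
      affine-D A′ B′ D′ = heights A′ B′
        (affine-point a 0# C CE C∈S C∈CE T∉CE) (affine-point a 0# E CE E∈S E∈CE T∉CE) D′
        (affine-point a 0# D₁ AC D₁∈S D₁∈AC T∉AC) (affine-point a 0# D₂ AE D₂∈S D₂∈AE T∉AE)
        T∉CE T∉AC T∉BE T∉AE T∉BC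
        where
        T∉CE = not-vertical {D} {C} {CE} D′ D∈AB D∈CE C∈CE C∉AB
        T∉AC = not-vertical {A} {C} {AC} A′ A∈AB A∈AC C∈AC C∉AB
        T∉BE = not-vertical {B} {E} {BE} B′ B∈AB B∈BE E∈BE E∉AB
        T∉AE = not-vertical {A} {E} {AE} A′ A∈AB A∈AE E∈AE E∉AB
        T∉BC = not-vertical {B} {C} {BC} B′ B∈AB B∈BC C∈BC C∉AB

      -- If `D` is T∞, the sides `AB` and `CE` pass through T∞, and together with `AC` and `BE` they
      -- form an O'Nan configuration there.
      infinite-D : Aff A → Aff B → D ∼ T∞ → ⊥
      infinite-D A′ B′ D∼ = no-O'Nan record
        { X₁ = A ; X₂ = B ; X₃ = C ; X₄ = E ; X₅ = D₁ ; l₁ = AB ; l₂ = CE ; l₃ = AC ; l₄ = BE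
        ; X₁∈S = A∈S ; X₂∈S = B∈S ; X₃∈S = C∈S ; X₄∈S = E∈S ; X₅∈S = D₁∈S
        ; P∈l₁ = P∈AB ; X₁∈l₁ = A∈AB ; X₂∈l₁ = B∈AB
        ; P∈l₂ = on-cong T∞ D CE (∼-sym D T∞ D∼) D∈CE ; X₃∈l₂ = C∈CE ; X₄∈l₂ = E∈CE
        ; X₁∈l₃ = A∈AC ; X₃∈l₃ = C∈AC ; X₅∈l₃ = D₁∈AC
        ; X₂∈l₄ = B∈BE ; X₄∈l₄ = E∈BE ; X₅∈l₄ = D₁∈BE
        ; P∉l₃ = not-vertical {A} {C} {AC} A′ A∈AB A∈AC C∈AC C∉AB
        ; P∉l₄ = not-vertical {B} {E} {BE} B′ B∈AB B∈BE E∈BE E∉AB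
        ; X₁∉l₄ = A∉BE ; X₄∉l₃ = E∉AC ; X₁∉l₂ = A∉CE
        }

      -- If the vertex `A` is T∞, two sides through it, `AB` and `AC`, form an O'Nan configuration
      -- with the sides `BE` and `CE`, which miss it. The vertex `B` is treated likewise.
      infinite-A : A ∼ T∞ → ⊥
      infinite-A A∼ = no-O'Nan record
        { X₁ = B ; X₂ = D ; X₃ = D₁ ; X₄ = C ; X₅ = E ; l₁ = AB ; l₂ = AC ; l₃ = BE ; l₄ = CE
        ; X₁∈S = B∈S ; X₂∈S = D∈S ; X₃∈S = D₁∈S ; X₄∈S = C∈S ; X₅∈S = E∈S
        ; P∈l₁ = P∈AB ; X₁∈l₁ = B∈AB ; X₂∈l₁ = D∈AB
        ; P∈l₂ = on-cong T∞ A AC (∼-sym A T∞ A∼) A∈AC ; X₃∈l₂ = D₁∈AC ; X₄∈l₂ = C∈AC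
        ; X₁∈l₃ = B∈BE ; X₃∈l₃ = D₁∈BE ; X₅∈l₃ = E∈BE
        ; X₂∈l₄ = D∈CE ; X₄∈l₄ = C∈CE ; X₅∈l₄ = E∈CE
        ; P∉l₃ = A∉BE ∘ on-cong A T∞ BE A∼
        ; P∉l₄ = A∉CE ∘ on-cong A T∞ CE A∼
        ; X₁∉l₄ = B∉CE ; X₄∉l₃ = C∉BE ; X₁∉l₂ = B∉AC
        }

      infinite-B : B ∼ T∞ → ⊥
      infinite-B B∼ = no-O'Nan record
        { X₁ = A ; X₂ = D ; X₃ = D₁ ; X₄ = E ; X₅ = C ; l₁ = AB ; l₂ = BE ; l₃ = AC ; l₄ = CE
        ; X₁∈S = A∈S ; X₂∈S = D∈S ; X₃∈S = D₁∈S ; X₄∈S = E∈S ; X₅∈S = C∈S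
        ; P∈l₁ = P∈AB ; X₁∈l₁ = A∈AB ; X₂∈l₁ = D∈AB
        ; P∈l₂ = on-cong T∞ B BE (∼-sym B T∞ B∼) B∈BE ; X₃∈l₂ = D₁∈BE ; X₄∈l₂ = E∈BE
        ; X₁∈l₃ = A∈AC ; X₃∈l₃ = D₁∈AC ; X₅∈l₃ = C∈AC
        ; X₂∈l₄ = D∈CE ; X₄∈l₄ = E∈CE ; X₅∈l₄ = C∈CE
        ; P∉l₃ = B∉AC ∘ on-cong B T∞ AC B∼
        ; P∉l₄ = B∉CE ∘ on-cong B T∞ CE B∼
        ; X₁∉l₄ = A∉CE ; X₄∉l₃ = E∉AC ; X₁∉l₂ = A∉BE
        }

    no-special : ⊥
    no-special = [ (λ A′ → [ (λ B′ → [ affine-D A′ B′ , infinite-D A′ B′ ]′ (𝓤-cases a 0# D D∈S)) , infinite-B ]′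
      (𝓤-cases a 0# B B∈S)) , infinite-A ]′ (𝓤-cases a 0# A A∈S)

  -- Conic unitals from b in 𝔽q, classical unitals from a = 0

  𝓤-subset : ∀ {a a′ b b′} → (∀ x → Fixed (curve a b x - curve a′ b′ x)) → ∀ P → 𝓤 a b P → 𝓤 a′ b′ P
  𝓤-subset {a} {a′} {b} {b′} difference P P∈ = [ (λ (x , y , P∼ , f) → 𝓤-affine a′ b′ P x y P∼
      (fixed-cong {y - curve a b x + (curve a b x - curve a′ b′ x)} {y - curve a′ b′ x} (telescope y (curve a b x) (curve a′ b′ x))
        (fixed-+ {y - curve a b x} {curve a b x - curve a′ b′ x} f (difference x)))) , inj₂ ]′ (𝓤-cases a b P P∈)
    where
    telescope : ∀ y u v → y - u + (u - v) ≈ y - v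
    telescope y u v = (ringIdentity 3 (λ a b c → a :- b :+ (b :- c) := a :- c) (_ ∷ _ ∷ _ ∷ []))

  module _ {a b : Carrier} (fb : Fixed b) where
    drop-b : ∀ x → Fixed (curve a b x - curve a 0# x)
    drop-b x = fixed-cong {b * norm x} {curve a b x - curve a 0# x} (cancel (norm x)) (fixed-* {b} {norm x} fb (fixed-norm x))
      where
      cancel : ∀ n → b * n ≈ a * (x * x) + b * n - (a * (x * x) + 0# * n)
      cancel n = (ringIdentity 4 (λ a b c d → a :* b := c :* (d :* d) :+ a :* b :- (c :* (d :* d) :+ :0 :* b)) (_ ∷ _ ∷ _ ∷ _ ∷ []))

    add-b : ∀ x → Fixed (curve a 0# x - curve a b x)
    add-b x = fixed-cong { - (curve a b x - curve a 0# x)} {curve a 0# x - curve a b x} (flip (curve a b x) (curve a 0# x))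
      (fixed-neg {curve a b x - curve a 0# x} (drop-b x))
      where
      flip : ∀ u v → - (u - v) ≈ v - u
      flip u v = (ringIdentity 2 (λ a b → :- (a :- b) := b :- a) (_ ∷ _ ∷ []))

    -- For `b` in 𝔽q the term `b x x̄` is absorbed into the free summand `r`, so the point set is
    -- the one for `b = 0` and the identity is an equivalence.
    fixed-b⇒conic : Admissible a b → ¬ Classical (𝓤 a b) → ConicUnital (𝓤 a b)
    fixed-b⇒conic adm nonclassical = a ,
      ⇒admissible {a} {0#} (λ s fs eq → admissible⇒ {a} {b} adm s fs (trans eq discriminants)) ,
      (λ (h , nondeg , iff) → nonclassical (h , nondeg , λ P → mk⇔ (Equivalence.to (iff P) ∘ Equivalence.to (same P)) (Equivalence.from (same P) ∘ Equivalence.from (iff P)))) ,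
      identity , same
      where
      discriminants : discriminant a 0# ≈ discriminant a b
      discriminants = equal (bar 0#) (bar b) (norm a) bar-0 fb
        where
        equal : ∀ z̄ b̄ n → z̄ ≈ 0# → b̄ ≈ b → (0# - z̄) * (0# - z̄) + (1# + 1#) * (1# + 1#) * n
          ≈ (b - b̄) * (b - b̄) + (1# + 1#) * (1# + 1#) * n
        equal z̄ b̄ n e e′ = combine₂ {(0# - z̄) * (0# - z̄) + (1# + 1#) * (1# + 1#) * n}
          {(b - b̄) * (b - b̄) + (1# + 1#) * (1# + 1#) * n} z̄ (b - b̄) e e′ (ringIdentity 4 (λ a b c d → (:0 :- a) :* (:0 :- a) :+ (:1 :+ :1) :* (:1 :+ :1) :* b :- ((c :- d)
                :* (c :- d) :+ (:1 :+ :1) :* (:1 :+ :1) :* b) := a :* (a :- :0) :+ (c :- d) :* (d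
                :- c)) (_ ∷ _ ∷ _ ∷ _ ∷ []))
      same : ∀ P → 𝓤 a b P ⇔ 𝓤 a 0# P
      same P = mk⇔ (𝓤-subset {a} {a} {b} {0#} drop-b P) (𝓤-subset {a} {a} {0#} {b} add-b P)
      identity : Automorphism
      identity = record
        { onPoints  = Identity.inverse homogeneousSetoid
        ; onLines   = Identity.inverse homogeneousSetoid
        ; incidence = λ P l → mk⇔ (λ P∈l → P∈l) (λ P∈l → P∈l)
        }

  -- For a = 0 the affine equation reads y - ȳ = β x x̄ with β = b - b̄.
  module _ {a b : Carrier} (a≈0 : a ≈ 0#) (adm : Admissible a b) where
    private
      β : Carrier
      β = b - bar b

      β≉0 : β ≉ 0#
      -- With `a` and `β` both zero the discriminant would be the square of 0.
      β≉0 β≈0 = admissible⇒ {a} {b} adm 0# bar-0 (vanish β (bar a) β≈0)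
        where
        vanish : ∀ β ā → β ≈ 0# → 0# * 0# ≈ β * β + (1# + 1#) * (1# + 1#) * (a * ā)
        vanish β ā e = combine₂ {0# * 0#} {β * β + (1# + 1#) * (1# + 1#) * (a * ā)}
          (- β) (- ((1# + 1#) * (1# + 1#) * ā)) e a≈0 (ringIdentity 3 (λ a b c → :0 :* :0 :- (a :* a :+ (:1 :+ :1) :* (:1 :+ :1) :* (b :* c)) := (:- a)
                :* (a :- :0) :+ (:- ((:1 :+ :1) :* (:1 :+ :1) :* c)) :* (b :- :0)) (_ ∷ _ ∷ _ ∷ []))

      bar-β : bar β ≈ - β
      bar-β = bar[x-bar] b

      -- The equation `y z̄ - z ȳ - β x x̄ = 0` is skew-Hermitian; multiplying it by `β`, which
      -- conjugation negates, makes it Hermitian.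
      form : Fin 3 → Fin 3 → Carrier
      form 0F 0F = - (β * β)
      form 1F 2F = β
      form 2F 1F = - β
      form _  _  = 0#

      hermitian : ∀ i j → form j i ≈ form i j ^ q
      hermitian i j = trans (hermitian′ i j) (sym (bar-def (form i j)))
        where
        zero′ : 0# ≈ bar 0#
        zero′ = sym bar-0
        hermitian′ : ∀ i j → form j i ≈ bar (form i j)
        hermitian′ 0F 0F = sym (trans (⟨neg⟩ (bar-β ⟨*⟩ bar-β)) (square β))
          where
          square : ∀ β → - (- β * - β) ≈ - (β * β)
          square β = (ringIdentity 1 (λ a → :- ((:- a) :* (:- a)) := :- (a :* a)) (_ ∷ []))
        hermitian′ 0F 1F = zero′
        hermitian′ 0F 2F = zero′
        hermitian′ 1F 0F = zero′
        hermitian′ 1F 1F = zero′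
        hermitian′ 1F 2F = sym bar-β
        hermitian′ 2F 0F = zero′
        hermitian′ 2F 1F = sym (trans (⟨neg⟩ bar-β) (double β))
          where
          double : ∀ β → - - β ≈ β
          double β = (ringIdentity 1 (λ a → :- (:- a) := a) (_ ∷ []))
        hermitian′ 2F 2F = zero′

      nondegenerate : ∀ (v : Coords) → (∀ i → sum (λ j → form i j * v j) ≈ 0#) → ∀ i → v i ≈ 0#
      nondegenerate v eq 0F = *-cancel-0 {β * β} {v 0F} (*-≉0 {β} {β} β≉0 β≉0) (row₀ β (v 0F) (v 1F) (v 2F) (eq 0F))
        where
        row₀ : ∀ β x y z → - (β * β) * x + (0# * y + (0# * z + 0#)) ≈ 0# → β * β * x ≈ 0#
        row₀ β x y z e = combine₁ {β * β * x} {0#} (- 1#) e (ringIdentity 4 (λ a b c d → a :* a :* b :- :0 := (:- :1) :* ((:- (a :* a)) :* b :+ (:0 :* c :+ (:0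
              :* d :+ :0)) :- :0)) (_ ∷ _ ∷ _ ∷ _ ∷ []))
      nondegenerate v eq 1F = *-cancel-0 {β} {v 1F} β≉0 (row₂ β (v 0F) (v 1F) (v 2F) (eq 2F))
        where
        row₂ : ∀ β x y z → 0# * x + (- β * y + (0# * z + 0#)) ≈ 0# → β * y ≈ 0#
        row₂ β x y z e = combine₁ {β * y} {0#} (- 1#) e (ringIdentity 4 (λ a b c d → a :* b :- :0 := (:- :1) :* (:0 :* c :+ ((:- a) :* b :+ (:0 :* d :+
              :0)) :- :0)) (_ ∷ _ ∷ _ ∷ _ ∷ []))
      nondegenerate v eq 2F = *-cancel-0 {β} {v 2F} β≉0 (row₁ β (v 0F) (v 1F) (v 2F) (eq 1F))
        where
        row₁ : ∀ β x y z → 0# * x + (0# * y + (β * z + 0#)) ≈ 0# → β * z ≈ 0#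
        row₁ β x y z e = combine₁ {β * z} {0#} 1# e (ringIdentity 4 (λ a b c d → a :* b :- :0 := :1 :* (:0 :* c :+ (:0 :* d :+ (a :* b :+ :0)) :-
              :0)) (_ ∷ _ ∷ _ ∷ _ ∷ []))

      value : (x y z x̄ ȳ z̄ : Carrier) → Carrier
      value x y z x̄ ȳ z̄ = β * (y * z̄ - z * ȳ - β * (x * x̄))

      Vanishes : Point → Set _
      Vanishes P = sum (λ i → sum (λ j → coords P i * form i j * coords P j ^ q)) ≈ 0#

      expand : ∀ β x y z x̄ ȳ z̄ →
        x * - (β * β) * x̄ + (x * 0# * ȳ + (x * 0# * z̄ + 0#))
        + (y * 0# * x̄ + (y * 0# * ȳ + (y * β * z̄ + 0#))
        + (z * 0# * x̄ + (z * - β * ȳ + (z * 0# * z̄ + 0#)) + 0#))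
        ≈ β * (y * z̄ - z * ȳ - β * (x * x̄))
      expand β x y z x̄ ȳ z̄ = (ringIdentity 7 (λ a b c d e f g → a :* (:- (b :* b)) :* c :+ (a :* :0 :* d :+ (a :* :0 :* e :+
            :0)) :+ (f :* :0 :* c :+ (f :* :0 :* d :+ (f :* b :* e :+ :0)) :+ (g :* :0 :* c :+ (g
            :* (:- b) :* d :+ (g :* :0 :* e :+ :0)) :+ :0)) := b :* (f :* e :- g :* d :- b :* (a
            :* c))) (_ ∷ _ ∷ _ ∷ _ ∷ _ ∷ _ ∷ _ ∷ []))

      value-of : ∀ P → sum (λ i → sum (λ j → coords P i * form i j * coords P j ^ q)) ≈
        value (coords P 0F) (coords P 1F) (coords P 2F) (coords P 0F ^ q) (coords P 1F ^ q) (coords P 2F ^ q)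
      value-of P = expand β (coords P 0F) (coords P 1F) (coords P 2F) (coords P 0F ^ q) (coords P 1F ^ q) (coords P 2F ^ q)

      bar-scaled : ∀ {x k y} → x ≈ k * y → x ^ q ≈ bar k * bar y
      bar-scaled {x} {k} {y} eq = trans (bar-def x) (trans (bar-cong eq) (bar-* k y))

      scale-value : ∀ k k̄ x y z x̄ ȳ z̄ → value (k * x) (k * y) (k * z) (k̄ * x̄) (k̄ * ȳ) (k̄ * z̄) ≈ k * k̄ * value x y z x̄ ȳ z̄
      scale-value k k̄ x y z x̄ ȳ z̄ = general β
        where
        general : ∀ β → β * (k * y * (k̄ * z̄) - k * z * (k̄ * ȳ) - β * (k * x * (k̄ * x̄))) ≈ k * k̄ * (β * (y * z̄ - z * ȳ - β * (x * x̄)))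
        general β = (ringIdentity 9 (λ a b c d e f g h i → a :* (b :* c :* (d :* e) :- b :* f :* (d :* g) :- a :* (b
              :* h :* (d :* i))) := b :* d :* (a :* (c :* e :- f :* g :- a :* (h :* i)))) (_ ∷ _ ∷ _ ∷ _ ∷ _ ∷ _ ∷ _ ∷ _ ∷ _ ∷ []))

      value-cong : ∀ {x x′ y y′ z z′ u u′ v v′ w w′} → x ≈ x′ → y ≈ y′ → z ≈ z′ → u ≈ u′ → v ≈ v′ → w ≈ w′ →
        value x y z u v w ≈ value x′ y′ z′ u′ v′ w′
      value-cong e₁ e₂ e₃ e₄ e₅ e₆ = *-congˡ {β} (+-cong (+-cong (*-cong e₂ e₆) (-‿cong (*-cong e₃ e₅)))
        (-‿cong (*-congˡ {β} (*-cong e₁ e₄))))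

      scaled-value : ∀ P Q ((k , _ , _) : P ∼ Q) → sum (λ i → sum (λ j → coords P i * form i j * coords P j ^ q)) ≈
        k * bar k * value (coords Q 0F) (coords Q 1F) (coords Q 2F) (bar (coords Q 0F)) (bar (coords Q 1F)) (bar (coords Q 2F))
      scaled-value P Q (k , _ , eq) = trans (value-of P) (trans
        (value-cong (eq 0F) (eq 1F) (eq 2F) (bar-scaled (eq 0F)) (bar-scaled (eq 1F)) (bar-scaled (eq 2F)))
        (scale-value k (bar k) (coords Q 0F) (coords Q 1F) (coords Q 2F) (bar (coords Q 0F)) (bar (coords Q 1F)) (bar (coords Q 2F))))

      vanishes : ∀ P Q → P ∼ Q →
        value (coords Q 0F) (coords Q 1F) (coords Q 2F) (bar (coords Q 0F)) (bar (coords Q 1F)) (bar (coords Q 2F)) ≈ 0# → Vanishes P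
      vanishes P Q P∼Q eq = trans (scaled-value P Q P∼Q) (trans (*-congˡ eq) (zeroʳ _))

      vanishes⁻¹ : ∀ P Q → P ∼ Q → Vanishes P →
        value (coords Q 0F) (coords Q 1F) (coords Q 2F) (bar (coords Q 0F)) (bar (coords Q 1F)) (bar (coords Q 2F)) ≈ 0#
      vanishes⁻¹ P Q P∼Q@(k , k#0 , _) eq = *-cancel-0 {k * bar k} (norm≉0 {k} (#⇒≉ k#0)) (trans (sym (scaled-value P Q P∼Q)) eq)

      affine-value : ∀ x y x̄ ȳ z̄ b̄ → z̄ ≈ 1# → y - (a * (x * x) + b * (x * x̄)) - (ȳ - b̄ * (x * x̄)) ≈ y * z̄ - 1# * ȳ - (b - b̄) * (x * x̄)
      affine-value x y x̄ ȳ z̄ b̄ e = combine₂ {y - (a * (x * x) + b * (x * x̄)) - (ȳ - b̄ * (x * x̄))} {y * z̄ - 1# * ȳ - (b - b̄) * (x * x̄)}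
        (- (x * x)) (- y) a≈0 e (ringIdentity 8 (λ a b c d e f g h → a :- (b :* (c :* c) :+ d :* (c :* e)) :- (f :- g :* (c :* e))
              :- (a :* h :- :1 :* f :- (d :- g) :* (c :* e)) := (:- (c :* c)) :* (b :- :0) :+ (:- a)
              :* (h :- :1)) (_ ∷ _ ∷ _ ∷ _ ∷ _ ∷ _ ∷ _ ∷ _ ∷ []))

      bar-equation : ∀ x y → bar (y - curve a b x) ≈ bar y - bar b * (x * bar x)
      bar-equation x y = trans (bar-sub y (curve a b x)) (+-congˡ {bar y} (-‿cong (trans (bar-+ (a * (x * x)) (b * norm x))
        (trans (+-cong (trans (bar-cong (trans (*-congʳ {x * x} a≈0) (zeroˡ (x * x)))) bar-0) (trans (bar-* b (norm x)) (*-congˡ {bar b} (fixed-norm x))))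
          (+-identityˡ (bar b * norm x))))))

      fixed⇒value : ∀ x y → Fixed (y - curve a b x) → value x y 1# (bar x) (bar y) (bar 1#) ≈ 0#
      fixed⇒value x y f = trans (*-congˡ {β} (trans (sym (affine-value x y (bar x) (bar y) (bar 1#) (bar b) bar-1))
        (trans (+-congˡ {y - curve a b x} (-‿cong (trans (sym (bar-equation x y)) f))) (-‿inverseʳ (y - curve a b x))))) (zeroʳ β)

      value⇒fixed : ∀ x y → value x y 1# (bar x) (bar y) (bar 1#) ≈ 0# → Fixed (y - curve a b x)
      value⇒fixed x y eq = trans (bar-equation x y) (sym (equal (y - curve a b x) (bar y - bar b * (x * bar x))
        (trans (affine-value x y (bar x) (bar y) (bar 1#) (bar b) bar-1) (*-cancel-0 {β} β≉0 eq))))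
        where
        equal : ∀ u v → u - v ≈ 0# → u ≈ v
        equal u v e = combine₁ {u} {v} 1# e (ringIdentity 2 (λ a b → a :- b := :1 :* (a :- b :- :0)) (_ ∷ _ ∷ []))

      infinite-value : value 0# 1# 0# (bar 0#) (bar 1#) (bar 0#) ≈ 0#
      infinite-value = general β (bar 0#) (bar 1#) bar-0
        where
        general : ∀ β z̄ w̄ → z̄ ≈ 0# → β * (1# * z̄ - 0# * w̄ - β * (0# * z̄)) ≈ 0#
        general β z̄ w̄ e = combine₁ {β * (1# * z̄ - 0# * w̄ - β * (0# * z̄))} {0#} β e (ringIdentity 3 (λ a b c → a :* (:1 :* b :- :0 :* c :- a :* (:0 :* b)) :- :0 := a :* (b :- :0)) (_ ∷ _ ∷ _ ∷ []))

      ∈⇒vanishes : ∀ P → 𝓤 a b P → Vanishes P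
      ∈⇒vanishes P P∈ = [ (λ (x , y , P∼ , f) → vanishes P (affine x y) P∼ (fixed⇒value x y f)) ,
        (λ P∼ → vanishes P T∞ P∼ infinite-value) ]′ (𝓤-cases a b P P∈)

      vanishes⇒∈ : ∀ P → Vanishes P → 𝓤 a b P
      vanishes⇒∈ P eq with coords P 2F ≟ 0#
      ... | no z≉0 = 𝓤-affine a b P (coords P 0F * j) (coords P 1F * j) P∼ (value⇒fixed (coords P 0F * j) (coords P 1F * j) (vanishes⁻¹ P (affine (coords P 0F * j) (coords P 1F * j)) P∼ eq))
        where
        j = coords P 2F ⁻¹
        divide : ∀ x z j → j * z ≈ 1# → x ≈ z * (x * j)
        divide x z j e = combine₁ {x} {z * (x * j)} (- x) e (ringIdentity 3 (λ a b c → a :- b :* (a :* c) := (:- a) :* (c :* b :- :1)) (_ ∷ _ ∷ _ ∷ []))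
        P∼ : P ∼ affine (coords P 0F * j) (coords P 1F * j)
        P∼ = scaled P (affine (coords P 0F * j) (coords P 1F * j)) z≉0 (divide (coords P 0F) (coords P 2F) j (⁻¹-inverse z≉0))
          (divide (coords P 1F) (coords P 2F) j (⁻¹-inverse z≉0)) (sym (*-identityʳ (coords P 2F)))
      -- On the line at infinity the form reduces to `- β² x x̄`, which vanishes only for `x = 0`.
      ... | yes z≈0 = inj₂ (scaled P T∞ y≉0 (trans x≈0 (sym (zeroʳ (coords P 1F)))) (sym (*-identityʳ (coords P 1F))) (trans z≈0 (sym (zeroʳ (coords P 1F)))))
        where
        norm-x≈0 : norm (coords P 0F) ≈ 0#
        norm-x≈0 = *-cancel-0 {β * β} {norm (coords P 0F)} (*-≉0 {β} {β} β≉0 β≉0)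
          (isolate β (coords P 0F) (coords P 1F) (coords P 2F) (bar (coords P 0F)) (coords P 1F ^ q) (coords P 2F ^ q) z≈0
            (trans (bar-def (coords P 2F)) (trans (bar-cong z≈0) bar-0))
            (trans (sym (trans (value-of P) (value-cong refl refl refl (bar-def (coords P 0F)) refl refl))) eq))
          where
          isolate : ∀ β x y z x̄ ȳ z̄ → z ≈ 0# → z̄ ≈ 0# → β * (y * z̄ - z * ȳ - β * (x * x̄)) ≈ 0# → β * β * (x * x̄) ≈ 0#
          isolate β x y z x̄ ȳ z̄ e e′ e″ = combine₃ {β * β * (x * x̄)} {0#} (- 1#) (β * y) (- (β * ȳ)) e″ e′ e (ringIdentity 7 (λ a b c d e f g → a :* a :* (b :* c) :- :0 := (:- :1) :* (a :* (d :* e :- f :* g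
                :- a :* (b :* c)) :- :0) :+ a :* d :* (e :- :0) :+ (:- (a :* g)) :* (f :- :0)) (_ ∷ _ ∷ _ ∷ _ ∷ _ ∷ _ ∷ _ ∷ []))
        x≈0 : coords P 0F ≈ 0#
        x≈0 with coords P 0F ≟ 0#
        ... | yes e  = e
        ... | no x≉0 = contradiction norm-x≈0 (norm≉0 {coords P 0F} x≉0)
        y≉0 : coords P 1F ≉ 0#
        y≉0 y≈0 = nonzero-coordinate P x≈0 y≈0 z≈0

    classical : Classical (𝓤 a b)
    classical = form , record { hermitian = hermitian ; nondegenerate = nondegenerate } ,
      λ P → mk⇔ (∈⇒vanishes P) (vanishes⇒∈ P)

  -- Admissible b for q = 3 and q = 5

  module _ {a b : Carrier} (a≉0 : a ≉ 0#) (adm : Admissible a b) where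
    private
      N β : Carrier
      N = norm a
      β = b - bar b

      N≉0 : N ≉ 0#
      N≉0 = norm≉0 {a} a≉0

      not-square : ∀ s → Fixed s → ∀ {N′ B} → N ≈ N′ → β * β ≈ B → ¬ (s * s ≈ B + (1# + 1#) * (1# + 1#) * N′)
      not-square s fs e e′ eq = admissible⇒ {a} {b} adm s fs (trans eq (+-cong (sym e′) (*-congˡ {(1# + 1#) * (1# + 1#)} (sym e))))

    -- A nonzero `β` has `β³ = - β`, so `β² = -1` and the discriminant is `-1 + 4 N`. For `N = 1`
    -- this is 3 = 0², for `N = -1` it is -5 = 1², so it is always a square.
    fixed-b-3 : q ≡ 3 → Fixed b
    fixed-b-3 q≡3 with β ≟ 0#
    ... | yes β≈0 = equal b (bar b) β≈0
      where
      equal : ∀ x y → x - y ≈ 0# → y ≈ x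
      equal x y e = combine₁ {y} {x} (- 1#) e (ringIdentity 2 (λ a b → a :- b := (:- :1) :* (b :- a :- :0)) (_ ∷ _ ∷ []))
    ... | no β≉0 = contradiction (*≈0⇒ {N - 1#} {N + 1#} (factors N (square-3 q≡3 {N} (fixed-norm a) N≉0)))
      [ (λ e → not-square 0# bar-0 (equal N e) ββ≈-1 (combine₁ {0# * 0#} { - 1# + (1# + 1#) * (1# + 1#) * 1#} (- 1#) (3≈0 q≡3) (ringIdentity 0 (:0 :* :0 :- (:- :1 :+ (:1 :+ :1) :* (:1 :+ :1) :* :1) := (:- :1) :* (:1 :+ :1
            :+ :1 :- :0)) ([]))))
      , (λ e → not-square 1# bar-1 (equal′ N e) ββ≈-1 (combine₁ {1# * 1#} { - 1# + (1# + 1#) * (1# + 1#) * - 1#} (1# + 1#) (3≈0 q≡3) (ringIdentity 0 (:1 :* :1 :- (:- :1 :+ (:1 :+ :1) :* (:1 :+ :1) :* (:- :1)) := (:1 :+ :1) :* (:1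
            :+ :1 :+ :1 :- :0)) ([])))) ]′
      where
      factors : ∀ n → n * n ≈ 1# → (n - 1#) * (n + 1#) ≈ 0#
      factors n e = combine₁ {(n - 1#) * (n + 1#)} {0#} 1# e (ringIdentity 1 (λ a → (a :- :1) :* (a :+ :1) :- :0 := :1 :* (a :* a :- :1)) (_ ∷ []))
      equal : ∀ n → n - 1# ≈ 0# → n ≈ 1#
      equal n e = combine₁ {n} {1#} 1# e (ringIdentity 1 (λ a → a :- :1 := :1 :* (a :- :1 :- :0)) (_ ∷ []))
      equal′ : ∀ n → n + 1# ≈ 0# → n ≈ - 1#
      equal′ n e = combine₁ {n} { - 1#} 1# e (ringIdentity 1 (λ a → a :- (:- :1) := :1 :* (a :+ :1 :- :0)) (_ ∷ []))
      cubic : ∀ β → β ≉ 0# → β * (β * β) ≈ - β → β * β ≈ - 1#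
      cubic β β≉0 e = combine₁ {β * β} { - 1#} 1# (*-cancel-0 {β} {β * β + 1#} β≉0 (combine₁ {β * (β * β + 1#)} {0#} 1# e (ringIdentity 1 (λ a → a :* (a :* a :+ :1) :- :0 := :1 :* (a :* (a :* a) :- (:- a))) (_ ∷ [])))) (ringIdentity 1 (λ a → a :* a :- (:- :1) := :1 :* (a :* a :+ :1 :- :0)) (_ ∷ []))
      ββ≈-1 : β * β ≈ - 1#
      ββ≈-1 = cubic β β≉0 (trans (sym (bar-3 q≡3 β)) (bar[x-bar] b))

    -- A nonzero `β` has `β⁵ = - β`, so `B = β²` satisfies `B² = -1`, and the nonsquare `N`
    -- satisfies `N² = -1` as well; hence `B = ± N`. The discriminant `B + 4 N` is then `5 N = 0` or
    -- `3 N`, and for `N = ± 2` the latter is 1 or 4: a square in each case.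
    fixed-b-5 : q ≡ 5 → ¬ SquareNorm a → Fixed b
    fixed-b-5 q≡5 nonsquare with β ≟ 0#
    ... | yes β≈0 = equal b (bar b) β≈0
      where
      equal : ∀ x y → x - y ≈ 0# → y ≈ x
      equal x y e = combine₁ {y} {x} (- 1#) e (ringIdentity 2 (λ a b → a :- b := (:- :1) :* (b :- a :- :0)) (_ ∷ _ ∷ []))
    ... | no β≉0 = contradiction NN≈-1 (nonsquares N (β * β) ββββ≈-1 not-square)
      where
      two = 1# + 1#
      f2 : Fixed two
      f2 = fixed-+ {1#} {1#} bar-1 bar-1
      five = 5≈0 q≡5
      quintic : ∀ β → β ≉ 0# → β * (β * β * (β * β)) ≈ - β → β * β * (β * β) ≈ - 1#
      quintic β β≉0 e = combine₁ {β * β * (β * β)} { - 1#} 1# (*-cancel-0 {β} {β * β * (β * β) + 1#} β≉0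
        (combine₁ {β * (β * β * (β * β) + 1#)} {0#} 1# e (ringIdentity 1 (λ a → a :* (a :* a :* (a :* a) :+ :1) :- :0 := :1 :* (a :* (a :* a :* (a :* a))
              :- (:- a))) (_ ∷ [])))) (ringIdentity 1 (λ a → a :* a :* (a :* a) :- (:- :1) := :1 :* (a :* a :* (a :* a) :+ :1 :- :0)) (_ ∷ []))
      ββββ≈-1 : β * β * (β * β) ≈ - 1#
      ββββ≈-1 = quintic β β≉0 (trans (sym (bar-5 q≡5 β)) (bar[x-bar] b))
      split : ∀ n → n * n * (n * n) ≈ 1# → (n - 1#) * ((n + 1#) * (n * n + 1#)) ≈ 0#
      split n e = combine₁ {(n - 1#) * ((n + 1#) * (n * n + 1#))} {0#} 1# e (ringIdentity 1 (λ a → (a :- :1) :* ((a :+ :1) :* (a :* a :+ :1)) :- :0 := :1 :* (a :* a :* (a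
            :* a) :- :1)) (_ ∷ []))
      minus : ∀ n k → n - k ≈ 0# → k ≈ n
      minus n k e = combine₁ {k} {n} (- 1#) e (ringIdentity 2 (λ a b → a :- b := (:- :1) :* (b :- a :- :0)) (_ ∷ _ ∷ []))
      plus : ∀ n → n + 1# ≈ 0# → two * two ≈ n
      plus n e = combine₂ {two * two} {n} 1# (- 1#) five e (ringIdentity 1 (λ a → (:1 :+ :1) :* (:1 :+ :1) :- a := :1 :* (:1 :+ :1 :+ :1 :+ :1 :+ :1 :- :0)
            :+ (:- :1) :* (a :+ :1 :- :0)) (_ ∷ []))
      shift : ∀ n → n + 1# ≈ 0# → n ≈ - 1#
      shift n e = combine₁ {n} { - 1#} 1# e (ringIdentity 1 (λ a → a :- (:- :1) := :1 :* (a :+ :1 :- :0)) (_ ∷ []))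
      NN≈-1 : N * N ≈ - 1#
      NN≈-1 = [ (λ e → contradiction (1# , bar-1 , trans (*-identityˡ 1#) (minus N 1# e)) nonsquare) ,
        (λ e′ → [ (λ e → contradiction (two , f2 , plus N e) nonsquare) , shift (N * N) ]′ (*≈0⇒ {N + 1#} {N * N + 1#} e′)) ]′
        (*≈0⇒ {N - 1#} {(N + 1#) * (N * N + 1#)} (split N (quartic-5 q≡5 {N} (fixed-norm a) N≉0)))
      nonsquares : ∀ n B → B * B ≈ - 1# →
        (∀ s → Fixed s → ∀ {n′ B′} → n ≈ n′ → B ≈ B′ → ¬ (s * s ≈ B′ + (1# + 1#) * (1# + 1#) * n′)) → ¬ (n * n ≈ - 1#)
      nonsquares n B BB≈-1 not-square nn≈-1 =
        [ (λ e → not-square 0# bar-0 refl (sym (minus B n e)) (combine₁ {0# * 0#} {n + two * two * n} (- n) five (ringIdentity 1 (λ a → :0 :* :0 :- (a :+ (:1 :+ :1) :* (:1 :+ :1) :* a) := (:- a) :* (:1 :+ :1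
              :+ :1 :+ :1 :+ :1 :- :0)) (_ ∷ []))))
        , (λ e → [ (λ e′ → not-square 1# bar-1 (sym (minus n two e′)) (negated two e e′) (combine₁ {1# * 1#} { - two + two * two * two} (- 1#) five (ringIdentity 0 (:1 :* :1 :- (:- (:1 :+ :1) :+ (:1 :+ :1) :* (:1 :+ :1) :* (:1 :+ :1)) := (:-
              :1) :* (:1 :+ :1 :+ :1 :+ :1 :+ :1 :- :0)) ([]))))
                 , (λ e′ → not-square two f2 (sym (minus n (- two) (trans (unneg n) e′))) (negated (- two) e (trans (unneg n) e′))
                     (combine₁ {two * two} { - - two + two * two * - two} two five (ringIdentity 0 ((:1 :+ :1) :* (:1 :+ :1) :- (:- (:- (:1 :+ :1)) :+ (:1 :+ :1) :* (:1 :+ :1) :* (:- (:1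
                           :+ :1))) := (:1 :+ :1) :* (:1 :+ :1 :+ :1 :+ :1 :+ :1 :- :0)) ([])))) ]′
                 (*≈0⇒ {n - two} {n + two} (combine₂ {(n - two) * (n + two)} {0#} 1# (- 1#) nn≈-1 five (ringIdentity 1 (λ a → (a :- (:1 :+ :1)) :* (a :+ (:1 :+ :1)) :- :0 := :1 :* (a :* a :- (:- :1))
                       :+ (:- :1) :* (:1 :+ :1 :+ :1 :+ :1 :+ :1 :- :0)) (_ ∷ [])))))
        ]′ (*≈0⇒ {B - n} {B + n} (combine₂ {(B - n) * (B + n)} {0#} 1# (- 1#) BB≈-1 nn≈-1 (ringIdentity 2 (λ a b → (a :- b) :* (a :+ b) :- :0 := :1 :* (a :* a :- (:- :1)) :+ (:- :1) :* (b
              :* b :- (:- :1))) (_ ∷ _ ∷ []))))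
        where
        negated : ∀ k → B + n ≈ 0# → n - k ≈ 0# → B ≈ - k
        negated k e e′ = combine₂ {B} { - k} 1# (- 1#) e e′ (ringIdentity 3 (λ a b c → a :- (:- b) := :1 :* (a :+ c :- :0) :+ (:- :1) :* (c :- b :- :0)) (_ ∷ _ ∷ _ ∷ []))
        unneg : ∀ n → n - - two ≈ n + two
        unneg n = (ringIdentity 1 (λ a → a :- (:- (:1 :+ :1)) := a :+ (:1 :+ :1)) (_ ∷ []))

  -- Existence and exception for all odd q

  square-norm? : ∀ a → Dec (SquareNorm a)
  square-norm? a = search (λ x≈y (fx , e) → fixed-cong x≈y fx , trans (sym (*-cong x≈y x≈y)) e)
    (λ s → fixed? s ×-dec (s * s ≟ norm a))

  theorem : (a b : Carrier) → Admissible a b → ¬ Classical (𝓤 a b) →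
    (¬ (ConicUnital (𝓤 a b) × (q ≡ 3 ⊎ q ≡ 5)) → ContainsBMSpecialTripleO'Nan (𝓤 a b))
    × (ConicUnital (𝓤 a b) × (q ≡ 3 ⊎ q ≡ 5) → ¬ ContainsBMSpecialTripleO'Nan (𝓤 a b))
  theorem a b adm nonclassical = exists , absent
    where
    a≉0 : a ≉ 0#
    a≉0 a≈0 = nonclassical (classical {a} {b} a≈0 adm)
    exists : ¬ (ConicUnital (𝓤 a b) × (q ≡ 3 ⊎ q ≡ 5)) → ContainsBMSpecialTripleO'Nan (𝓤 a b)
    exists exception = cases (oddPrimePower-cases opp) (square-norm? a)
      where
      conic : Fixed b → ConicUnital (𝓤 a b)
      conic fb = fixed-b⇒conic {a} {b} fb adm nonclassical
      cases : q ≡ 3 ⊎ q ≡ 5 ⊎ 7 ≤ q → Dec (SquareNorm a) → ContainsBMSpecialTripleO'Nan (𝓤 a b)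
      cases (inj₁ q≡3) _ = contradiction (conic (fixed-b-3 {a} {b} a≉0 adm q≡3) , inj₁ q≡3) exception
      cases (inj₂ (inj₁ q≡5)) (yes square) = contains-square a b a≉0 square (ℕ.≤-reflexive (≡.sym q≡5))
      cases (inj₂ (inj₁ q≡5)) (no nonsquare) =
        contradiction (conic (fixed-b-5 {a} {b} a≉0 adm q≡5 nonsquare) , inj₂ q≡5) exception
      cases (inj₂ (inj₂ 7≤q)) (yes square) = contains-square a b a≉0 square (ℕ.≤-trans (ℕ.m≤n+m 5 2) 7≤q)
      cases (inj₂ (inj₂ 7≤q)) (no nonsquare) = contains-nonsquare a b a≉0 nonsquare 7≤q
    absent : ConicUnital (𝓤 a b) × (q ≡ 3 ⊎ q ≡ 5) → ¬ ContainsBMSpecialTripleO'Nan (𝓤 a b)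
    absent ((a′ , adm′ , nonclassical′ , equivalent) , q-small) (t , special) =
      no-special {a′} adm′ nonsquare q-small (special-transfers {a} {b} {a′} adm a′≉0 nonsquare equivalent (flatten (𝓤 a b) t special))
      where
      a′≉0 : a′ ≉ 0#
      a′≉0 a′≈0 = nonclassical′ (classical {a′} {0#} a′≈0 adm′)
      nonsquare : ¬ SquareNorm a′
      -- For `b = 0` the discriminant is `4 N(a′)`, so a fixed square root `s` of the norm would
      -- give the root `2 s`.
      nonsquare (s , fs , ss≈N) = admissible⇒ {a′} {0#} adm′ ((1# + 1#) * s)
        (fixed-* {1# + 1#} {s} (fixed-+ {1#} {1#} bar-1 bar-1) fs) (quadruple (bar 0#) (norm a′) bar-0 ss≈N)
        where
        quadruple : ∀ z̄ N → z̄ ≈ 0# → s * s ≈ N → (1# + 1#) * s * ((1# + 1#) * s) ≈ (0# - z̄) * (0# - z̄) + (1# + 1#) * (1# + 1#) * N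
        quadruple z̄ N e e′ = combine₂ {(1# + 1#) * s * ((1# + 1#) * s)} {(0# - z̄) * (0# - z̄) + (1# + 1#) * (1# + 1#) * N}
          (- z̄) ((1# + 1#) * (1# + 1#)) e e′ (ringIdentity 3 (λ a b c → (:1 :+ :1) :* a :* ((:1 :+ :1) :* a) :- ((:0 :- b) :* (:0 :- b) :+ (:1
                :+ :1) :* (:1 :+ :1) :* c) := (:- b) :* (b :- :0) :+ (:1 :+ :1) :* (:1 :+ :1) :* (a
                :* a :- c)) (_ ∷ _ ∷ _ ∷ []))

open import Data.Nat.Base using (_^_)

theorem6 : ∀ {c ℓ₁ ℓ₂} (F : HeytingField c ℓ₁ ℓ₂) (q : ℕ) →
    OddPrimePower q → HasSize F (q ^ 2) →
    let open HeytingField F using (Carrier)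
        open Plane F q
    in
    (a b : Carrier) → Admissible a b → ¬ Classical (𝓤 a b) →
    (¬ (ConicUnital (𝓤 a b) × (q ≡ 3 ⊎ q ≡ 5)) → ContainsBMSpecialTripleO'Nan (𝓤 a b))
    × (ConicUnital (𝓤 a b) × (q ≡ 3 ⊎ q ≡ 5) → ¬ ContainsBMSpecialTripleO'Nan (𝓤 a b))
theorem6 = Unitals.theorem
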